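{- There exist infinitely many pairwise nonisomorphic finite posets that are minimal, under weak subposet containment, among the finite posets $P$ satisfying \[ e(P)=1\qquad\text{and}\qquad \pi^-(P)>1. \]
   Context: A family $\mathcal G$ of sets is a weak copy of a finite poset $(P,\leqslant)$ if there is a bijection $\psi:P\to\mathcal G$ such that $\psi(p)\subseteq\psi(p')$ whenever $p\leqslant p'$. A family $\mathcal F$ is (weak) $P$-free if no subfamily of it is a weak copy of $P$. $\mathrm{La}(n,P)$ is the maximum size of a weak $P$-free family $\mathcal F\subseteq 2^{[n]}$, and $\pi^-(P)=\liminf_{n\to\infty}\mathrm{La}(n,P)/\binom{n}{\lfloor n/2\rfloor}$. $e(P)$ is the maximum integer $k$ such that, for every $n$, the union of any $k$ consecutive layers of $2^{[n]}$ is weak $P$-free; a layer of $2^{[n]}$ is $\binom{[n]}{s}=\{Y\subseteq[n]:|Y|=s\}$. A poset $Q$ is weakly contained in (is a weak subposet of) a poset $P$ if there is an injection $\varphi:Q\to P$ such that $x\le y$ in $Q$ implies $\varphi(x)\le\varphi(y)$ in $P$. A poset $P$ in a class of finite posets is minimal under weak subposet containment if every poset in the class that is weakly contained in $P$ is isomorphic to $P$. -}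

module Defs where

open import Level using (0ℓ) renaming (suc to lsuc)
open import Data.Fin.Base using (Fin; toℕ)
open import Data.Fin.Subset using (Subset; ∣_∣) renaming (_⊆_ to _⊆ₛ_)
open import Data.Integer.Base using (+_)
open import Data.List.Base using (List; length)
open import Data.List.Membership.Propositional using () renaming (_∈_ to _∈ₗ_)
open import Data.List.Relation.Unary.Unique.Propositional using (Unique)
open import Data.Nat.Base
  using (ℕ; zero; suc; _+_; _≤_; z≤n; s≤s; ⌊_/2⌋; NonZero; >-nonZero; >-nonZero⁻¹)
open import Data.Nat.Combinatorics using (_C_; nCk≡nC[n∸k]; nCn≡1; nCk+nC[k+1]≡[n+1]C[k+1])
open import Data.Nat.Properties using (⌊n/2⌋≤n; ≤-trans; m≤m+n)
open import Data.Product.Base using (∃-syntax; Σ-syntax; _×_)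
open import Data.Rational.Base as ℚ using (ℚ; 1ℚ)
open import Function.Bundles using (_⇔_)
open import Function.Definitions using (Injective)
open import Relation.Binary.Core using (Rel)
open import Relation.Binary.Morphism.Structures using (IsOrderHomomorphism; IsOrderIsomorphism)
open import Relation.Binary.PropositionalEquality using (_≡_; subst; sym; trans)
open import Relation.Binary.Structures using (IsPartialOrder)
open import Relation.Nullary.Negation using (¬_)
open import Relation.Unary using (Pred; _∈_; _⊆_; ⋃)

-- Every finite poset is isomorphic to one whose carrier is some Fin size.
record FinPoset : Set₁ where
  field
    size           : ℕ
    _≼_            : Rel (Fin size) 0ℓ
    isPartialOrder : IsPartialOrder _≡_ _≼_

  Carrier : Set
  Carrier = Fin size

open FinPoset using (Carrier)

_≅_ : FinPoset → FinPoset → Set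
P ≅ Q = ∃[ φ ] IsOrderIsomorphism {A = Carrier P} {B = Carrier Q}
                 _≡_ _≡_ (FinPoset._≼_ P) (FinPoset._≼_ Q) φ

_WeaklyContainedIn_ : FinPoset → FinPoset → Set
Q WeaklyContainedIn P = ∃[ φ ]
    Injective {A = Carrier Q} {B = Carrier P} _≡_ _≡_ φ
  × IsOrderHomomorphism _≡_ _≡_ (FinPoset._≼_ Q) (FinPoset._≼_ P) φ

IsMinimal : Pred FinPoset (lsuc 0ℓ) → Pred FinPoset (lsuc 0ℓ)
IsMinimal 𝒞 P = P ∈ 𝒞 × (∀ Q → Q ∈ 𝒞 → Q WeaklyContainedIn P → Q ≅ P)

Family : ℕ → Set₁
Family n = Pred (Subset n) 0ℓ

HasSize : ∀ {n} → Family n → ℕ → Set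
HasSize 𝓕 k = ∃[ xs ] Unique xs × length xs ≡ k × (∀ Y → Y ∈ 𝓕 ⇔ Y ∈ₗ xs)

record _IsWeakCopyOf_ {n} (𝓖 : Family n) (P : FinPoset) : Set where
  open FinPoset P using (_≼_)
  field
    ψ          : Carrier P → Subset n
    ψ∈𝓖        : ∀ p → ψ p ∈ 𝓖
    injective  : Injective _≡_ _≡_ ψ
    surjective : ∀ {Y} → Y ∈ 𝓖 → ∃[ p ] ψ p ≡ Y
    monotone   : ∀ {p p′} → p ≼ p′ → ψ p ⊆ₛ ψ p′

_IsFree_ : ∀ {n} → FinPoset → Family n → Set₁
P IsFree 𝓕 = ∀ 𝓖 → 𝓖 ⊆ 𝓕 → ¬ (𝓖 IsWeakCopyOf P)

IsMaximum : Pred ℕ (lsuc 0ℓ) → ℕ → Set₁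
IsMaximum S m = m ∈ S × (∀ k → k ∈ S → k ≤ m)

Layer : ∀ n → ℕ → Family n
Layer n s Y = ∣ Y ∣ ≡ s

ConsecutiveLayers : ∀ n → ℕ → ℕ → Family n
ConsecutiveLayers n s k = ⋃[ i ∶ Fin k ] Layer n (s + toℕ i)

-- e(P) = k.  The bound s + k ≤ suc n says that the layers s, …, s + k - 1
-- are all layers of the n-cube.
e[_]≡_ : FinPoset → ℕ → Set₁
e[ P ]≡ k = IsMaximum (λ j → ∀ n s → s + j ≤ suc n → P IsFree ConsecutiveLayers n s j) k

-- La(n,P) = m.
La[_,_]≡_ : ℕ → FinPoset → ℕ → Set₁
La[ n , P ]≡ m = IsMaximum (λ k → Σ[ 𝓕 ∈ Family n ] HasSize 𝓕 k × P IsFree 𝓕) m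

-- liminf a = sup_N inf_{n ≥ N} a n is a real (or infinite) number, represented
-- here by its lower cut, i.e. by the set of rationals strictly below it: q is
-- below liminf a iff some rational c > q is a lower bound of a tail of a.
liminf : (ℕ → ℚ) → Pred ℚ 0ℓ
liminf a q = ∃[ c ] q ℚ.< c × (∃[ N ] ∀ n → N ≤ n → c ℚ.≤ a n)

nCk-nonZero : ∀ {n k} → k ≤ n → NonZero (n C k)
nCk-nonZero {n} {zero} z≤n =
  subst NonZero (sym (trans (nCk≡nC[n∸k] {0} {n} z≤n) (nCn≡1 n))) _
nCk-nonZero {suc n} {suc k} (s≤s k≤n) =
  subst NonZero (nCk+nC[k+1]≡[n+1]C[k+1] n k)
    (>-nonZero (≤-trans (>-nonZero⁻¹ (n C k) {{nCk-nonZero k≤n}}) (m≤m+n (n C k) (n C suc k))))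

_/middleBinomial_ : ℕ → ℕ → ℚ
m /middleBinomial n = ℚ._/_ (+ m) (n C ⌊ n /2⌋) {{nCk-nonZero (⌊n/2⌋≤n n)}}

-- q < π⁻(P).
_<π⁻[_] : ℚ → FinPoset → Set₁
q <π⁻[ P ] = Σ[ a ∈ (ℕ → ℕ) ] (∀ n → La[ n , P ]≡ a n) × q ∈ liminf (λ n → a n /middleBinomial n)

e≡1∧π⁻>1 : Pred FinPoset (lsuc 0ℓ)
e≡1∧π⁻>1 P = e[ P ]≡ 1 × 1ℚ <π⁻[ P ]

{-# OPTIONS --safe #-}

-- Let H be a graph of girth > g, and let P be its incidence poset (each vertex
-- is below the edges containing it).  Singletons and pairs embed P into two
-- consecutive layers, so e(P) = 1.
--
-- π⁻(P) > 1 for a suitable H.  Put k = ⌊n/2⌋ and give each i ∈ [n] a vector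
-- over 𝔽₃ of dimension k + 1.  Let F consist of the k-sets and of the
-- (k+1)-sets whose vectors span; on average the latter are half of all
-- (k+1)-sets.  A copy of P in F maps the vertices x to k-sets A x and the edges
-- to distinct spanning sets A x ∪ A y.  A random parity cut of the A x shows
-- that, if any two large vertex sets are joined by an edge, half of the A x
-- lie in a Hamming ball of bounded radius.  In this ball, colour x by
-- the sizes of A x ∖ A₀ and A₀ ∖ A x and by the values, at boundedly many
-- vectors, of a functional vanishing on A x.  With boundedly many colours, the
-- edges inside a colour class have bounded degree, so H has an independent set
-- of linear size, which is excluded by construction.  Such an H is obtained
-- greedily, adding only edges between distant vertices.
--
-- Small subposets Q of P are forests and have π⁻(Q) ≤ 1.  By the LYM weighting,
-- a family of (1 + ε) times the middle binomial coefficient has many comparable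
-- pairs, hence a part of large minimum degree, where a forest can be
-- embedded leaf by leaf.
--
-- Therefore a minimal poset of the class below P has more than g elements.

module Submission where

open import Defs
open import Level using (0ℓ; Lift; lift; lower) renaming (suc to lsuc)
open import Axiom.ExcludedMiddle using (ExcludedMiddle)
open import Data.Bool.Base using (Bool; true; false; if_then_else_; _∧_; _xor_; not)
open import Data.Empty using (⊥; ⊥-elim)
open import Data.Fin.Base using (Fin; zero; suc; toℕ; _↑ˡ_; _↑ʳ_; splitAt; join)
open import Data.Fin.Subset using (Subset; ∣_∣; ⁅_⁆; _∪_) renaming (_∈_ to _∈ₛ_; _∉_ to _∉ₛ_; _⊆_ to _⊆ₛ_)
open import Data.List.Base using (List; []; _∷_; [_]; _++_; length; map; allFin; concatMap; filter; lookup; cartesianProduct; tabulate; upTo)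
open import Data.List.Membership.Propositional using (_∈_; _∉_)
open import Data.List.Relation.Unary.All using (All; []; _∷_)
open import Data.List.Relation.Unary.AllPairs using ([]; _∷_)
open import Data.List.Relation.Unary.Any using (here; there)
open import Data.List.Relation.Unary.Unique.Propositional using (Unique)
open import Data.Nat.Base using (ℕ; zero; suc; _+_; _*_; _∸_; _^_; _!; _≤_; _<_; z≤n; s≤s; z<s; ⌊_/2⌋; ⌈_/2⌉; NonZero; nonZero; >-nonZero; >-nonZero⁻¹)
open import Data.Nat.Combinatorics
  using (_C_; nCn≡1; nCk≡nC[n∸k]; nCk+nC[k+1]≡[n+1]C[k+1]; k>n⇒nCk≡0; nCk≡n!/k![n-k]!; k![n∸k]!∣n!)
open import Data.Product.Base using (Σ; Σ-syntax; ∃; ∃-syntax; _×_; _,_; proj₁; proj₂)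
open import Data.Sum.Base using (_⊎_; inj₁; inj₂; [_,_]′)
open import Data.Unit.Base using (⊤; tt)
open import Data.Vec.Base as V using (Vec; []; _∷_)
open import Function.Base using (_∘_; id; case_of_)
open import Function.Bundles using (_⇔_; mk⇔; Equivalence)
open import Function.Definitions using (Injective)
open import Relation.Binary.PropositionalEquality using (_≡_; _≢_; refl; sym; trans; cong; cong₂; subst; subst₂; module ≡-Reasoning)
open import Relation.Nullary using (¬_; Dec; yes; no; does; contradiction)
import Data.Nat.Properties as ℕₚ
open ℕₚ using (≤-trans; ≤-reflexive; *-monoʳ-≤; *-monoˡ-≤; +-identityʳ; *-mono-<; m≤m+n; m≤n+m; +-mono-≤; +-monoʳ-≤; +-monoˡ-≤; <⇒≤; n≤1+n; +-suc; ≤-refl; +-comm; +-cancelʳ-≤; +-cancelˡ-≤; *-comm; ≰⇒>; ≮⇒≥; *-zeroʳ; m+[n∸m]≡n; *-assoc; *-mono-≤; ≤-<-trans; <-≤-trans; m≤n*m; m^n>0; <-irrefl; *-identityˡ; *-identityʳ; *-distribˡ-+; ≤-pred; *-cancelʳ-≤; *-cancelˡ-≤)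
import Data.Fin.Properties as Finₚ
import Data.Fin.Subset.Properties as Subₚ
import Data.List.Properties as Listₚ
import Data.List.Membership.Propositional.Properties as Memₚ
import Data.List.Relation.Unary.Unique.Propositional.Properties as Uniqₚ
open import Data.Nat.Tactic.RingSolver using (solve-∀)
open import Relation.Binary.PropositionalEquality.Properties using () renaming (isEquivalence to ≡-isEquivalence)
open import Data.Nat.DivMod using (_mod_; m/n*n≡m)
open import Relation.Nullary.Decidable using (from-yes; _→-dec_; map′)
import Data.Integer.Base as ℤ
import Data.Integer.Properties as ℤₚ
import Data.Rational.Base as ℚ
import Data.Rational.Properties as ℚₚ
import Data.Rational.Unnormalised.Base as ℚᵘ
import Data.Rational.Unnormalised.Properties as ℚᵘₚ
open import Relation.Binary.Morphism.Structures using (IsOrderHomomorphism; IsOrderIsomorphism)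
open import Relation.Unary using (Pred) renaming (_∈_ to _∈ᵖ_)

-- The obstacle is uniformity in n: H is fixed while n grows, so only boundedly much may be recorded
-- of each A x. The ball bounds how far A x is from A₀, but not where it differs. Let an edge xy
-- inside a colour class replace a point b of A x by a point a. If a and b lie outside A₀, then A x
-- and A y have the same trace on A₀; boundedly many vectors complete this trace to a spanning
-- family, so normals that agree on them coincide and vanish on A x ∪ A y, which spans. As this is
-- impossible, a and b lie in A₀, and then a is one of the few points of A₀ ∖ A x. The dimension k +
-- 1 matters here: every k-set has a normal, although at least half of the (k+1)-sets have none. H
-- carries two sets of edges because one density cannot serve both purposes. The ball is found from
-- the cuts of `es₁`, and its radius grows with the density of `es₁`; the number of colours, hence
-- the size of the independent sets to be excluded, depends on that radius, and only the additional
-- edges `es₂` exclude them.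

module Classical (dec : (A : Set) → Dec A) where

  -- Finite sums, indicators and counting arguments.

  module FiniteSums where

    private variable
      A B : Set

    ∑ : List A → (A → ℕ) → ℕ
    ∑ []       f = 0
    ∑ (x ∷ xs) f = f x + ∑ xs f

    ∑-mono : ∀ (xs : List A) {f g : A → ℕ} → (∀ x → x ∈ xs → f x ≤ g x) → ∑ xs f ≤ ∑ xs g
    ∑-mono []       h = z≤n
    ∑-mono (x ∷ xs) h = +-mono-≤ (h x (here refl)) (∑-mono xs (λ y → h y ∘ there))

    ∑-mono′ : ∀ (xs : List A) {f g : A → ℕ} → (∀ x → f x ≤ g x) → ∑ xs f ≤ ∑ xs g
    ∑-mono′ xs h = ∑-mono xs (λ x _ → h x)

    ∑-cong : ∀ (xs : List A) {f g : A → ℕ} → (∀ x → f x ≡ g x) → ∑ xs f ≡ ∑ xs g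
    ∑-cong []       h = refl
    ∑-cong (x ∷ xs) h = cong₂ _+_ (h x) (∑-cong xs h)

    ∑-+ : ∀ (xs : List A) (f g : A → ℕ) → ∑ xs (λ x → f x + g x) ≡ ∑ xs f + ∑ xs g
    ∑-+ []       f g = refl
    ∑-+ (x ∷ xs) f g = trans (cong (f x + g x +_) (∑-+ xs f g)) (interchange (f x) (g x) (∑ xs f) (∑ xs g))
      where
      interchange : ∀ a b c d → a + b + (c + d) ≡ (a + c) + (b + d)
      interchange = solve-∀

    ∑-* : ∀ (xs : List A) c (f : A → ℕ) → ∑ xs (λ x → c * f x) ≡ c * ∑ xs f
    ∑-* []       c f = sym (*-zeroʳ c)
    ∑-* (x ∷ xs) c f = trans (cong (c * f x +_) (∑-* xs c f)) (sym (*-distribˡ-+ c (f x) _))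

    ∑-*ʳ : ∀ (xs : List A) c (f : A → ℕ) → ∑ xs (λ x → f x * c) ≡ ∑ xs f * c
    ∑-*ʳ xs c f = trans (∑-cong xs (λ x → *-comm (f x) c)) (trans (∑-* xs c f) (*-comm c _))

    ∑-const : ∀ (xs : List A) c → ∑ xs (λ _ → c) ≡ length xs * c
    ∑-const []       c = refl
    ∑-const (x ∷ xs) c = cong (c +_) (∑-const xs c)

    ∑-zero : ∀ (xs : List A) {f : A → ℕ} → (∀ x → x ∈ xs → f x ≡ 0) → ∑ xs f ≡ 0
    ∑-zero []       h = refl
    ∑-zero (x ∷ xs) h = cong₂ _+_ (h x (here refl)) (∑-zero xs (λ y → h y ∘ there))

    ∑-++ : ∀ (xs ys : List A) (f : A → ℕ) → ∑ (xs ++ ys) f ≡ ∑ xs f + ∑ ys f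
    ∑-++ []       ys f = refl
    ∑-++ (x ∷ xs) ys f = trans (cong (f x +_) (∑-++ xs ys f)) (sym (ℕₚ.+-assoc (f x) _ _))

    ∑-map : ∀ (h : A → B) (xs : List A) (f : B → ℕ) → ∑ (map h xs) f ≡ ∑ xs (f ∘ h)
    ∑-map h []       f = refl
    ∑-map h (x ∷ xs) f = cong (f (h x) +_) (∑-map h xs f)

    ∑-concatMap : ∀ (h : A → List B) (xs : List A) (f : B → ℕ) → ∑ (concatMap h xs) f ≡ ∑ xs (λ x → ∑ (h x) f)
    ∑-concatMap h []       f = refl
    ∑-concatMap h (x ∷ xs) f = trans (∑-++ (h x) _ f) (cong (∑ (h x) f +_) (∑-concatMap h xs f))

    ∑-swap : ∀ (xs : List A) (ys : List B) (f : A → B → ℕ) →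
             ∑ xs (λ x → ∑ ys (f x)) ≡ ∑ ys (λ y → ∑ xs (λ x → f x y))
    ∑-swap []       ys f = sym (trans (∑-const ys 0) (*-zeroʳ (length ys)))
    ∑-swap (x ∷ xs) ys f = trans (cong (∑ ys (f x) +_) (∑-swap xs ys f)) (sym (∑-+ ys (f x) _))

    ∑-1 : ∀ (xs : List A) → ∑ xs (λ _ → 1) ≡ length xs
    ∑-1 xs = trans (∑-const xs 1) (*-identityʳ _)

    ∈⇒≤∑ : ∀ {xs : List A} {x} (f : A → ℕ) → x ∈ xs → f x ≤ ∑ xs f
    ∈⇒≤∑ f (here refl) = m≤m+n _ _
    ∈⇒≤∑ f (there p)   = ≤-trans (∈⇒≤∑ f p) (m≤n+m _ _)

    -- Expectation arguments take this form: the outcomes of a random choice are listed,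
    -- expectations are sums over the list, and some outcome is at least as good as the average.
    ∑-average : ∀ (xs : List A) (f g : A → ℕ) → 0 < length xs → ∑ xs f ≤ ∑ xs g → ∃[ x ] x ∈ xs × f x ≤ g x
    ∑-average (x ∷ xs) f g _ h with f x ≤? g x where open ℕₚ
    ... | yes p = x , here refl , p
    ∑-average (x ∷ []) f g _ h | no p = contradiction (subst₂ _≤_ (+-identityʳ _) (+-identityʳ _) h) p
    ∑-average (x ∷ xs@(_ ∷ _)) f g _ h | no p =
      let y , y∈ , q = ∑-average xs f g z<s
                         (+-cancelˡ-≤ (g x) _ _ (≤-trans (+-monoˡ-≤ _ (<⇒≤ (≰⇒> p))) h))
      in y , there y∈ , q

    ⟦_⟧ : Set → ℕ
    ⟦ A ⟧ = if does (dec A) then 1 else 0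

    ⟦⟧-true : A → ⟦ A ⟧ ≡ 1
    ⟦⟧-true {A} a with dec A
    ... | yes _ = refl
    ... | no ¬a = contradiction a ¬a

    ⟦⟧-false : ¬ A → ⟦ A ⟧ ≡ 0
    ⟦⟧-false {A} ¬a with dec A
    ... | yes a = contradiction a ¬a
    ... | no _  = refl

    ⟦⟧-≤1 : ∀ A → ⟦ A ⟧ ≤ 1
    ⟦⟧-≤1 A with dec A
    ... | yes _ = ≤-refl
    ... | no  _ = z≤n

    ⟦⟧-≤ : ∀ {n} → (A → 1 ≤ n) → ⟦ A ⟧ ≤ n
    ⟦⟧-≤ {A} h with dec A
    ... | yes a = h a
    ... | no _  = z≤n

    ⟦⟧-mono : (A → B) → ⟦ A ⟧ ≤ ⟦ B ⟧
    ⟦⟧-mono f = ⟦⟧-≤ (λ a → ≤-reflexive (sym (⟦⟧-true (f a))))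

    ⟦⟧-cong : (A → B) → (B → A) → ⟦ A ⟧ ≡ ⟦ B ⟧
    ⟦⟧-cong f g = ℕₚ.≤-antisym (⟦⟧-mono f) (⟦⟧-mono g)

    ⟦⟧-* : ∀ A B → ⟦ A × B ⟧ ≡ ⟦ A ⟧ * ⟦ B ⟧
    ⟦⟧-* A B with dec A
    ... | yes a = trans (⟦⟧-cong proj₂ (a ,_)) (sym (+-identityʳ _))
    ... | no ¬a = ⟦⟧-false (¬a ∘ proj₁)

    ⟦⟧-⊎ : ∀ A B → ⟦ A ⊎ B ⟧ ≤ ⟦ A ⟧ + ⟦ B ⟧
    ⟦⟧-⊎ A B = ⟦⟧-≤ λ
      { (inj₁ a) → ≤-trans (≤-reflexive (sym (⟦⟧-true a))) (m≤m+n _ _)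
      ; (inj₂ b) → ≤-trans (≤-reflexive (sym (⟦⟧-true b))) (m≤n+m _ _) }

    ⟦⟧-¬ : ∀ A → ⟦ A ⟧ + ⟦ ¬ A ⟧ ≡ 1
    ⟦⟧-¬ A with dec A
    ... | yes a = cong suc (⟦⟧-false (λ ¬a → ¬a a))
    ... | no ¬a = ⟦⟧-true ¬a

    filt : (A → Set) → List A → List A
    filt P = filter (λ x → dec (P x))

    length-filt : ∀ (P : A → Set) xs → length (filt P xs) ≡ ∑ xs (λ x → ⟦ P x ⟧)
    length-filt P []       = refl
    length-filt P (x ∷ xs) with dec (P x)
    ... | yes _ = cong suc (length-filt P xs)
    ... | no  _ = length-filt P xs

    ∑-filt : ∀ (P : A → Set) xs (f : A → ℕ) → ∑ (filt P xs) f ≡ ∑ xs (λ x → ⟦ P x ⟧ * f x)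
    ∑-filt P []       f = refl
    ∑-filt P (x ∷ xs) f with dec (P x)
    ... | yes _ = cong₂ _+_ (sym (+-identityʳ _)) (∑-filt P xs f)
    ... | no  _ = ∑-filt P xs f

    ∈-filt⁺ : ∀ {P : A → Set} {xs x} → x ∈ xs → P x → x ∈ filt P xs
    ∈-filt⁺ {P = P} = Memₚ.∈-filter⁺ (λ x → dec (P x))

    ∈-filt⁻ : ∀ {P : A → Set} {xs x} → x ∈ filt P xs → x ∈ xs × P x
    ∈-filt⁻ {P = P} = Memₚ.∈-filter⁻ (λ x → dec (P x))

    filt-unique : ∀ {P : A → Set} {xs} → Unique xs → Unique (filt P xs)
    filt-unique {P = P} = Uniqₚ.filter⁺ (λ x → dec (P x))

    unique∈ : ∀ {x : A} {xs} → Unique xs → ∑ xs (λ y → ⟦ y ≡ x ⟧) ≤ 1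
    unique∈ {xs = []}     _        = z≤n
    unique∈ {x = x} {xs = y ∷ xs} (y∉ ∷ u) with dec (y ≡ x)
    ... | yes refl = s≤s (≤-reflexive (∑-zero xs λ z z∈ → ⟦⟧-false (λ { refl → All-lookup y∉ z∈ refl })))
      where open import Data.List.Relation.Unary.All using () renaming (lookup to All-lookup)
    ... | no _ = unique∈ u

    ∑-∈≤length : ∀ {xs : List A} → Unique xs → ∀ ys → ∑ xs (λ x → ⟦ x ∈ ys ⟧) ≤ length ys
    ∑-∈≤length {xs = xs} u []       = ≤-reflexive (∑-zero xs (λ x _ → ⟦⟧-false λ ()))
    ∑-∈≤length {xs = xs} u (y ∷ ys) = begin
      ∑ xs (λ x → ⟦ x ∈ y ∷ ys ⟧)  ≤⟨ ∑-mono′ xs (λ x → ≤-trans (⟦⟧-mono split) (⟦⟧-⊎ _ _)) ⟩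
      ∑ xs (λ x → ⟦ x ≡ y ⟧ + ⟦ x ∈ ys ⟧)  ≡⟨ ∑-+ xs _ _ ⟩
      ∑ xs (λ x → ⟦ x ≡ y ⟧) + ∑ xs (λ x → ⟦ x ∈ ys ⟧)  ≤⟨ +-mono-≤ (unique∈ u) (∑-∈≤length u ys) ⟩
      suc (length ys)  ∎
      where
      open ℕₚ.≤-Reasoning
      split : ∀ {x} → x ∈ y ∷ ys → (x ≡ y) ⊎ (x ∈ ys)
      split (here p)  = inj₁ p
      split (there p) = inj₂ p

    unique-⊆⇒length≤ : ∀ {xs ys : List A} → Unique xs → (∀ {x} → x ∈ xs → x ∈ ys) → length xs ≤ length ys
    unique-⊆⇒length≤ {xs = xs} {ys} u sub = begin
      length xs  ≡⟨ ∑-1 xs ⟨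
      ∑ xs (λ _ → 1)  ≤⟨ ∑-mono xs (λ x x∈ → ≤-reflexive (sym (⟦⟧-true (sub x∈)))) ⟩
      ∑ xs (λ x → ⟦ x ∈ ys ⟧)  ≤⟨ ∑-∈≤length u ys ⟩
      length ys  ∎
      where open ℕₚ.≤-Reasoning

    ∑-⊆ : ∀ {xs ys : List A} (f : A → ℕ) → Unique xs → (∀ {x} → x ∈ xs → x ∈ ys) → ∑ xs f ≤ ∑ ys f
    ∑-⊆ {xs = []}     f _        sub = z≤n
    ∑-⊆ {xs = x ∷ xs} f (x∉ ∷ u) sub with Memₚ.∈-∃++ (sub (here refl))
    ... | as , bs , refl = begin
      f x + ∑ xs f  ≤⟨ +-monoʳ-≤ (f x) (∑-⊆ f u sub′) ⟩
      f x + ∑ (as ++ bs) f  ≡⟨ cong (f x +_) (∑-++ as bs f) ⟩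
      f x + (∑ as f + ∑ bs f)  ≡⟨ swap (f x) (∑ as f) (∑ bs f) ⟩
      ∑ as f + (f x + ∑ bs f)  ≡⟨ ∑-++ as (x ∷ bs) f ⟨
      ∑ (as ++ x ∷ bs) f  ∎
      where
      open ℕₚ.≤-Reasoning
      open import Data.List.Relation.Unary.All using () renaming (lookup to All-lookup)
      swap : ∀ a b c → a + (b + c) ≡ b + (a + c)
      swap = solve-∀
      sub′ : ∀ {y} → y ∈ xs → y ∈ as ++ bs
      sub′ {y} y∈ with Memₚ.∈-++⁻ as (sub (there y∈))
      ... | inj₁ p          = Memₚ.∈-++⁺ˡ p
      ... | inj₂ (here p)   = contradiction (sym p) (All-lookup x∉ y∈)
      ... | inj₂ (there p)  = Memₚ.∈-++⁺ʳ as p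

    -- Pigeonhole, with the division by the number of colours cleared.
    popular-colour : ∀ {A B : Set} (xs : List A) (cs : List B) (c : A → B) → (∀ x → x ∈ xs → c x ∈ cs) → 0 < length cs →
                     ∃[ b ] length xs ≤ length cs * length (filt (λ x → c x ≡ b) xs)
    popular-colour xs cs c c∈ 0<cs =
      let b , _ , le = ∑-average cs (λ _ → length xs) (λ b → length cs * length (filt (λ x → c x ≡ b) xs)) 0<cs total
      in b , le
      where
      open ℕₚ.≤-Reasoning
      total : ∑ cs (λ _ → length xs) ≤ ∑ cs (λ b → length cs * length (filt (λ x → c x ≡ b) xs))
      total = begin
        ∑ cs (λ _ → length xs)  ≡⟨ ∑-const cs _ ⟩
        length cs * length xs  ≡⟨ cong (length cs *_) (∑-1 xs) ⟨
        length cs * ∑ xs (λ _ → 1)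
          ≤⟨ *-monoʳ-≤ (length cs) (∑-mono xs (λ x x∈ → subst (_≤ ∑ cs (λ b → ⟦ c x ≡ b ⟧)) (⟦⟧-true refl) (∈⇒≤∑ (λ b → ⟦ c x ≡ b ⟧) (c∈ x x∈)))) ⟩
        length cs * ∑ xs (λ x → ∑ cs (λ b → ⟦ c x ≡ b ⟧))  ≡⟨ cong (length cs *_) (∑-swap xs cs _) ⟩
        length cs * ∑ cs (λ b → ∑ xs (λ x → ⟦ c x ≡ b ⟧))  ≡⟨ ∑-* cs (length cs) _ ⟨
        ∑ cs (λ b → length cs * ∑ xs (λ x → ⟦ c x ≡ b ⟧))  ≡⟨ ∑-cong cs (λ b → cong (length cs *_) (sym (length-filt (λ x → c x ≡ b) xs))) ⟩
        ∑ cs (λ b → length cs * length (filt (λ x → c x ≡ b) xs))  ∎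

    length-allFin : ∀ n → length (allFin n) ≡ n
    length-allFin n = Listₚ.length-tabulate id

    ∑-tabulate : ∀ {n} (h : Fin n → A) (f : A → ℕ) → ∑ (tabulate h) f ≡ ∑ (allFin n) (f ∘ h)
    ∑-tabulate {n = zero}  h f = refl
    ∑-tabulate {n = suc n} h f = cong (f (h zero) +_) (trans (∑-tabulate (h ∘ suc) f) (sym (∑-tabulate suc (f ∘ h))))

    ∑-allFin-suc : ∀ {n} (f : Fin (suc n) → ℕ) → ∑ (allFin (suc n)) f ≡ f zero + ∑ (allFin n) (f ∘ suc)
    ∑-allFin-suc f = cong (f zero +_) (∑-tabulate suc f)

    -- The common form of the spaces summed over below: subsets, vectors, configurations of vectors
    -- and random choices of points.
    vecs : List A → ∀ n → List (Vec A n)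
    vecs as zero    = [ [] ]
    vecs as (suc n) = concatMap (λ a → map (a ∷_) (vecs as n)) as

    ∑-vecs : ∀ (as : List A) n (f : Vec A (suc n) → ℕ) →
             ∑ (vecs as (suc n)) f ≡ ∑ as (λ a → ∑ (vecs as n) (λ v → f (a ∷ v)))
    ∑-vecs as n f = trans (∑-concatMap _ as f) (∑-cong as (λ a → ∑-map (a ∷_) (vecs as n) f))

    length-vecs : ∀ (as : List A) n → length (vecs as n) ≡ length as ^ n
    length-vecs as zero    = refl
    length-vecs as (suc n) = begin
      length (vecs as (suc n))  ≡⟨ ∑-1 (vecs as (suc n)) ⟨
      ∑ (vecs as (suc n)) (λ _ → 1)  ≡⟨ ∑-vecs as n _ ⟩
      ∑ as (λ a → ∑ (vecs as n) (λ v → 1))  ≡⟨ ∑-cong as (λ _ → trans (∑-1 (vecs as n)) (length-vecs as n)) ⟩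
      ∑ as (λ a → length as ^ n)  ≡⟨ ∑-const as _ ⟩
      length as * length as ^ n  ∎
      where open ≡-Reasoning

    ∈-vecs : ∀ {as : List A} → (∀ a → a ∈ as) → ∀ {n} (v : Vec A n) → v ∈ vecs as n
    ∈-vecs all []      = here refl
    ∈-vecs {as = as} all (a ∷ v) = Memₚ.∈-concatMap⁺ (λ a → map (a ∷_) (vecs as _)) (lose (all a) (Memₚ.∈-map⁺ (a ∷_) (∈-vecs all v)))
      where open import Data.List.Membership.Propositional using (lose)

    vecs-unique : ∀ {as : List A} → Unique as → ∀ n → Unique (vecs as n)
    vecs-unique u zero    = [] ∷ []
    vecs-unique {A = A} {as = as} u (suc n) = go as u
      where
      vs = vecs as n
      head≡ : ∀ {x y : A} {v w : Vec A n} → _≡_ {A = Vec A (suc n)} (x ∷ v) (y ∷ w) → x ≡ y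
      head≡ refl = refl
      head∈ : ∀ {b} {v : Vec A n} xs → b ∷ v ∈ concatMap (λ a → map (a ∷_) vs) xs → b ∈ xs
      head∈ (x ∷ xs) p with Memₚ.∈-++⁻ (map (x ∷_) vs) p
      ... | inj₂ q = there (head∈ xs q)
      ... | inj₁ q with Memₚ.∈-map⁻ (x ∷_) q
      ...   | _ , _ , eq = here (head≡ eq)
      go : ∀ xs → Unique xs → Unique (concatMap (λ a → map (a ∷_) vs) xs)
      go []       _        = []
      go (x ∷ xs) (x∉ ∷ ux) = Uniqₚ.++⁺ (Uniqₚ.map⁺ (λ { refl → refl }) (vecs-unique u n)) (go xs ux)
        λ { (p , q) → disjoint p q }
        where
        open import Data.List.Relation.Unary.All using () renaming (lookup to All-lookup)
        disjoint : ∀ {v} → v ∈ map (x ∷_) vs → v ∈ concatMap (λ a → map (a ∷_) vs) xs → ⊥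
        disjoint p q with Memₚ.∈-map⁻ (x ∷_) p
        ... | _ , _ , refl = All-lookup x∉ (head∈ xs q) refl

    bools : List Bool
    bools = true ∷ false ∷ []

    ∈-bools : ∀ b → b ∈ bools
    ∈-bools true  = here refl
    ∈-bools false = there (here refl)

    subsets : ∀ n → List (Subset n)
    subsets = vecs bools

    subsets-unique : ∀ n → Unique (subsets n)
    subsets-unique = vecs-unique (((λ ()) ∷ []) ∷ [] ∷ [])

    ∈-subsets : ∀ {n} (Y : Subset n) → Y ∈ subsets n
    ∈-subsets = ∈-vecs ∈-bools

    ∑-fiber : ∀ {n} (i : Fin n) → ∑ (allFin n) (λ j → ⟦ j ≡ i ⟧) ≤ 1
    ∑-fiber {n} i = unique∈ {x = i} (Uniqₚ.allFin⁺ n)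

    ∑-⟦⟧+⟦¬⟧ : ∀ (xs : List A) (P : A → Set) → ∑ xs (λ x → ⟦ P x ⟧) + ∑ xs (λ x → ⟦ ¬ P x ⟧) ≡ length xs
    ∑-⟦⟧+⟦¬⟧ xs P = trans (sym (∑-+ xs _ _)) (trans (∑-cong xs (λ x → ⟦⟧-¬ (P x))) (∑-1 xs))

    subsetOf : ∀ {n} → (Fin n → Set) → Subset n
    subsetOf P = V.tabulate (λ i → does (dec (P i)))

    lookup-subsetOf : ∀ {n} (P : Fin n → Set) i → V.lookup (subsetOf P) i ≡ does (dec (P i))
    lookup-subsetOf P i = lookup∘tabulate _ i
      where open import Data.Vec.Properties using (lookup∘tabulate)

    ∈-subsetOf⁺ : ∀ {n} {P : Fin n → Set} {i} → P i → V.lookup (subsetOf P) i ≡ true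
    ∈-subsetOf⁺ {P = P} {i} p with dec (P i) | lookup-subsetOf P i
    ... | yes _ | eq = eq
    ... | no ¬p | eq = contradiction p ¬p

    ∈-subsetOf⁻ : ∀ {n} {P : Fin n → Set} {i} → V.lookup (subsetOf P) i ≡ true → P i
    ∈-subsetOf⁻ {P = P} {i} eq with dec (P i) | lookup-subsetOf P i
    ... | yes p | _ = p
    ... | no ¬p | eq′ = contradiction (trans (sym eq) eq′) λ ()

    ^-distribʳ-* : ∀ m a b → (a * b) ^ m ≡ a ^ m * b ^ m
    ^-distribʳ-* zero    a b = refl
    ^-distribʳ-* (suc m) a b = trans (cong (a * b *_) (^-distribʳ-* m a b)) (shuffle a b (a ^ m) (b ^ m))
      where
      shuffle : ∀ a b x y → a * b * (x * y) ≡ a * x * (b * y)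
      shuffle = solve-∀

    -- Bernoulli's inequality (1 + 1/c)^m ≥ 1 + m/c, multiplied by c^(m+1).
    bernoulli : ∀ c m → c ^ m * (c + m) ≤ c * suc c ^ m
    bernoulli c zero    = ≤-reflexive (base c)
      where
      base : ∀ c → 1 * (c + 0) ≡ c * 1
      base = solve-∀
    bernoulli c (suc m) = begin
      c * c ^ m * (c + suc m)  ≤⟨ m≤m+n _ (c ^ m * m) ⟩
      c * c ^ m * (c + suc m) + c ^ m * m  ≡⟨ expand c m (c ^ m) ⟩
      suc c * (c ^ m * (c + m))  ≤⟨ *-monoʳ-≤ (suc c) (bernoulli c m) ⟩
      suc c * (c * suc c ^ m)  ≡⟨ swap c (suc c) (suc c ^ m) ⟩
      c * (suc c * suc c ^ m)  ∎
      where
      open ℕₚ.≤-Reasoning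
      expand : ∀ c m x → c * x * (c + suc m) + x * m ≡ suc c * (x * (c + m))
      expand = solve-∀
      swap : ∀ a b x → b * (a * x) ≡ a * (b * x)
      swap = solve-∀

    -- The case m = c: c successive reductions by the factor c / (c + 1) halve a quantity. This
    -- gives the number of greedy rounds and the decay of the parity bias.
    doubling : ∀ c → 0 < c → 2 * c ^ c ≤ suc c ^ c
    doubling c 0<c = *-cancelˡ-≤ c {{>-nonZero 0<c}} (≤-trans (≤-reflexive (two c (c ^ c))) (bernoulli c c))
      where
      two : ∀ c x → c * (2 * x) ≡ x * (c + c)
      two = solve-∀

    -- Double counting of the related pairs, for an injection that is only given as a relation.
    unique-relation : ∀ {Φ : A → B → Set} {ys : List A} → Unique ys → ∀ as → (∀ {y} → y ∈ ys → ∃[ a ] a ∈ as × Φ y a) →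
                      (∀ {a y y′} → Φ y a → Φ y′ a → y ≡ y′) → length ys ≤ length as
    unique-relation {Φ = Φ} {ys} u as total functional = begin
      length ys  ≡⟨ ∑-1 ys ⟨
      ∑ ys (λ _ → 1)  ≤⟨ ∑-mono ys (λ y y∈ → let a , a∈ , φ = total y∈ in
                                                        subst (_≤ ∑ as (λ a → ⟦ Φ y a ⟧)) (⟦⟧-true φ) (∈⇒≤∑ (λ a → ⟦ Φ y a ⟧) a∈)) ⟩
      ∑ ys (λ y → ∑ as (λ a → ⟦ Φ y a ⟧))  ≡⟨ ∑-swap ys as _ ⟩
      ∑ as (λ a → ∑ ys (λ y → ⟦ Φ y a ⟧))  ≤⟨ ∑-mono′ as atMostOne ⟩
      ∑ as (λ _ → 1)  ≡⟨ ∑-1 as ⟩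
      length as  ∎
      where
      open ℕₚ.≤-Reasoning
      atMostOne : ∀ a → ∑ ys (λ y → ⟦ Φ y a ⟧) ≤ 1
      atMostOne a with dec (∃[ y ] Φ y a)
      ... | yes (y , φ) = ≤-trans (∑-mono′ ys (λ y′ → ⟦⟧-mono (λ φ′ → functional φ′ φ))) (unique∈ u)
      ... | no ¬φ       = ≤-trans (≤-reflexive (∑-zero ys (λ y _ → ⟦⟧-false (λ φ → ¬φ (y , φ))))) z≤n

    -- Greedy choice: keeping one entry discards it and at most `d` neighbours. The bound `m` drives
    -- the recursion, which continues on a filtered list.
    independent : ∀ (R : A → A → Set) d → (∀ {x y} → R x y → R y x) → (∀ {x} → ¬ R x x) → ∀ m (xs : List A) → length xs ≤ m → Unique xs →
                  (∀ {x ys} → x ∈ xs → Unique ys → (∀ {y} → y ∈ ys → R x y) → length ys ≤ d) →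
                  ∃[ I ] Unique I × (∀ {x} → x ∈ I → x ∈ xs) × (∀ {x y} → x ∈ I → y ∈ I → ¬ R x y) × length xs ≤ suc d * length I
    independent R d R-sym R-irr m       []       _   u deg = [] , [] , (λ ()) , (λ ()) , z≤n
    independent {A} R d R-sym R-irr (suc m) (x ∷ xs) (s≤s le) (x∉ ∷ u) deg =
      let I , uI , I⊆ , ind , bound = independent R d R-sym R-irr m xs′ (≤-trans (Listₚ.length-filter (λ y → dec (¬ R x y)) xs) le)
                                        (filt-unique u) (λ y∈ → deg (there (proj₁ (∈-filt⁻ {xs = xs} y∈))))
      in x ∷ I
       , All.tabulate (λ {y} y∈ e → All.lookup x∉ (proj₁ (∈-filt⁻ {xs = xs} (I⊆ y∈))) e) ∷ uI
       , (λ { (here p) → here p ; (there p) → there (proj₁ (∈-filt⁻ {xs = xs} (I⊆ p))) })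
       , (λ { (here refl) (here refl) → R-irr
            ; (here refl) (there q)   → proj₂ (∈-filt⁻ {xs = xs} (I⊆ q))
            ; (there p)   (here refl) → λ r → proj₂ (∈-filt⁻ {xs = xs} (I⊆ p)) (R-sym r)
            ; (there p)   (there q)   → ind p q })
       , (begin
          suc (length xs)  ≡⟨ cong suc (∑-⟦⟧+⟦¬⟧ xs (R x)) ⟨
          suc (∑ xs (λ y → ⟦ R x y ⟧) + ∑ xs (λ y → ⟦ ¬ R x y ⟧))  ≡⟨ cong₂ (λ a b → suc (a + b)) (sym (length-filt (R x) xs)) (sym (length-filt (λ y → ¬ R x y) xs)) ⟩
          suc (length (filt (R x) xs) + length xs′)  ≤⟨ s≤s (+-mono-≤ (deg (here refl) (filt-unique u) (λ y∈ → proj₂ (∈-filt⁻ {xs = xs} y∈))) bound) ⟩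
          suc (d + suc d * length I)  ≡⟨ ℕₚ.*-suc (suc d) (length I) ⟨
          suc d * suc (length I)  ∎)
      where
      open ℕₚ.≤-Reasoning
      import Data.List.Relation.Unary.All as All
      xs′ = filt (λ y → ¬ R x y) xs

    #-∈ₛ : ∀ {n} (p : Subset n) → ∑ (allFin n) (λ i → ⟦ i ∈ₛ p ⟧) ≡ ∣ p ∣
    #-∈ₛ []          = refl
    #-∈ₛ {suc n} (true ∷ p)  = trans (∑-allFin-suc (λ i → ⟦ i ∈ₛ true ∷ p ⟧)) (cong₂ _+_ (⟦⟧-true V.here)
      (trans (∑-cong (allFin n) (λ i → ⟦⟧-cong (λ { (V.there q) → q }) V.there)) (#-∈ₛ p)))
    #-∈ₛ {suc n} (false ∷ p) = trans (∑-allFin-suc (λ i → ⟦ i ∈ₛ false ∷ p ⟧)) (cong₂ _+_ (⟦⟧-false λ ())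
      (trans (∑-cong (allFin n) (λ i → ⟦⟧-cong (λ { (V.there q) → q }) V.there)) (#-∈ₛ p)))

    elements : ∀ {n} → Subset n → List (Fin n)
    elements {n} p = filt (_∈ₛ p) (allFin n)

    length-elements : ∀ {n} (p : Subset n) → length (elements p) ≡ ∣ p ∣
    length-elements {n} p = trans (length-filt (_∈ₛ p) (allFin n)) (#-∈ₛ p)

    ∈-elements : ∀ {n} {p : Subset n} {i} → i ∈ₛ p → i ∈ elements p
    ∈-elements {i = i} = ∈-filt⁺ (Memₚ.∈-allFin i)

    length≤# : ∀ {n} {I : List (Fin n)} → Unique I → length I ≤ ∑ (allFin n) (λ x → ⟦ x ∈ I ⟧)
    length≤# {n} {I} u = ≤-trans (unique-⊆⇒length≤ u (λ {x} x∈ → ∈-filt⁺ (Memₚ.∈-allFin x) x∈))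
                           (≤-reflexive (length-filt (_∈ I) (allFin n)))

  open FiniteSums

  -- Sparse graphs of large girth in which large vertex sets are joined.

  # : ∀ {n} → (Fin n → Set) → ℕ
  # {n} P = ∑ (allFin n) (λ i → ⟦ P i ⟧)

  Edges : ℕ → Set
  Edges N = List (Fin N × Fin N)

  module _ {N : ℕ} where

    private V = Fin N

    ends : V → V → V → List V
    ends a b w = if does (a Finₚ.≟ w) then [ b ] else []

    nbrs : Edges N → V → List V
    nbrs []             w = []
    nbrs ((a , b) ∷ es) w = ends a b w ++ (ends b a w ++ nbrs es w)

    deg : Edges N → V → ℕ
    deg es w = length (nbrs es w)

    ball : ℕ → Edges N → V → List V
    ball zero    es u = [ u ]
    ball (suc g) es u = u ∷ concatMap (ball g es) (nbrs es u)

    -- The list is a construction history, the newest edge in front. Large girth is derived from it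
    -- later by induction on the edges.
    data Good (g : ℕ) : Edges N → Set where
      []  : Good g []
      _∷_ : ∀ {u v es} → v ∉ ball g es u → Good g es → Good g ((u , v) ∷ es)

    MaxDegree : ℕ → Edges N → Set
    MaxDegree Δ es = ∀ w → deg es w ≤ Δ

    -- The sets may overlap. With P′ = P this bounds independent sets; with the two sides of a cut
    -- it says that a balanced cut is crossed.
    Joined : ℕ → Edges N → Set₁
    Joined t es = ∀ (P P′ : V → Set) → t ≤ # P → t ≤ # P′ → ∃[ e ] e ∈ es × P (proj₁ e) × P′ (proj₂ e)

    length-ends : ∀ a b w → length (ends a b w) ≡ ⟦ w ≡ a ⟧
    length-ends a b w with a Finₚ.≟ w
    ... | yes p = sym (⟦⟧-true (sym p))
    ... | no ¬p = sym (⟦⟧-false (¬p ∘ sym))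

    deg-∷ : ∀ a b es w → deg ((a , b) ∷ es) w ≡ ⟦ w ≡ a ⟧ + (⟦ w ≡ b ⟧ + deg es w)
    deg-∷ a b es w = trans (Listₚ.length-++ (ends a b w)) (cong₂ _+_ (length-ends a b w)
      (trans (Listₚ.length-++ (ends b a w)) (cong (_+ deg es w) (length-ends b a w))))

    ∑-deg : ∀ es → ∑ (allFin N) (deg es) ≤ 2 * length es
    ∑-deg []             = ≤-reflexive (∑-zero (allFin N) λ _ _ → refl)
    ∑-deg ((a , b) ∷ es) = begin
      ∑ (allFin N) (deg ((a , b) ∷ es))  ≡⟨ ∑-cong (allFin N) (deg-∷ a b es) ⟩
      ∑ (allFin N) (λ w → ⟦ w ≡ a ⟧ + (⟦ w ≡ b ⟧ + deg es w))  ≡⟨ ∑-+ (allFin N) _ _ ⟩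
      ∑ (allFin N) (λ w → ⟦ w ≡ a ⟧) + ∑ (allFin N) (λ w → ⟦ w ≡ b ⟧ + deg es w)
        ≡⟨ cong (∑ (allFin N) (λ w → ⟦ w ≡ a ⟧) +_) (∑-+ (allFin N) _ _) ⟩
      ∑ (allFin N) (λ w → ⟦ w ≡ a ⟧) + (∑ (allFin N) (λ w → ⟦ w ≡ b ⟧) + ∑ (allFin N) (deg es))
        ≤⟨ +-mono-≤ (∑-fiber a) (+-mono-≤ (∑-fiber b) (∑-deg es)) ⟩
      1 + (1 + 2 * length es)  ≡⟨ two (length es) ⟩
      2 * suc (length es)  ∎
      where
      open ℕₚ.≤-Reasoning
      two : ∀ m → 1 + (1 + 2 * m) ≡ 2 * suc m
      two = solve-∀

  -- 1 + Δ + ... + Δ^g, which bounds a ball of radius g when all degrees are at most Δ.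
  β : ℕ → ℕ → ℕ
  β Δ zero    = 1
  β Δ (suc g) = suc (Δ * β Δ g)

  length-concatMap : ∀ {A B : Set} (f : A → List B) xs m → (∀ x → length (f x) ≤ m) → length (concatMap f xs) ≤ length xs * m
  length-concatMap f []       m h = z≤n
  length-concatMap f (x ∷ xs) m h = subst (_≤ m + length xs * m) (sym (Listₚ.length-++ (f x)))
    (+-mono-≤ (h x) (length-concatMap f xs m h))

  length-ball : ∀ {N} Δ (es : Edges N) → MaxDegree Δ es → ∀ g u → length (ball g es u) ≤ β Δ g
  length-ball Δ es md zero    u = ≤-refl
  length-ball Δ es md (suc g) u = s≤s (≤-trans
    (length-concatMap (ball g es) (nbrs es u) (β Δ g) (length-ball Δ es md g)) (*-monoˡ-≤ (β Δ g) (md u)))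

  -- Edges joining distant vertices of small degree are added one at a time; by
  -- averaging, some such edge joins a positive proportion of the pairs of large
  -- sets that are not joined yet.
  module Greedy (g c Δ E N r : ℕ) (0<N : 0 < N) (0<c : 0 < c)
                (N²≤ : N * N ≤ suc c * (r * r)) (E<Δr : 2 * E < Δ * suc r) (β≤r : β Δ g ≤ r) where

    private V = Fin N

    _∈ᵇ_ : V → Subset N → Set
    u ∈ᵇ T = V.lookup T u ≡ true

    -- The factor 4 leaves room: at most `r` vertices are saturated and at most `r` lie in a given
    -- ball, so at least `r` admissible ends remain on either side.
    Large : Subset N → Set
    Large T = 4 * r ≤ # (_∈ᵇ T)

    Hit : V × V → Subset N × Subset N → Set
    Hit (u , v) (T , T′) = u ∈ᵇ T × v ∈ᵇ T′

    module Step (es : Edges N) (md : MaxDegree Δ es) (len : length es ≤ E) where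

      Allowed : V → V → Set
      Allowed u v = (deg es u < Δ) × (deg es v < Δ) × v ∉ ball g es u

      -- Handshake: more than `r` vertices of degree `Δ` or more would need more than `E` edges.
      saturated : # (λ u → ¬ (deg es u < Δ)) ≤ r
      saturated = ≮⇒≥ λ r< → <-irrefl refl (begin-strict
        Δ * suc r  ≤⟨ *-monoʳ-≤ Δ r< ⟩
        Δ * # (λ u → ¬ (deg es u < Δ))  ≡⟨ ∑-* (allFin N) Δ _ ⟨
        ∑ (allFin N) (λ u → Δ * ⟦ ¬ (deg es u < Δ) ⟧)  ≤⟨ ∑-mono′ (allFin N) big ⟩
        ∑ (allFin N) (deg es)  ≤⟨ ∑-deg es ⟩
        2 * length es  ≤⟨ *-monoʳ-≤ 2 len ⟩
        2 * E  <⟨ E<Δr ⟩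
        Δ * suc r  ∎)
        where
        open ℕₚ.≤-Reasoning
        big : ∀ u → Δ * ⟦ ¬ (deg es u < Δ) ⟧ ≤ deg es u
        big u with dec (¬ (deg es u < Δ))
        ... | yes p = ≤-trans (≤-reflexive (*-identityʳ Δ)) (≮⇒≥ p)
        ... | no  _ = ≤-trans (≤-reflexive (*-zeroʳ Δ)) z≤n

      many-allowed : ∀ T T′ → Large T → Large T′ →
        r * r ≤ ∑ (allFin N) (λ u → ∑ (allFin N) (λ v → ⟦ Allowed u v × Hit (u , v) (T , T′) ⟧))
      many-allowed T T′ LT LT′ = begin
        r * r  ≤⟨ *-monoˡ-≤ r many-u ⟩
        # (λ u → u ∈ᵇ T × deg es u < Δ) * r  ≡⟨ ∑-*ʳ (allFin N) r _ ⟨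
        ∑ (allFin N) (λ u → ⟦ u ∈ᵇ T × deg es u < Δ ⟧ * r)  ≤⟨ ∑-mono′ (allFin N) many-v ⟩
        ∑ (allFin N) (λ u → ∑ (allFin N) (λ v → ⟦ Allowed u v × Hit (u , v) (T , T′) ⟧)) ∎
        where
        open ℕₚ.≤-Reasoning
        cancel₁ : ∀ {a b} → 4 * r ≤ a + b → b ≤ r → r ≤ a
        cancel₁ {a} {b} h b≤ = +-cancelʳ-≤ r _ _ (begin
          r + r  ≤⟨ m≤m+n (r + r) (r + r) ⟩
          r + r + (r + r) ≡⟨ four r ⟩
          4 * r  ≤⟨ h ⟩
          a + b  ≤⟨ +-monoʳ-≤ a b≤ ⟩
          a + r  ∎)
          where
          four : ∀ x → x + x + (x + x) ≡ 4 * x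
          four = solve-∀
        cancel₂ : ∀ {a b d} → 4 * r ≤ a + (b + d) → b ≤ r → d ≤ r → r ≤ a
        cancel₂ {a} {b} {d} h b≤ d≤ = +-cancelʳ-≤ (r + r) _ _ (begin
          r + (r + r)  ≤⟨ m≤m+n (r + (r + r)) r ⟩
          r + (r + r) + r  ≡⟨ four r ⟩
          4 * r  ≤⟨ h ⟩
          a + (b + d)  ≤⟨ +-monoʳ-≤ a (+-mono-≤ b≤ d≤) ⟩
          a + (r + r)  ∎)
          where
          four : ∀ x → x + (x + x) + x ≡ 4 * x
          four = solve-∀
        many-u : r ≤ # (λ u → u ∈ᵇ T × deg es u < Δ)
        many-u = cancel₁ (begin
          4 * r  ≤⟨ LT ⟩
          # (_∈ᵇ T)  ≤⟨ ∑-mono′ (allFin N) cover ⟩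
          ∑ (allFin N) (λ u → ⟦ u ∈ᵇ T × deg es u < Δ ⟧ + ⟦ ¬ (deg es u < Δ) ⟧)  ≡⟨ ∑-+ (allFin N) _ _ ⟩
          # (λ u → u ∈ᵇ T × deg es u < Δ) + # (λ u → ¬ (deg es u < Δ))  ∎) saturated
          where
          cover : ∀ u → ⟦ u ∈ᵇ T ⟧ ≤ ⟦ u ∈ᵇ T × deg es u < Δ ⟧ + ⟦ ¬ (deg es u < Δ) ⟧
          cover u = ≤-trans (⟦⟧-mono classify) (⟦⟧-⊎ _ _)
            where
            classify : u ∈ᵇ T → (u ∈ᵇ T × deg es u < Δ) ⊎ ¬ (deg es u < Δ)
            classify p with dec (deg es u < Δ)
            ... | yes q = inj₁ (p , q)
            ... | no  q = inj₂ q
        many-v : ∀ u → ⟦ u ∈ᵇ T × deg es u < Δ ⟧ * r ≤ ∑ (allFin N) (λ v → ⟦ Allowed u v × Hit (u , v) (T , T′) ⟧)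
        many-v u with dec (u ∈ᵇ T × deg es u < Δ)
        ... | no _ = z≤n
        ... | yes (u∈ , d<) = ≤-trans (≤-reflexive (+-identityʳ r)) (cancel₂ (begin
          4 * r  ≤⟨ LT′ ⟩
          # (_∈ᵇ T′)  ≤⟨ ∑-mono′ (allFin N) cover ⟩
          ∑ (allFin N) (λ v → ⟦ Allowed u v × Hit (u , v) (T , T′) ⟧ + (⟦ ¬ (deg es v < Δ) ⟧ + ⟦ v ∈ ball g es u ⟧))
            ≡⟨ trans (∑-+ (allFin N) _ _) (cong (∑ (allFin N) (λ v → ⟦ Allowed u v × Hit (u , v) (T , T′) ⟧) +_) (∑-+ (allFin N) _ _)) ⟩
          ∑ (allFin N) (λ v → ⟦ Allowed u v × Hit (u , v) (T , T′) ⟧) + (# (λ v → ¬ (deg es v < Δ)) + # (_∈ ball g es u)) ∎)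
          saturated (≤-trans (∑-∈≤length (Uniqₚ.allFin⁺ N) (ball g es u)) (≤-trans (length-ball Δ es md g u) β≤r)))
          where
          cover : ∀ v → ⟦ v ∈ᵇ T′ ⟧ ≤ ⟦ Allowed u v × Hit (u , v) (T , T′) ⟧ + (⟦ ¬ (deg es v < Δ) ⟧ + ⟦ v ∈ ball g es u ⟧)
          cover v = ≤-trans (⟦⟧-mono classify) (≤-trans (⟦⟧-⊎ _ _) (+-monoʳ-≤ _ (⟦⟧-⊎ _ _)))
            where
            classify : v ∈ᵇ T′ → (Allowed u v × Hit (u , v) (T , T′)) ⊎ (¬ (deg es v < Δ) ⊎ v ∈ ball g es u)
            classify p with dec (deg es v < Δ) | dec (v ∈ ball g es u)
            ... | no q  | _     = inj₂ (inj₁ q)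
            ... | yes _ | yes q = inj₂ (inj₂ q)
            ... | yes a | no b  = inj₁ ((d< , a , b) , u∈ , p)

      allPairs : List (V × V)
      allPairs = concatMap (λ u → map (u ,_) (allFin N)) (allFin N)

      ∑-allPairs : ∀ (f : V × V → ℕ) → ∑ allPairs f ≡ ∑ (allFin N) (λ u → ∑ (allFin N) (λ v → f (u , v)))
      ∑-allPairs f = trans (∑-concatMap _ (allFin N) f) (∑-cong (allFin N) (λ u → ∑-map (u ,_) (allFin N) f))

      length-allPairs : length allPairs ≡ N * N
      length-allPairs = begin
        length allPairs  ≡⟨ ∑-1 allPairs ⟨
        ∑ allPairs (λ _ → 1)  ≡⟨ ∑-allPairs _ ⟩
        ∑ (allFin N) (λ u → ∑ (allFin N) (λ v → 1))  ≡⟨ ∑-const (allFin N) _ ⟩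
        length (allFin N) * ∑ (allFin N) (λ _ → 1)  ≡⟨ cong₂ _*_ (length-allFin N) (trans (∑-1 (allFin N)) (length-allFin N)) ⟩
        N * N  ∎
        where open ≡-Reasoning

      -- Each pair of large sets is hit by at least r² allowed edges among the N² ≤ (c + 1) r²
      -- candidates, so an average candidate hits the proportion 1 / (c + 1).
      best-edge : ∀ (𝓑 : List (Subset N × Subset N)) → (∀ b → b ∈ 𝓑 → Large (proj₁ b) × Large (proj₂ b)) → 0 < length 𝓑 →
                  ∃[ e ] Allowed (proj₁ e) (proj₂ e) × length 𝓑 ≤ suc c * ∑ 𝓑 (λ b → ⟦ Hit e b ⟧)
      best-edge 𝓑 large 0<𝓑 with ∑-average allPairs (λ _ → length 𝓑)
                            (λ e → suc c * (⟦ Allowed (proj₁ e) (proj₂ e) ⟧ * ∑ 𝓑 (λ b → ⟦ Hit e b ⟧)))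
                            (subst (0 <_) (sym length-allPairs) (*-mono-< {0} {N} {0} {N} 0<N 0<N)) total
        where
        open ℕₚ.≤-Reasoning
        total : ∑ allPairs (λ _ → length 𝓑) ≤ ∑ allPairs (λ e → suc c * (⟦ Allowed (proj₁ e) (proj₂ e) ⟧ * ∑ 𝓑 (λ b → ⟦ Hit e b ⟧)))
        total = begin
          ∑ allPairs (λ _ → length 𝓑)  ≡⟨ trans (∑-const allPairs _) (cong (_* length 𝓑) length-allPairs) ⟩
          N * N * length 𝓑  ≤⟨ *-monoˡ-≤ (length 𝓑) N²≤ ⟩
          suc c * (r * r) * length 𝓑  ≡⟨ trans (*-assoc (suc c) (r * r) (length 𝓑)) (cong (suc c *_) (trans (*-comm (r * r) (length 𝓑)) (sym (∑-const 𝓑 (r * r))))) ⟩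
          suc c * ∑ 𝓑 (λ _ → r * r)
            ≤⟨ *-monoʳ-≤ (suc c) (∑-mono 𝓑 (λ b b∈ → ≤-trans (many-allowed (proj₁ b) (proj₂ b) (proj₁ (large b b∈)) (proj₂ (large b b∈))) (≤-reflexive (sym (∑-allPairs _))))) ⟩
          suc c * ∑ 𝓑 (λ b → ∑ allPairs (λ e → ⟦ Allowed (proj₁ e) (proj₂ e) × Hit e b ⟧))
            ≡⟨ cong (suc c *_) (∑-swap 𝓑 allPairs _) ⟩
          suc c * ∑ allPairs (λ e → ∑ 𝓑 (λ b → ⟦ Allowed (proj₁ e) (proj₂ e) × Hit e b ⟧))
            ≡⟨ ∑-* allPairs (suc c) _ ⟨
          ∑ allPairs (λ e → suc c * ∑ 𝓑 (λ b → ⟦ Allowed (proj₁ e) (proj₂ e) × Hit e b ⟧))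
            ≡⟨ ∑-cong allPairs (λ e → cong (suc c *_) (trans (∑-cong 𝓑 (λ b → ⟦⟧-* _ _)) (∑-* 𝓑 ⟦ Allowed (proj₁ e) (proj₂ e) ⟧ (λ b → ⟦ Hit e b ⟧)))) ⟩
          ∑ allPairs (λ e → suc c * (⟦ Allowed (proj₁ e) (proj₂ e) ⟧ * ∑ 𝓑 (λ b → ⟦ Hit e b ⟧))) ∎
      ... | e , _ , le with dec (Allowed (proj₁ e) (proj₂ e))
      ...   | yes a = e , a , subst (length 𝓑 ≤_) (cong (suc c *_) (+-identityʳ _)) le
      -- A forbidden edge was counted as hitting nothing, so it cannot reach the average over a
      -- nonempty `𝓑`.
      ...   | no _  = contradiction (≤-trans 0<𝓑 (subst (length 𝓑 ≤_) (*-zeroʳ (suc c)) le)) λ ()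

      MaxDegree-∷ : ∀ {u v} → Allowed u v → MaxDegree Δ ((u , v) ∷ es)
      MaxDegree-∷ {u} {v} (du , dv , v∉) w = subst (_≤ Δ) (sym (deg-∷ u v es w)) (cases (dec (w ≡ u)) (dec (w ≡ v)))
        where
        u∈ball : ∀ g → u ∈ ball g es u
        u∈ball zero    = here refl
        u∈ball (suc g) = here refl
        cases : Dec (w ≡ u) → Dec (w ≡ v) → ⟦ w ≡ u ⟧ + (⟦ w ≡ v ⟧ + deg es w) ≤ Δ
        cases (yes refl) (yes refl) = contradiction (u∈ball g) v∉
        cases (yes p)    (no q) rewrite ⟦⟧-true p | ⟦⟧-false q | p = du
        cases (no p)     (yes q) rewrite ⟦⟧-false p | ⟦⟧-true q | q = dv
        cases (no p)     (no q) rewrite ⟦⟧-false p | ⟦⟧-false q = md w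

    -- `decay` says that after i rounds at most the proportion (c / (c + 1))^i of the pairs is
    -- unjoined. Fewer than i edges may be used, since the process stops when no pair is left.
    record Extension (i : ℕ) (es : Edges N) (𝓑 : List (Subset N × Subset N)) : Set where
      field
        new       : Edges N
        rest      : List (Subset N × Subset N)
        short     : length new ≤ i
        good      : Good g (new ++ es)
        maxDegree : MaxDegree Δ (new ++ es)
        decay     : suc c ^ i * length rest ≤ c ^ i * length 𝓑
        joined    : ∀ b → b ∈ 𝓑 → b ∈ rest ⊎ (∃[ e ] e ∈ new × Hit e b)

    extend : ∀ i es 𝓑 → Good g es → MaxDegree Δ es → length es + i ≤ E →
             (∀ b → b ∈ 𝓑 → Large (proj₁ b) × Large (proj₂ b)) → Extension i es 𝓑
    extend zero es 𝓑 gd md len large = record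
      { new = [] ; rest = 𝓑 ; short = z≤n ; good = gd ; maxDegree = md ; decay = ≤-refl ; joined = λ b → inj₁ }
    extend (suc i) es []           gd md len large = record
      { new = [] ; rest = [] ; short = z≤n ; good = gd ; maxDegree = md
      ; decay = ≤-trans (≤-reflexive (*-zeroʳ (suc c ^ suc i))) z≤n ; joined = λ b → inj₁ }
    extend (suc i) es 𝓑@(_ ∷ _) gd md len large with Step.best-edge es md (≤-trans (m≤m+n _ _) len) 𝓑 large z<s
    ... | e@(u , v) , allowed@(_ , _ , v∉) , le = record
      { new       = X.new ++ [ e ]
      ; rest      = X.rest
      ; short     = ≤-trans (≤-reflexive (trans (Listₚ.length-++ X.new) (+-comm _ 1))) (s≤s X.short)
      ; good      = subst (Good g) assoc X.good
      ; maxDegree = subst (MaxDegree Δ) assoc X.maxDegree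
      ; decay     = decay′
      ; joined    = joined′
      }
      where
      open Step es md (≤-trans (m≤m+n _ _) len) hiding (best-edge)
      𝓑′ = filt (λ b → ¬ Hit e b) 𝓑
      module X = Extension (extend i (e ∷ es) 𝓑′ (v∉ ∷ gd) (MaxDegree-∷ allowed)
                   (subst (_≤ E) (+-suc (length es) i) len) (λ b b∈ → large b (proj₁ (∈-filt⁻ {xs = 𝓑} b∈))))
      assoc : X.new ++ e ∷ es ≡ (X.new ++ [ e ]) ++ es
      assoc = sym (Listₚ.++-assoc X.new [ e ] es)
      joined′ : ∀ b → b ∈ 𝓑 → b ∈ X.rest ⊎ (∃[ e′ ] e′ ∈ X.new ++ [ e ] × Hit e′ b)
      joined′ b b∈ with dec (Hit e b)
      ... | yes h = inj₂ (e , Memₚ.∈-++⁺ʳ X.new (here refl) , h)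
      ... | no ¬h with X.joined b (∈-filt⁺ b∈ ¬h)
      ...   | inj₁ p             = inj₁ p
      ...   | inj₂ (e′ , p , h)  = inj₂ (e′ , Memₚ.∈-++⁺ˡ p , h)
      open ℕₚ.≤-Reasoning
      hits = ∑ 𝓑 (λ b → ⟦ Hit e b ⟧)
      reduce : suc c * length 𝓑′ ≤ c * length 𝓑
      reduce = +-cancelʳ-≤ (length 𝓑) _ _ (begin
        suc c * length 𝓑′ + length 𝓑  ≤⟨ +-monoʳ-≤ (suc c * length 𝓑′) le ⟩
        suc c * length 𝓑′ + suc c * hits  ≡⟨ *-distribˡ-+ (suc c) (length 𝓑′) hits ⟨
        suc c * (length 𝓑′ + hits)  ≡⟨ cong (suc c *_) (trans (cong (_+ hits) (length-filt _ 𝓑)) (trans (+-comm _ hits) (∑-⟦⟧+⟦¬⟧ 𝓑 (Hit e)))) ⟩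
        suc c * length 𝓑  ≡⟨ +-comm (length 𝓑) (c * length 𝓑) ⟩
        c * length 𝓑 + length 𝓑  ∎)
      decay′ : suc c ^ suc i * length X.rest ≤ c ^ suc i * length 𝓑
      decay′ = begin
        suc c * suc c ^ i * length X.rest  ≡⟨ *-assoc (suc c) (suc c ^ i) _ ⟩
        suc c * (suc c ^ i * length X.rest)  ≤⟨ *-monoʳ-≤ (suc c) X.decay ⟩
        suc c * (c ^ i * length 𝓑′)  ≡⟨ swap (suc c) (c ^ i) (length 𝓑′) ⟩
        c ^ i * (suc c * length 𝓑′)  ≤⟨ *-monoʳ-≤ (c ^ i) reduce ⟩
        c ^ i * (c * length 𝓑)  ≡⟨ swap′ (c ^ i) c (length 𝓑) ⟩
        c * c ^ i * length 𝓑  ∎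
        where
        swap : ∀ x y z → x * (y * z) ≡ y * (x * z)
        swap = solve-∀
        swap′ : ∀ x y z → x * (y * z) ≡ y * x * z
        swap′ = solve-∀

    doubling^ : ∀ m → 2 ^ m * c ^ (c * m) ≤ suc c ^ (c * m)
    doubling^ m = subst₂ _≤_ (trans (^-distribʳ-* m 2 (c ^ c)) (cong (2 ^ m *_) (ℕₚ.^-*-assoc c c m)))
                         (ℕₚ.^-*-assoc (suc c) c m) (ℕₚ.^-monoˡ-≤ m (doubling c 0<c))

    module _ (es : Edges N) (gd : Good g es) (md : MaxDegree Δ es) where

      -- Every c rounds halve the number of unjoined pairs, which is at most 2^(2N) initially; 2N +
      -- 1 halvings leave less than one pair.
      steps : ℕ
      steps = c * suc (N + N)

      allBipairs : List (Subset N × Subset N)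
      allBipairs = filt (λ b → Large (proj₁ b) × Large (proj₂ b))
                        (concatMap (λ T → map (T ,_) (subsets N)) (subsets N))

      length-allBipairs : length allBipairs ≤ 2 ^ (N + N)
      length-allBipairs = begin
        length allBipairs  ≤⟨ Listₚ.length-filter (λ b → dec (Large (proj₁ b) × Large (proj₂ b))) bs ⟩
        length bs  ≡⟨ ∑-1 bs ⟨
        ∑ bs (λ _ → 1)  ≡⟨ ∑-concatMap _ (subsets N) _ ⟩
        ∑ (subsets N) (λ T → ∑ (map (T ,_) (subsets N)) (λ _ → 1)) ≡⟨ ∑-cong (subsets N) (λ T → trans (∑-map (T ,_) (subsets N) (λ _ → 1)) (trans (∑-1 (subsets N)) (length-vecs bools N))) ⟩
        ∑ (subsets N) (λ T → 2 ^ N)  ≡⟨ trans (∑-const (subsets N) _) (cong (_* 2 ^ N) (length-vecs bools N)) ⟩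
        2 ^ N * 2 ^ N  ≡⟨ ℕₚ.^-distribˡ-+-* 2 N N ⟨
        2 ^ (N + N)  ∎
        where
        open ℕₚ.≤-Reasoning
        bs = concatMap (λ T → map (T ,_) (subsets N)) (subsets N)

      module _ (len : length es + steps ≤ E) where

        private
          module X = Extension (extend steps es allBipairs gd md len (λ b b∈ → proj₂ (∈-filt⁻ {xs = concatMap (λ T → map (T ,_) (subsets N)) (subsets N)} b∈)))

        rest-empty : ∀ b → b ∉ X.rest
        rest-empty b b∈ = <-irrefl refl (begin-strict
          2 ^ (N + N) * c ^ steps  <⟨ ℕₚ.*-monoˡ-< (c ^ steps) {{>-nonZero (m^n>0 c {{>-nonZero 0<c}} steps)}} (ℕₚ.m<m+n (2 ^ (N + N)) {2 ^ (N + N) + 0} (<-≤-trans (m^n>0 2 (N + N)) (m≤m+n _ 0))) ⟩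
          2 ^ suc (N + N) * c ^ steps  ≤⟨ doubling^ (suc (N + N)) ⟩
          suc c ^ steps  ≡⟨ *-identityʳ _ ⟨
          suc c ^ steps * 1  ≤⟨ *-monoʳ-≤ (suc c ^ steps) (nonempty b∈) ⟩
          suc c ^ steps * length X.rest  ≤⟨ X.decay ⟩
          c ^ steps * length allBipairs  ≤⟨ *-monoʳ-≤ (c ^ steps) length-allBipairs ⟩
          c ^ steps * 2 ^ (N + N)  ≡⟨ *-comm (c ^ steps) _ ⟩
          2 ^ (N + N) * c ^ steps  ∎)
          where
          open ℕₚ.≤-Reasoning
          nonempty : ∀ {A : Set} {x : A} {xs} → x ∈ xs → 1 ≤ length xs
          nonempty (here _)  = s≤s z≤n
          nonempty (there _) = s≤s z≤n

        abstract
          phase : ∃[ new ] Good g (new ++ es) × MaxDegree Δ (new ++ es) × length new ≤ steps × Joined (4 * r) new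
          phase = X.new , X.good , X.maxDegree , X.short , joined
            where
            #-subsetOf : ∀ (P : V → Set) → # P ≤ # (_∈ᵇ subsetOf P)
            #-subsetOf P = ∑-mono′ (allFin N) (λ i → ⟦⟧-mono (∈-subsetOf⁺ {P = P}))
            joined : Joined (4 * r) X.new
            joined P P′ hP hP′ with X.joined (subsetOf P , subsetOf P′) (∈-filt⁺
              (Memₚ.∈-concatMap⁺ (λ T → map (T ,_) (subsets N)) (lose (∈-subsets (subsetOf P)) (Memₚ.∈-map⁺ (subsetOf P ,_) (∈-subsets (subsetOf P′)))))
              (≤-trans hP (#-subsetOf P) , ≤-trans hP′ (#-subsetOf P′)))
              where open import Data.List.Membership.Propositional using (lose)
            ... | inj₁ b∈rest            = contradiction b∈rest (rest-empty _)
            ... | inj₂ (e , e∈ , p , p′) = e , e∈ , ∈-subsetOf⁻ {P = P} p , ∈-subsetOf⁻ {P = P′} p′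

  -- It is essential that s may be chosen after D: the radius of the ball found
  -- with es₁ depends on D, and s depends on that radius.
  record SparseGraph (g D s : ℕ) : Set₁ where
    field
      N t₁ t₂  : ℕ
      N≡32t₁   : N ≡ 32 * t₁
      N≡st₂    : N ≡ s * t₂
      0<t₂     : 0 < t₂
      0<N      : 0 < N
      es₁ es₂  : Edges N
      good     : Good g (es₂ ++ es₁)
      short    : length es₁ ≤ D * N
      joined₁  : Joined t₁ es₁
      joined₂  : Joined t₂ es₂

  -- Two greedy phases on the same N = 4 · 32 · s · R vertices: the first joins sets of N/32 = 4 r₁
  -- vertices, the second sets of N/s = 4 r₂ vertices. The rate `c₁` of the first phase is free of s
  -- and g, hence so is the bound on `es₁`.
  sparse-graph : ∀ w → w ≡ 4 * 32 → ∀ g s → 0 < s → SparseGraph g (3 * (w * w)) s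
  sparse-graph w w≡ g s 0<s = record
    { N = N ; t₁ = 4 * r₁ ; t₂ = 4 * r₂
    ; N≡32t₁ = trans (cong (λ w → w * s * R) w≡) (eq₁ s R) ; N≡st₂ = trans (cong (λ w → w * s * R) w≡) (eq₂ s R)
    ; 0<t₂ = <-≤-trans 0<R (≤-trans (m≤n*m R 32) (m≤n*m (32 * R) 4))
    ; 0<N = 0<N
    ; es₁ = proj₁ ph₁ ; es₂ = proj₁ ph₂
    ; good = proj₁ (proj₂ ph₂)
    ; short = ≤-trans short₁ steps₁≤
    ; joined₁ = proj₂ (proj₂ (proj₂ (proj₂ ph₁)))
    ; joined₂ = proj₂ (proj₂ (proj₂ (proj₂ ph₂)))
    }
    where
    -- These are (N / r₁)² and (N / r₂)², as the averaging over N² candidates requires.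
    c₁ = w * w
    c₂ = 16 * (s * s)
    -- This makes 2 E equal to Δ R. As R does not occur in Δ, there is no circle in taking R to be
    -- the ball size.
    Δ = 2 * (3 * (c₁ + c₂)) * (w * s)
    R = β Δ g
    N = w * s * R
    E = 3 * (c₁ + c₂) * N
    r₁ = s * R
    r₂ = 32 * R
    0<w : 0 < w
    0<w = subst (0 <_) (sym w≡) z<s
    0<c₁ : 0 < c₁
    0<c₁ = *-mono-< {0} {w} {0} 0<w 0<w
    0<R : 0 < R
    0<R = β-pos g
      where
      β-pos : ∀ g → 0 < β Δ g
      β-pos zero    = z<s
      β-pos (suc g) = z<s
    0<N : 0 < N
    0<N = *-mono-< {0} {w * s} {0} (*-mono-< {0} {w} {0} 0<w 0<s) 0<R
    eq₁ : ∀ s R → 4 * 32 * s * R ≡ 32 * (4 * (s * R))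
    eq₁ = solve-∀
    eq₂ : ∀ s R → 4 * 32 * s * R ≡ s * (4 * (32 * R))
    eq₂ = solve-∀
    R≤r₁ : R ≤ r₁
    R≤r₁ = m≤n*m R s {{>-nonZero 0<s}}
    R≤r₂ : R ≤ r₂
    R≤r₂ = m≤n*m R 32
    0<Δ : 0 < Δ
    0<Δ = *-mono-< {0} {2 * (3 * (c₁ + c₂))} {0}
      (*-mono-< {0} {2} {0} z<s (*-mono-< {0} {3} {0} z<s (<-≤-trans 0<c₁ (m≤m+n c₁ c₂)))) (*-mono-< {0} {w} {0} 0<w 0<s)
    E<Δ : ∀ r → R ≤ r → 2 * E < Δ * suc r
    E<Δ r R≤r = begin-strict
      2 * E  ≡⟨ eq (3 * (c₁ + c₂)) (w * s) R ⟩
      Δ * R  <⟨ ℕₚ.*-monoʳ-< Δ {{>-nonZero 0<Δ}} (s≤s R≤r) ⟩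
      Δ * suc r  ∎
      where
      open ℕₚ.≤-Reasoning
      eq : ∀ a b R → 2 * (a * (b * R)) ≡ 2 * a * b * R
      eq = solve-∀
    N²₁ : N * N ≤ suc c₁ * (r₁ * r₁)
    N²₁ = ≤-trans (≤-reflexive (eq w s R)) (*-monoˡ-≤ (r₁ * r₁) (n≤1+n c₁))
      where
      eq : ∀ w s R → w * s * R * (w * s * R) ≡ w * w * (s * R * (s * R))
      eq = solve-∀
    N²₂ : N * N ≤ suc c₂ * (r₂ * r₂)
    N²₂ = ≤-trans (≤-reflexive (trans (cong (λ w → w * s * R * (w * s * R)) w≡) (eq 32 s R))) (*-monoˡ-≤ (r₂ * r₂) (n≤1+n c₂))
      where
      eq : ∀ v s R → 4 * v * s * R * (4 * v * s * R) ≡ 16 * (s * s) * (v * R * (v * R))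
      eq = solve-∀
    0<c₂ : 0 < c₂
    0<c₂ = *-mono-< {0} {16} {0} z<s (*-mono-< {0} {s} {0} 0<s 0<s)
    steps≤ : ∀ c → c * suc (N + N) ≤ 3 * c * N
    steps≤ c = ≤-trans (*-monoʳ-≤ c (+-monoˡ-≤ (N + N) 0<N)) (≤-reflexive (eq c N))
      where
      eq : ∀ c N → c * (N + (N + N)) ≡ 3 * c * N
      eq = solve-∀
    steps₁≤ : c₁ * suc (N + N) ≤ 3 * c₁ * N
    steps₁≤ = steps≤ c₁
    both : 3 * c₁ * N + 3 * c₂ * N ≡ E
    both = eq c₁ c₂ N
      where
      eq : ∀ a b N → 3 * a * N + 3 * b * N ≡ 3 * (a + b) * N
      eq = solve-∀
    module G₁ = Greedy g c₁ Δ E N r₁ 0<N 0<c₁ N²₁ (E<Δ r₁ R≤r₁) R≤r₁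
    ph₁ = G₁.phase [] [] (λ _ → z≤n) (≤-trans steps₁≤ (≤-trans (m≤m+n _ _) (≤-reflexive both)))
    short₁ : length (proj₁ ph₁) ≤ c₁ * suc (N + N)
    short₁ = proj₁ (proj₂ (proj₂ (proj₂ ph₁)))
    module G₂ = Greedy g c₂ Δ E N r₂ 0<N 0<c₂ N²₂ (E<Δ r₂ R≤r₂) R≤r₂
    ph₂ = G₂.phase (proj₁ ph₁) (subst (Good g) (Listₚ.++-identityʳ (proj₁ ph₁)) (proj₁ (proj₂ ph₁)))
            (subst (MaxDegree Δ) (Listₚ.++-identityʳ (proj₁ ph₁)) (proj₁ (proj₂ (proj₂ ph₁))))
            (≤-trans (+-mono-≤ (≤-trans short₁ steps₁≤) (steps≤ c₂)) (≤-reflexive both))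

  abstract
    D₁ : ℕ
    D₁ = 3 * (128 * 128)

    sparse : ∀ g s → 0 < s → SparseGraph g D₁ s
    sparse = sparse-graph 128 refl

  -- Short cycles, and leaves of small subsets of the incidence graph.

  module _ {N : ℕ} where

    private V = Fin N

    Joins : V × V → V → V → Set
    Joins (a , b) x y = (x ≡ a × y ≡ b) ⊎ (x ≡ b × y ≡ a)

    Joins-sym : ∀ {e x y} → Joins e x y → Joins e y x
    Joins-sym (inj₁ (p , q)) = inj₂ (q , p)
    Joins-sym (inj₂ (p , q)) = inj₁ (q , p)

    Adj : Edges N → V → V → Set
    Adj es x y = ∃[ e ] e ∈ es × Joins e x y

    Adj-sym : ∀ {es x y} → Adj es x y → Adj es y x
    Adj-sym (e , e∈ , j) = e , e∈ , Joins-sym j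

    Adj-∷ : ∀ {e es x y} → Adj (e ∷ es) x y → Joins e x y ⊎ Adj es x y
    Adj-∷ (e , here refl , j) = inj₁ j
    Adj-∷ (e , there p   , j) = inj₂ (e , p , j)

    Adj⇒∈nbrs : ∀ {es x y} → Adj es x y → y ∈ nbrs es x
    Adj⇒∈nbrs (e , e∈ , j) = go e∈ j
      where
      ∈-ends : ∀ a b → b ∈ ends a b a
      ∈-ends a b with a Finₚ.≟ a
      ... | yes _ = here refl
      ... | no ¬p = contradiction refl ¬p
      go : ∀ {es e x y} → e ∈ es → Joins e x y → y ∈ nbrs es x
      go (here {x = a , b} refl) (inj₁ (refl , refl)) = Memₚ.∈-++⁺ˡ (∈-ends a b)
      go {x = x} (here {x = a , b} refl) (inj₂ (refl , refl)) = Memₚ.∈-++⁺ʳ (ends a b x) (Memₚ.∈-++⁺ˡ (∈-ends b a))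
      go {es = (a , b) ∷ _} {x = x} (there p) j = Memₚ.∈-++⁺ʳ (ends a b x) (Memₚ.∈-++⁺ʳ (ends b a x) (go p j))

    data Walk (es : Edges N) : V → V → ℕ → Set where
      nil  : ∀ {u} → Walk es u u 0
      step : ∀ {u v w n} → Adj es u v → Walk es v w n → Walk es u w (suc n)

    infixr 5 _◅◅_
    _◅◅_ : ∀ {es u v w m n} → Walk es u v m → Walk es v w n → Walk es u w (m + n)
    nil      ◅◅ q = q
    step a p ◅◅ q = step a (p ◅◅ q)

    reverseWalk : ∀ {es u v n} → Walk es u v n → Walk es v u n
    reverseWalk nil = nil
    reverseWalk (step {n = n} a p) = subst (Walk _ _ _) (+-comm n 1) (reverseWalk p ◅◅ step (Adj-sym a) nil)

    Walk⇒∈ball : ∀ {es u v n g} → n ≤ g → Walk es u v n → v ∈ ball g es u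
    Walk⇒∈ball {g = zero}  z≤n nil = here refl
    Walk⇒∈ball {g = suc g} _   nil = here refl
    Walk⇒∈ball {es} {g = suc g} (s≤s n≤) (step a p) =
      there (Memₚ.∈-concatMap⁺ (ball g es) (lose (Adj⇒∈nbrs a) (Walk⇒∈ball n≤ p)))
      where open import Data.List.Membership.Propositional using (lose)

    -- Non-backtracking walks from a via c to b, of length suc n.
    data NB (es : Edges N) : V → V → V → ℕ → Set where
      one  : ∀ {a b} → Adj es a b → NB es a b b 0
      step : ∀ {a c d b n} → Adj es a c → a ≢ d → NB es c d b n → NB es a c b (suc n)

    NB⇒Walk : ∀ {es a c b n} → NB es a c b n → Walk es a b (suc n)
    NB⇒Walk (one a)      = step a nil
    NB⇒Walk (step a _ p) = step a (NB⇒Walk p)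

    -- The index of `NB` is the length minus one, so closed non-backtracking walks of length at most
    -- g are excluded.
    NoCycle : ℕ → Edges N → Set
    NoCycle g es = ∀ {a c n} → n < g → ¬ NB es a c a n

    module AddEdge (g : ℕ) (es : Edges N) (u v : V) (acyclic : NoCycle g es)
                   (far′ : ∀ {n} → n ≤ g → ¬ Walk es u v n) where

      far : ∀ {s t n} → Joins (u , v) s t → n ≤ g → ¬ Walk es s t n
      far (inj₁ (refl , refl)) n≤ p = far′ n≤ p
      far (inj₂ (refl , refl)) n≤ p = far′ n≤ (reverseWalk p)

      data Start (a c s t : V) : ℕ → Set where
        now   : a ≡ s → c ≡ t → Start a c s t 0
        later : ∀ {i} → NB es a c s i → Start a c s t (suc i)

      -- The part before the new edge stays non-backtracking, because the induction prolongs it at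
      -- the front and may have to close it; of the part after it only the length matters.
      data AtMostOnce (a c b : V) (n : ℕ) : Set where
        old : NB es a c b n → AtMostOnce a c b n
        new : ∀ {s t i j} → Joins (u , v) s t → Start a c s t i → Walk es t b j → i + j ≤ n → AtMostOnce a c b n

      -- Between two uses of the new edge there would be a short old walk: either it joins the ends
      -- of the edge, against their distance, or it is closed and non-backtracking, against
      -- acyclicity. Two consecutive uses would be a backtrack.
      classify : ∀ {a c b n} → n < g → NB ((u , v) ∷ es) a c b n → AtMostOnce a c b n
      classify n< (one r) with Adj-∷ r
      ... | inj₁ j = new j (now refl refl) nil z≤n
      ... | inj₂ a = old (one a)
      classify n< (step r a≢d p) with Adj-∷ r | classify (<⇒≤ n<) p
      ... | inj₂ a | old q                     = old (step a a≢d q)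
      ... | inj₁ j | old q                     = new j (now refl refl) (NB⇒Walk q) ≤-refl
      ... | inj₂ a | new j (now refl refl) w le = new j (later (one a)) w (s≤s le)
      ... | inj₂ a | new j (later q) w le      = new j (later (step a a≢d q)) w (s≤s le)
      ... | inj₁ j | new j′ (now refl refl) w le = ⊥-elim (backtrack a≢d j j′)
        where
        backtrack : ∀ {a s t} → a ≢ t → Joins (u , v) a s → Joins (u , v) s t → ⊥
        backtrack a≢d (inj₁ (refl , refl)) (inj₁ (refl , refl)) = far′ z≤n nil
        backtrack a≢d (inj₁ (refl , refl)) (inj₂ (refl , refl)) = a≢d refl
        backtrack a≢d (inj₂ (refl , refl)) (inj₂ (refl , refl)) = far′ z≤n nil
        backtrack a≢d (inj₂ (refl , refl)) (inj₁ (refl , refl)) = a≢d refl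
      ... | inj₁ j | new {i = suc i} {j = m} j′ (later q) w le = ⊥-elim (twice j j′ q)
        where
        i<g : i < g
        i<g = ≤-trans (≤-trans (m≤m+n (suc i) m) le) (<⇒≤ (<⇒≤ n<))
        twice : ∀ {a c d s t} → Joins (u , v) a c → Joins (u , v) s t → NB es c d s i → ⊥
        twice (inj₁ (refl , refl)) (inj₁ (refl , refl)) q = far (inj₂ (refl , refl)) i<g (NB⇒Walk q)
        twice (inj₁ (refl , refl)) (inj₂ (refl , refl)) q = acyclic i<g q
        twice (inj₂ (refl , refl)) (inj₁ (refl , refl)) q = acyclic i<g q
        twice (inj₂ (refl , refl)) (inj₂ (refl , refl)) q = far (inj₁ (refl , refl)) i<g (NB⇒Walk q)

      acyclic′ : NoCycle g ((u , v) ∷ es)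
      acyclic′ n< p with classify n< p
      ... | old q = acyclic n< q
      ... | new j (now refl refl) w le = far (Joins-sym j) (≤-trans le (<⇒≤ n<)) w
      -- The closed walk is rotated: from the far end of the new edge through the base point to its
      -- near end, by old edges only.
      ... | new {i = suc i} {j = m} j (later q) w le = far (Joins-sym j)
            (≤-trans (≤-reflexive (+-comm m (suc i))) (≤-trans le (<⇒≤ n<))) (w ◅◅ NB⇒Walk q)

    Good⇒NoCycle : ∀ {g es} → Good g es → NoCycle g es
    Good⇒NoCycle [] n< (one (_ , () , _))
    Good⇒NoCycle [] n< (step (_ , () , _) _ _)
    Good⇒NoCycle {g} (_∷_ {u} {v} {es} v∉ gd) =
      AddEdge.acyclic′ g es u v (Good⇒NoCycle gd) (λ n≤ p → v∉ (Walk⇒∈ball n≤ p))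

    Good⇒loopless : ∀ {g es e x} → Good g es → e ∈ es → ¬ Joins e x x
    Good⇒loopless {g} (v∉ ∷ gd) (here refl) (inj₁ (refl , refl)) = v∉ (Walk⇒∈ball {n = 0} {g} z≤n nil)
    Good⇒loopless {g} (v∉ ∷ gd) (here refl) (inj₂ (refl , refl)) = v∉ (Walk⇒∈ball {n = 0} {g} z≤n nil)
    Good⇒loopless (v∉ ∷ gd) (there p) j = Good⇒loopless gd p j

    -- A second edge on the same ends would have been added between vertices at distance 1.
    Good⇒simple : ∀ {g es} → 1 ≤ g → Good g es → ∀ (i j : Fin (length es)) {x y} →
                  Joins (lookup es i) x y → Joins (lookup es j) x y → i ≡ j
    Good⇒simple 1≤g (v∉ ∷ gd) zero    zero    p q = refl
    Good⇒simple 1≤g (v∉ ∷ gd) (suc i) (suc j) p q = cong suc (Good⇒simple 1≤g gd i j p q)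
    Good⇒simple {es = _ ∷ es} 1≤g (v∉ ∷ gd) zero    (suc j) p q = contradiction (Walk⇒∈ball 1≤g (step (adj p q) nil)) v∉
      where
      adj : ∀ {u v x y} → Joins (u , v) x y → Joins (lookup es j) x y → Adj es u v
      adj (inj₁ (refl , refl)) q = lookup es j , Memₚ.∈-lookup j , q
      adj (inj₂ (refl , refl)) q = lookup es j , Memₚ.∈-lookup j , Joins-sym q
    Good⇒simple {es = _ ∷ es} 1≤g (v∉ ∷ gd) (suc i) zero    p q = contradiction (Walk⇒∈ball 1≤g (step (adj q p) nil)) v∉
      where
      adj : ∀ {u v x y} → Joins (u , v) x y → Joins (lookup es i) x y → Adj es u v
      adj (inj₁ (refl , refl)) q = lookup es i , Memₚ.∈-lookup i , q
      adj (inj₂ (refl , refl)) q = lookup es i , Memₚ.∈-lookup i , Joins-sym q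

    Node : Edges N → Set
    Node es = V ⊎ Fin (length es)

    Endpoint : V × V → V → Set
    Endpoint (a , b) x = x ≡ a ⊎ x ≡ b

    data Inc (es : Edges N) : Node es → Node es → Set where
      up   : ∀ {v e} → Endpoint (lookup es e) v → Inc es (inj₁ v) (inj₂ e)
      down : ∀ {v e} → Endpoint (lookup es e) v → Inc es (inj₂ e) (inj₁ v)

    module Leaf (g : ℕ) (es : Edges N) (gd : Good g es) (W : List (Node es)) (0<W : 0 < length W) (W≤g : length W ≤ g) where

      -- At most one neighbour within `W`; a node without neighbours counts as a leaf.
      IsLeaf : Node es → Set
      IsLeaf w = ∀ {x y} → x ∈ W → y ∈ W → Inc es w x → Inc es w y → x ≡ y

      private
        Branching : Node es → Set
        Branching w = ∃[ x ] ∃[ y ] x ≢ y × x ∈ W × y ∈ W × Inc es w x × Inc es w y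

        ¬leaf⇒branching : ∀ {w} → ¬ IsLeaf w → Branching w
        ¬leaf⇒branching {w} ¬l with dec (Branching w)
        ... | yes b = b
        ... | no ¬b = contradiction (λ {x} {y} x∈ y∈ p q → leaf x y x∈ y∈ p q) ¬l
          where
          leaf : ∀ x y → x ∈ W → y ∈ W → Inc es w x → Inc es w y → x ≡ y
          leaf x y x∈ y∈ p q with dec (x ≡ y)
          ... | yes e = e
          ... | no ¬e = contradiction (x , y , ¬e , x∈ , y∈ , p , q) ¬b

      module NoLeaf (branch : ∀ {w} → w ∈ W → Branching w) where

        other-end : ∀ {e v} → inj₂ e ∈ W → Endpoint (lookup es e) v → ∃[ d ] inj₁ d ∈ W × Joins (lookup es e) v d
        other-end {e} e∈ p with branch e∈
        ... | _ , _ , x≢y , x∈ , y∈ , down q , down r = pick p q r x≢y x∈ y∈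
          where
          pick : ∀ {v x y ab} → Endpoint ab v → Endpoint ab x → Endpoint ab y → inj₁ x ≢ inj₁ y →
                 inj₁ x ∈ W → inj₁ y ∈ W → ∃[ d ] inj₁ d ∈ W × Joins ab v d
          pick _ (inj₁ refl) (inj₁ refl) ne _ _ = contradiction refl ne
          pick _ (inj₂ refl) (inj₂ refl) ne _ _ = contradiction refl ne
          pick (inj₁ refl) (inj₁ refl) (inj₂ refl) _ _ y∈ = _ , y∈ , inj₁ (refl , refl)
          pick (inj₁ refl) (inj₂ refl) (inj₁ refl) _ x∈ _ = _ , x∈ , inj₁ (refl , refl)
          pick (inj₂ refl) (inj₁ refl) (inj₂ refl) _ x∈ _ = _ , x∈ , inj₂ (refl , refl)
          pick (inj₂ refl) (inj₂ refl) (inj₁ refl) _ _ y∈ = _ , y∈ , inj₂ (refl , refl)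

        record State : Set where
          constructor state
          field
            prev cur : V
            prev∈    : inj₁ prev ∈ W
            cur∈     : inj₁ cur ∈ W
            adj      : Adj es prev cur
        open State

        adjacent : ∀ e {x y} → Joins (lookup es e) x y → Adj es x y
        adjacent e j = lookup es e , Memₚ.∈-lookup e , j

        -- The current vertex has two edges in `W`. If the first leads back to the previous vertex,
        -- the second does not, since no two edges are parallel.
        next : (s : State) → Σ[ t ∈ State ] prev t ≡ cur s × prev s ≢ cur t
        next (state p c p∈ c∈ a) with branch c∈
        ... | inj₂ e , inj₂ f , e≢f , e∈ , f∈ , up q , up r with other-end e∈ q | other-end f∈ r
        ...   | d , d∈ , j | d′ , d′∈ , j′ with dec (p ≡ d)
        ...     | no p≢d  = state c d c∈ d∈ (adjacent e j) , refl , p≢d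
        ...     | yes refl = state c d′ c∈ d′∈ (adjacent f j′) , refl ,
                  λ { refl → e≢f (cong inj₂ (Good⇒simple (≤-trans 0<W W≤g) gd e f j j′)) }

        start : State
        start = fromNode (proj₂ (first W 0<W))
          where
          first : (xs : List (Node es)) → 0 < length xs → ∃[ x ] x ∈ xs
          first (x ∷ _) _ = x , here refl
          fromNode : ∀ {w} → w ∈ W → State
          fromNode {inj₂ e} e∈ = let d , d∈ , j = other-end e∈ (inj₁ refl) ; d′ , d′∈ , j′ = other-end e∈ (endpoint j)
                                 in state d d′ d∈ d′∈ (adjacent e j′)
            where
            endpoint : ∀ {ab x y} → Joins ab x y → Endpoint ab y
            endpoint (inj₁ (_ , q)) = inj₂ q
            endpoint (inj₂ (_ , q)) = inj₁ q
          fromNode {inj₁ v} v∈ with branch v∈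
          ... | inj₂ e , _ , _ , e∈ , _ , up q , _ = let d , d∈ , j = other-end e∈ q in state v d v∈ d∈ (adjacent e j)

        iter : ℕ → State → State
        iter zero    s = s
        iter (suc n) s = iter n (proj₁ (next s))

        iter-+ : ∀ m n s → iter (m + n) s ≡ iter n (iter m s)
        iter-+ zero    n s = refl
        iter-+ (suc m) n s = iter-+ m n (proj₁ (next s))

        prev-iter : ∀ n s → prev (iter (suc n) s) ≡ cur (iter n s)
        prev-iter zero    s = proj₁ (proj₂ (next s))
        prev-iter (suc n) s = prev-iter n (proj₁ (next s))

        walk : ∀ n s → NB es (prev s) (cur s) (cur (iter n s)) n
        walk zero    s = one (adj s)
        walk (suc n) s with next s | walk n (proj₁ (next s))
        ... | t , eq , ne | w = step (adj s) ne (subst (λ z → NB es z (cur t) (cur (iter n t)) n) eq w)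

        -- A walk that never turns back stays on vertices of `W`, so within |W| + 1 states a vertex
        -- recurs, and the piece in between is a closed walk of length at most g.
        impossible : ⊥
        impossible with Finₚ.pigeonhole (ℕₚ.n<1+n (length W)) (λ i → index (prev∈ (iter (toℕ i) start)))
          where open import Data.List.Relation.Unary.Any using (index)
        ... | i , j , i<j , eq = Good⇒NoCycle gd k<g
                (subst (λ z → NB es (prev s) (cur s) z k) (trans (sym (prev-iter k s)) (trans (cong prev (sym split)) (sym prev≡))) (walk k s))
          where
          s = iter (toℕ i) start
          -- The closed walk has length j - i ≤ |W|; `NB` counts one less.
          k = toℕ j ∸ suc (toℕ i)
          k≡ : suc (toℕ i) + k ≡ toℕ j
          k≡ = m+[n∸m]≡n i<j
          split : iter (toℕ j) start ≡ iter (suc k) s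
          split = trans (cong (λ z → iter z start) (sym (trans (+-suc (toℕ i) k) k≡))) (iter-+ (toℕ i) (suc k) start)
          inj₁-injective : ∀ {x y} → _≡_ {A = Node es} (inj₁ x) (inj₁ y) → x ≡ y
          inj₁-injective refl = refl
          prev≡ : prev (iter (toℕ i) start) ≡ prev (iter (toℕ j) start)
          prev≡ = inj₁-injective (index-injective (prev∈ (iter (toℕ i) start)) (prev∈ (iter (toℕ j) start)) eq)
            where
            open import Data.List.Relation.Unary.Any using (index)
            index-injective : ∀ {xs : List (Node es)} {x y} (p : x ∈ xs) (q : y ∈ xs) → index p ≡ index q → x ≡ y
            index-injective (here refl) (here refl) _ = refl
            index-injective (there p)   (there q)   e = index-injective p q (Finₚ.suc-injective e)
          k<g : k < g
          k<g = ≤-trans (≤-trans (m≤n+m (suc k) (toℕ i)) (≤-reflexive (trans (+-suc (toℕ i) k) k≡)))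
                  (≤-trans (≤-pred (Finₚ.toℕ<n j)) W≤g)

      leaf : ∃[ w ] w ∈ W × IsLeaf w
      leaf with dec (∃[ w ] w ∈ W × IsLeaf w)
      ... | yes l = l
      ... | no ¬l = ⊥-elim (NoLeaf.impossible (λ {w} w∈ → ¬leaf⇒branching (λ (l : IsLeaf w) → ¬l (w , w∈ , λ {x} {y} → l {x} {y}))))

  -- Incidence posets and the value e = 1.

  ⊆∧≥⇒≡ : ∀ {n} {p q : Subset n} → p ⊆ₛ q → ∣ q ∣ ≤ ∣ p ∣ → p ≡ q
  ⊆∧≥⇒≡ {p = p} {q} p⊆q le = Subₚ.⊆-antisym p⊆q λ {x} x∈q → case x Subₚ.∈? p of λ
    { (yes x∈p) → x∈p
    ; (no x∉p)  → contradiction (Subₚ.p⊂q⇒∣p∣<∣q∣ (p⊆q , x , x∈q , x∉p)) (ℕₚ.≤⇒≯ le) }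

  free⇒no-embedding : ∀ {n P} {𝓕 : Family n} → P IsFree 𝓕 → (ψ : FinPoset.Carrier P → Subset n) →
    (∀ p → 𝓕 (ψ p)) → Injective _≡_ _≡_ ψ → (∀ {p p′} → FinPoset._≼_ P p p′ → ψ p ⊆ₛ ψ p′) → ⊥
  free⇒no-embedding free ψ ψ∈ inj mono = free (λ Y → ∃[ p ] ψ p ≡ Y) (λ { (p , refl) → ψ∈ p }) record
    { ψ = ψ ; ψ∈𝓖 = λ p → p , refl ; injective = inj ; surjective = id ; monotone = mono }

  module _ {N : ℕ} (es : Edges N) where

    data Up : Node es → Node es → Set where
      up : ∀ {v e} → Endpoint (lookup es e) v → Up (inj₁ v) (inj₂ e)

    node : Fin (N + length es) → Node es
    node = splitAt N

    _≼ᵢ_ : Fin (N + length es) → Fin (N + length es) → Set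
    x ≼ᵢ y = x ≡ y ⊎ Up (node x) (node y)

    incidencePoset : FinPoset
    incidencePoset = record
      { size = N + length es
      ; _≼_ = _≼ᵢ_
      ; isPartialOrder = record
        { isPreorder = record
          { isEquivalence = ≡-isEquivalence
          ; reflexive = inj₁
          ; trans = ≼-trans }
        ; antisym = ≼-antisym }
      }
      where
      no-chain : ∀ {a b c} → Up a b → Up b c → ⊥
      no-chain (up _) ()
      ≼-trans : ∀ {x y z} → x ≼ᵢ y → y ≼ᵢ z → x ≼ᵢ z
      ≼-trans (inj₁ refl) q           = q
      ≼-trans (inj₂ p)    (inj₁ refl) = inj₂ p
      ≼-trans (inj₂ p)    (inj₂ q)    = ⊥-elim (no-chain p q)
      ≼-antisym : ∀ {x y} → x ≼ᵢ y → y ≼ᵢ x → x ≡ y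
      ≼-antisym (inj₁ p) _        = p
      ≼-antisym (inj₂ p) (inj₁ q) = sym q
      ≼-antisym (inj₂ p) (inj₂ q) = ⊥-elim (no-chain p q)

    vertex : Fin N → Fin (N + length es)
    vertex v = v ↑ˡ length es

    edge : Fin (length es) → Fin (N + length es)
    edge e = N ↑ʳ e

    vertex≼edge : ∀ {v e} → Endpoint (lookup es e) v → vertex v ≼ᵢ edge e
    vertex≼edge {v} {e} p = inj₂ (subst₂ Up (sym (Finₚ.splitAt-↑ˡ N v (length es))) (sym (Finₚ.splitAt-↑ʳ N (length es) e)) (up p))

    vertex≢edge : ∀ {v e} → vertex v ≢ edge e
    vertex≢edge {v} {e} p with trans (sym (Finₚ.splitAt-↑ˡ N v (length es))) (trans (cong node p) (Finₚ.splitAt-↑ʳ N (length es) e))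
    ... | ()

    edge-injective : ∀ {e f} → edge e ≡ edge f → e ≡ f
    edge-injective = Finₚ.↑ʳ-injective N _ _

    vertex-injective : ∀ {u v} → vertex u ≡ vertex v → u ≡ v
    vertex-injective = Finₚ.↑ˡ-injective (length es) _ _

    node-injective : ∀ {x y} → node x ≡ node y → x ≡ y
    node-injective {x} {y} p = trans (sym (Finₚ.join-splitAt N (length es) x)) (trans (cong (join N (length es)) p) (Finₚ.join-splitAt N (length es) y))

  ∣pair∣ : ∀ {n} (a b : Fin n) → a ≢ b → ∣ ⁅ a ⁆ ∪ ⁅ b ⁆ ∣ ≡ 2
  ∣pair∣ zero    zero    a≢b = contradiction refl a≢b
  ∣pair∣ zero    (suc b) a≢b = cong suc (trans (cong ∣_∣ (Subₚ.∪-identityˡ ⁅ b ⁆)) (Subₚ.∣⁅x⁆∣≡1 b))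
  ∣pair∣ (suc a) zero    a≢b = cong suc (trans (cong ∣_∣ (Subₚ.∪-identityʳ ⁅ a ⁆)) (Subₚ.∣⁅x⁆∣≡1 a))
  ∣pair∣ (suc a) (suc b) a≢b = ∣pair∣ a b (a≢b ∘ cong suc)

  module _ {N g : ℕ} (es : Edges N) (gd : Good g es) (1≤g : 1 ≤ g) (e₀ : Fin (length es)) where

    private
      P = incidencePoset es

      -- An edge lies above its ends, but a layer has no two distinct nested sets.
      free-in-layer : ∀ n s → s + 1 ≤ suc n → P IsFree ConsecutiveLayers n s 1
      free-in-layer n s _ 𝓖 𝓖⊆ copy = vertex≢edge es (W.injective (⊆∧≥⇒≡ (W.monotone (vertex≼edge es (inj₁ refl)))
          (≤-reflexive (trans (size e) (sym (size v))))))
        where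
        module W = _IsWeakCopyOf_ copy
        v = vertex es (proj₁ (lookup es e₀))
        e = edge es e₀
        size : ∀ p → ∣ W.ψ p ∣ ≡ s + 0
        size p with 𝓖⊆ (W.ψ∈𝓖 p)
        ... | zero , eq = eq

      module TwoLayers (k : ℕ) where
        -- The points beyond the N vertices make 1, ..., k + 2 layers of the cube, so the failure in
        -- two layers refutes every bound k + 2.
        n = N + suc (suc k)
        ι : Fin N → Fin n
        ι v = v ↑ˡ suc (suc k)
        ι-injective : ∀ {u v} → ι u ≡ ι v → u ≡ v
        ι-injective = Finₚ.↑ˡ-injective _ _ _
        φ : Node es → Subset n
        φ (inj₁ v) = ⁅ ι v ⁆
        φ (inj₂ e) = ⁅ ι (proj₁ (lookup es e)) ⁆ ∪ ⁅ ι (proj₂ (lookup es e)) ⁆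
        ∣φedge∣ : ∀ e → ∣ φ (inj₂ e) ∣ ≡ 2
        ∣φedge∣ e = ∣pair∣ _ _ (λ p → Good⇒loopless gd (Memₚ.∈-lookup {xs = es} e) (inj₁ (refl , ι-injective p)))
        φ∈ : ∀ w → ConsecutiveLayers n 1 (suc (suc k)) (φ w)
        φ∈ (inj₁ v) = zero , Subₚ.∣⁅x⁆∣≡1 (ι v)
        φ∈ (inj₂ e) = suc zero , ∣φedge∣ e
        ∈pair : ∀ {a b x : Fin n} → x ∈ₛ ⁅ a ⁆ ∪ ⁅ b ⁆ → x ≡ a ⊎ x ≡ b
        ∈pair {a} {b} p with Subₚ.x∈p∪q⁻ ⁅ a ⁆ ⁅ b ⁆ p
        ... | inj₁ q = inj₁ (Subₚ.x∈⁅y⁆⇒x≡y a q)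
        ... | inj₂ q = inj₂ (Subₚ.x∈⁅y⁆⇒x≡y b q)
        pair-joins : ∀ (a b c d : Fin N) → a ≢ b → ⁅ ι a ⁆ ∪ ⁅ ι b ⁆ ≡ ⁅ ι c ⁆ ∪ ⁅ ι d ⁆ → Joins (c , d) a b
        pair-joins a b c d a≢b eq with ∈pair (subst (ι a ∈ₛ_) eq (Subₚ.x∈p∪q⁺ (inj₁ (Subₚ.x∈⁅x⁆ (ι a)))))
                                   | ∈pair (subst (ι b ∈ₛ_) eq (Subₚ.x∈p∪q⁺ (inj₂ (Subₚ.x∈⁅x⁆ (ι b)))))
        ... | inj₁ p | inj₁ q = contradiction (ι-injective (trans p (sym q))) a≢b
        ... | inj₁ p | inj₂ q = inj₁ (ι-injective p , ι-injective q)
        ... | inj₂ p | inj₁ q = inj₂ (ι-injective p , ι-injective q)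
        ... | inj₂ p | inj₂ q = contradiction (ι-injective (trans p (sym q))) a≢b
        φ-injective : ∀ {x y} → φ x ≡ φ y → x ≡ y
        φ-injective {inj₁ u} {inj₁ v} eq = cong inj₁ (ι-injective (Subₚ.x∈⁅y⁆⇒x≡y (ι v) (subst (ι u ∈ₛ_) eq (Subₚ.x∈⁅x⁆ (ι u)))))
        φ-injective {inj₁ u} {inj₂ f} eq = contradiction (trans (sym (Subₚ.∣⁅x⁆∣≡1 (ι u))) (trans (cong ∣_∣ eq) (∣φedge∣ f))) λ ()
        φ-injective {inj₂ e} {inj₁ v} eq = contradiction (trans (sym (Subₚ.∣⁅x⁆∣≡1 (ι v))) (trans (cong ∣_∣ (sym eq)) (∣φedge∣ e))) λ ()
        φ-injective {inj₂ e} {inj₂ f} eq = cong inj₂ (Good⇒simple 1≤g gd e f (inj₁ (refl , refl))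
          (pair-joins _ _ _ _ (λ p → Good⇒loopless gd (Memₚ.∈-lookup {xs = es} e) (inj₁ (refl , p))) eq))
        φ-mono : ∀ {x y} → Up es x y → φ x ⊆ₛ φ y
        φ-mono (up {v} {e} (inj₁ refl)) = Subₚ.p⊆p∪q ⁅ ι (proj₂ (lookup es e)) ⁆
        φ-mono (up {v} {e} (inj₂ refl)) = Subₚ.q⊆p∪q ⁅ ι (proj₁ (lookup es e)) ⁆ ⁅ ι (proj₂ (lookup es e)) ⁆

        mono : ∀ {p p′} → _≼ᵢ_ es p p′ → φ (node es p) ⊆ₛ φ (node es p′)
        mono (inj₁ refl) = id
        mono (inj₂ p)    = φ-mono p

        not-free : ¬ (P IsFree ConsecutiveLayers n 1 (suc (suc k)))
        not-free free = free⇒no-embedding free (φ ∘ node es) (λ p → φ∈ (node es p)) (λ eq → node-injective es (φ-injective eq)) mono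

    incidence-e≡1 : e[ P ]≡ 1
    incidence-e≡1 = free-in-layer , λ
      { zero          _    → z≤n
      ; (suc zero)    _    → ≤-refl
      ; (suc (suc k)) free → contradiction (free (N + suc (suc k)) 1 (s≤s (m≤n+m _ N))) (TwoLayers.not-free k) }

  -- Linear algebra over 𝔽₃ and random configurations of vectors.

  𝔽₃ : Set
  𝔽₃ = Fin 3

  infixl 6 _⊕_ _⊝_
  infixl 7 _⊗_
  _⊕_ _⊝_ _⊗_ : 𝔽₃ → 𝔽₃ → 𝔽₃
  a ⊕ b = (toℕ a + toℕ b) mod 3
  a ⊝ b = (toℕ a + 2 * toℕ b) mod 3
  a ⊗ b = (toℕ a * toℕ b) mod 3

  private
    ⊝-⊗ : ∀ a b c → (a ⊝ b) ⊗ c ≡ a ⊗ c ⊝ b ⊗ c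
    ⊝-⊗ = from-yes (Finₚ.all? λ a → Finₚ.all? λ b → Finₚ.all? λ c → (a ⊝ b) ⊗ c Finₚ.≟ a ⊗ c ⊝ b ⊗ c)

    ⊝-⊕ : ∀ a b c d → (a ⊝ b) ⊕ (c ⊝ d) ≡ (a ⊕ c) ⊝ (b ⊕ d)
    ⊝-⊕ = from-yes (Finₚ.all? λ a → Finₚ.all? λ b → Finₚ.all? λ c → Finₚ.all? λ d →
            (a ⊝ b) ⊕ (c ⊝ d) Finₚ.≟ (a ⊕ c) ⊝ (b ⊕ d))

    ⊝-self : ∀ a → a ⊝ a ≡ zero
    ⊝-self = from-yes (Finₚ.all? λ a → a ⊝ a Finₚ.≟ zero)

    ⊝≡0 : ∀ a b → a ⊝ b ≡ zero → a ≡ b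
    ⊝≡0 = from-yes (Finₚ.all? λ a → Finₚ.all? λ b → (a ⊝ b Finₚ.≟ zero) →-dec (a Finₚ.≟ b))

    0⊝≡ : ∀ a → zero ⊝ a ≡ a → a ≡ zero
    0⊝≡ = from-yes (Finₚ.all? λ a → (zero ⊝ a Finₚ.≟ a) →-dec (a Finₚ.≟ zero))

    0⊗⊕0 : ∀ b → zero ⊗ b ⊕ zero ≡ zero
    0⊗⊕0 = from-yes (Finₚ.all? λ b → zero ⊗ b ⊕ zero Finₚ.≟ zero)

    ⊕-solve : ∀ x y c → x ⊕ y ≡ c → y ≡ c ⊝ x
    ⊕-solve = from-yes (Finₚ.all? λ x → Finₚ.all? λ y → Finₚ.all? λ c → (x ⊕ y Finₚ.≟ c) →-dec (y Finₚ.≟ c ⊝ x))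

    -- A nonzero element of 𝔽₃ is its own inverse.
    ⊗-solve : ∀ a b c → a ≢ zero → a ⊗ b ⊕ zero ≡ c → b ≡ a ⊗ c
    ⊗-solve zero                b c a≢0 = contradiction refl a≢0
    ⊗-solve (suc zero)          b c _   = from-yes (Finₚ.all? λ b → Finₚ.all? λ c → (suc zero ⊗ b ⊕ zero Finₚ.≟ c) →-dec (b Finₚ.≟ suc zero ⊗ c)) b c
    ⊗-solve (suc (suc zero))    b c _   = from-yes (Finₚ.all? λ b → Finₚ.all? λ c → (suc (suc zero) ⊗ b ⊕ zero Finₚ.≟ c) →-dec (b Finₚ.≟ suc (suc zero) ⊗ c)) b c

  𝔽₃s : List 𝔽₃
  𝔽₃s = allFin 3

  Vector : ℕ → Set
  Vector m = Vec 𝔽₃ m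

  𝟎 : ∀ {m} → Vector m
  𝟎 {m} = V.replicate m zero

  _−_ : ∀ {m} → Vector m → Vector m → Vector m
  _−_ = V.zipWith _⊝_

  dot : ∀ {m} → Vector m → Vector m → 𝔽₃
  dot []      []      = zero
  dot (a ∷ h) (b ∷ w) = a ⊗ b ⊕ dot h w

  dot-− : ∀ {m} (h h′ w : Vector m) → dot (h − h′) w ≡ dot h w ⊝ dot h′ w
  dot-− []      []        []      = refl
  dot-− (a ∷ h) (a′ ∷ h′) (b ∷ w) = trans (cong₂ _⊕_ (⊝-⊗ a a′ b) (dot-− h h′ w)) (⊝-⊕ (a ⊗ b) (a′ ⊗ b) (dot h w) (dot h′ w))

  dot-𝟎 : ∀ {m} (w : Vector m) → dot 𝟎 w ≡ zero
  dot-𝟎 []      = refl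
  dot-𝟎 (b ∷ w) = trans (cong (zero ⊗ b ⊕_) (dot-𝟎 w)) (0⊗⊕0 b)

  −≡𝟎 : ∀ {m} (h h′ : Vector m) → h − h′ ≡ 𝟎 → h ≡ h′
  −≡𝟎 []      []        _  = refl
  −≡𝟎 (a ∷ h) (a′ ∷ h′) eq = cong₂ _∷_ (⊝≡0 a a′ (cong V.head eq)) (−≡𝟎 h h′ (cong V.tail eq))

  -- The characteristic is not 2; this is what makes the count of normals gain a factor 2.
  𝟎−≡ : ∀ {m} (h : Vector m) → 𝟎 − h ≡ h → h ≡ 𝟎
  𝟎−≡ []      _  = refl
  𝟎−≡ (a ∷ h) eq = cong₂ _∷_ (0⊝≡ a (cong V.head eq)) (𝟎−≡ h (cong V.tail eq))

  vectors : ∀ m → List (Vector m)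
  vectors = vecs 𝔽₃s

  vectors-unique : ∀ m → Unique (vectors m)
  vectors-unique = vecs-unique (Uniqₚ.allFin⁺ 3)

  ∈-vectors : ∀ {m} (h : Vector m) → h ∈ vectors m
  ∈-vectors = ∈-vecs (λ a → Memₚ.∈-allFin a)

  -- If the tail of the functional is nonzero, each value of the first coordinate leaves a third of
  -- the tails; otherwise the first coordinate is forced.
  hyperplane : ∀ {m} (h : Vector m) → h ≢ 𝟎 → ∀ c → 3 * ∑ (vectors m) (λ w → ⟦ dot h w ≡ c ⟧) ≤ 3 ^ m
  hyperplane []      h≢𝟎 c = contradiction refl h≢𝟎
  hyperplane {suc m} (a ∷ h) ah≢𝟎 c with dec (h ≡ 𝟎)
  ... | no h≢𝟎 = *-monoʳ-≤ 3 (begin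
      ∑ (vectors (suc m)) (λ w → ⟦ dot (a ∷ h) w ≡ c ⟧)  ≡⟨ ∑-vecs 𝔽₃s m _ ⟩
      ∑ 𝔽₃s (λ b → ∑ (vectors m) (λ w → ⟦ a ⊗ b ⊕ dot h w ≡ c ⟧))
        ≤⟨ ∑-mono′ 𝔽₃s (λ b → ∑-mono′ (vectors m) (λ w → ⟦⟧-mono (⊕-solve (a ⊗ b) (dot h w) c))) ⟩
      ∑ 𝔽₃s (λ b → ∑ (vectors m) (λ w → ⟦ dot h w ≡ c ⊝ a ⊗ b ⟧))  ≤⟨ third ⟩
      3 ^ m  ∎)
    where
    open ℕₚ.≤-Reasoning
    third : ∑ 𝔽₃s (λ b → ∑ (vectors m) (λ w → ⟦ dot h w ≡ c ⊝ a ⊗ b ⟧)) ≤ 3 ^ m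
    third = *-cancelˡ-≤ 3 (≤-trans (≤-reflexive (sym (∑-* 𝔽₃s 3 (λ b → ∑ (vectors m) (λ w → ⟦ dot h w ≡ c ⊝ a ⊗ b ⟧)))))
              (≤-trans (∑-mono′ 𝔽₃s (λ b → hyperplane h h≢𝟎 (c ⊝ a ⊗ b))) (≤-reflexive (∑-const 𝔽₃s (3 ^ m)))))
  ... | yes refl = *-monoʳ-≤ 3 (begin
      ∑ (vectors (suc m)) (λ w → ⟦ dot (a ∷ 𝟎) w ≡ c ⟧)  ≡⟨ ∑-vecs 𝔽₃s m _ ⟩
      ∑ 𝔽₃s (λ b → ∑ (vectors m) (λ w → ⟦ a ⊗ b ⊕ dot 𝟎 w ≡ c ⟧))
        ≤⟨ ∑-mono′ 𝔽₃s (λ b → ∑-mono′ (vectors m) (λ w → ⟦⟧-mono (λ e → ⊗-solve a b c a≢0 (trans (cong (a ⊗ b ⊕_) (sym (dot-𝟎 w))) e)))) ⟩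
      ∑ 𝔽₃s (λ b → ∑ (vectors m) (λ w → ⟦ b ≡ a ⊗ c ⟧))  ≡⟨ ∑-swap 𝔽₃s (vectors m) (λ b _ → ⟦ b ≡ a ⊗ c ⟧) ⟩
      ∑ (vectors m) (λ w → ∑ 𝔽₃s (λ b → ⟦ b ≡ a ⊗ c ⟧))  ≤⟨ ∑-mono′ (vectors m) (λ w → ∑-fiber (a ⊗ c)) ⟩
      ∑ (vectors m) (λ _ → 1)  ≡⟨ trans (∑-1 (vectors m)) (length-vecs 𝔽₃s m) ⟩
      3 ^ m  ∎)
    where
    open ℕₚ.≤-Reasoning
    a≢0 : a ≢ zero
    a≢0 refl = ah≢𝟎 refl

  Config : ℕ → ℕ → Set
  Config m n = Vec (Vector m) n

  _⊥[_]_ : ∀ {m n} → Vector m → Config m n → Subset n → Set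
  h ⊥[ v ] B = ∀ i → i ∈ₛ B → dot h (V.lookup v i) ≡ zero

  -- The dual form of spanning, since only functionals vanishing on sets are ever compared.
  Spanning : ∀ {m n} → Config m n → Subset n → Set
  Spanning v B = ∀ h → h ⊥[ v ] B → h ≡ 𝟎

  configs : ∀ m n → List (Config m n)
  configs m = vecs (vectors m)

  length-configs : ∀ m n → length (configs m n) ≡ (3 ^ m) ^ n
  length-configs m n = trans (length-vecs (vectors m) n) (cong (_^ n) (length-vecs 𝔽₃s m))

  -- The vectors of different points are independent, and each point of `B` costs a factor 3 by
  -- `hyperplane`.
  count-⊥ : ∀ {m n} (h : Vector m) → h ≢ 𝟎 → (B : Subset n) → 3 ^ ∣ B ∣ * ∑ (configs m n) (λ v → ⟦ h ⊥[ v ] B ⟧) ≤ (3 ^ m) ^ n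
  count-⊥ {m} {zero} h h≢𝟎 [] = ≤-trans (≤-reflexive (*-identityˡ _)) (≤-trans (≤-reflexive (+-identityʳ _)) (⟦⟧-≤1 _))
  count-⊥ {m} {suc n} h h≢𝟎 (false ∷ B) = begin
    3 ^ ∣ B ∣ * ∑ (configs m (suc n)) (λ v → ⟦ h ⊥[ v ] (false ∷ B) ⟧)  ≡⟨ cong (3 ^ ∣ B ∣ *_) (∑-vecs (vectors m) n _) ⟩
    3 ^ ∣ B ∣ * ∑ (vectors m) (λ w → ∑ (configs m n) (λ v → ⟦ h ⊥[ w ∷ v ] (false ∷ B) ⟧))
      ≤⟨ *-monoʳ-≤ (3 ^ ∣ B ∣) (∑-mono′ (vectors m) (λ w → ∑-mono′ (configs m n) (λ v → ⟦⟧-mono λ k i i∈ → k (suc i) (V.there i∈)))) ⟩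
    3 ^ ∣ B ∣ * ∑ (vectors m) (λ w → ∑ (configs m n) (λ v → ⟦ h ⊥[ v ] B ⟧))  ≡⟨ ∑-* (vectors m) (3 ^ ∣ B ∣) _ ⟨
    ∑ (vectors m) (λ w → 3 ^ ∣ B ∣ * ∑ (configs m n) (λ v → ⟦ h ⊥[ v ] B ⟧))  ≤⟨ ∑-mono′ (vectors m) (λ w → count-⊥ h h≢𝟎 B) ⟩
    ∑ (vectors m) (λ w → (3 ^ m) ^ n)  ≡⟨ trans (∑-const (vectors m) _) (cong (_* (3 ^ m) ^ n) (length-vecs 𝔽₃s m)) ⟩
    3 ^ m * (3 ^ m) ^ n  ∎
    where open ℕₚ.≤-Reasoning
  count-⊥ {m} {suc n} h h≢𝟎 (true ∷ B) = begin
    3 * 3 ^ ∣ B ∣ * ∑ (configs m (suc n)) (λ v → ⟦ h ⊥[ v ] (true ∷ B) ⟧)  ≡⟨ cong (3 * 3 ^ ∣ B ∣ *_) (∑-vecs (vectors m) n _) ⟩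
    3 * 3 ^ ∣ B ∣ * ∑ (vectors m) (λ w → ∑ (configs m n) (λ v → ⟦ h ⊥[ w ∷ v ] (true ∷ B) ⟧))
      ≤⟨ *-monoʳ-≤ (3 * 3 ^ ∣ B ∣) (∑-mono′ (vectors m) (λ w → ∑-mono′ (configs m n) (λ v →
           ≤-trans (⟦⟧-mono λ k → k zero V.here , λ i i∈ → k (suc i) (V.there i∈)) (≤-reflexive (⟦⟧-* _ _))))) ⟩
    3 * 3 ^ ∣ B ∣ * ∑ (vectors m) (λ w → ∑ (configs m n) (λ v → ⟦ dot h w ≡ zero ⟧ * ⟦ h ⊥[ v ] B ⟧))
      ≡⟨ cong (3 * 3 ^ ∣ B ∣ *_) (trans (∑-cong (vectors m) (λ w → ∑-* (configs m n) ⟦ dot h w ≡ zero ⟧ (λ v → ⟦ h ⊥[ v ] B ⟧))) (∑-*ʳ (vectors m) (∑ (configs m n) (λ v → ⟦ h ⊥[ v ] B ⟧)) (λ w → ⟦ dot h w ≡ zero ⟧))) ⟩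
    3 * 3 ^ ∣ B ∣ * (∑ (vectors m) (λ w → ⟦ dot h w ≡ zero ⟧) * ∑ (configs m n) (λ v → ⟦ h ⊥[ v ] B ⟧))
      ≡⟨ shuffle (3 ^ ∣ B ∣) (∑ (vectors m) (λ w → ⟦ dot h w ≡ zero ⟧)) (∑ (configs m n) (λ v → ⟦ h ⊥[ v ] B ⟧)) ⟩
    3 * ∑ (vectors m) (λ w → ⟦ dot h w ≡ zero ⟧) * (3 ^ ∣ B ∣ * ∑ (configs m n) (λ v → ⟦ h ⊥[ v ] B ⟧))
      ≤⟨ *-mono-≤ (hyperplane h h≢𝟎 zero) (count-⊥ h h≢𝟎 B) ⟩
    3 ^ m * (3 ^ m) ^ n  ∎
    where
    open ℕₚ.≤-Reasoning
    shuffle : ∀ x y z → 3 * x * (y * z) ≡ 3 * y * (x * z)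
    shuffle = solve-∀

  -- First moment method: a nonzero h orthogonal to B comes together with − h ≠ h,
  -- which gains the factor 2.
  few-nonspanning : ∀ {m n} (B : Subset n) → ∣ B ∣ ≡ m → 2 * ∑ (configs m n) (λ v → ⟦ ¬ Spanning v B ⟧) ≤ (3 ^ m) ^ n
  few-nonspanning {m} {n} B ∣B∣≡m = *-cancelˡ-≤ (3 ^ m) {{ℕₚ.m^n≢0 3 m}} (begin
    3 ^ m * (2 * ∑ (configs m n) (λ v → ⟦ ¬ Spanning v B ⟧))  ≡⟨ cong (3 ^ m *_) (sym (∑-* (configs m n) 2 _)) ⟩
    3 ^ m * ∑ (configs m n) (λ v → 2 * ⟦ ¬ Spanning v B ⟧)  ≤⟨ *-monoʳ-≤ (3 ^ m) (∑-mono′ (configs m n) pair) ⟩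
    3 ^ m * ∑ (configs m n) (λ v → ∑ (vectors m) (λ h → ⟦ Witness v h ⟧))  ≡⟨ cong (3 ^ m *_) (∑-swap (configs m n) (vectors m) _) ⟩
    3 ^ m * ∑ (vectors m) (λ h → ∑ (configs m n) (λ v → ⟦ Witness v h ⟧))  ≡⟨ ∑-* (vectors m) (3 ^ m) _ ⟨
    ∑ (vectors m) (λ h → 3 ^ m * ∑ (configs m n) (λ v → ⟦ Witness v h ⟧))  ≤⟨ ∑-mono′ (vectors m) each ⟩
    ∑ (vectors m) (λ h → (3 ^ m) ^ n)  ≡⟨ trans (∑-const (vectors m) _) (cong (_* (3 ^ m) ^ n) (length-vecs 𝔽₃s m)) ⟩
    3 ^ m * (3 ^ m) ^ n  ∎)
    where
    open ℕₚ.≤-Reasoning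
    Witness : Config m n → Vector m → Set
    Witness v h = (h ≢ 𝟎) × h ⊥[ v ] B
    each : ∀ h → 3 ^ m * ∑ (configs m n) (λ v → ⟦ Witness v h ⟧) ≤ (3 ^ m) ^ n
    each h with dec (h ≡ 𝟎)
    ... | yes p = ≤-trans (≤-reflexive (trans (cong (3 ^ m *_) (∑-zero (configs m n) (λ v _ → ⟦⟧-false (λ w → proj₁ w p)))) (*-zeroʳ (3 ^ m)))) z≤n
    ... | no ¬p = ≤-trans (*-mono-≤ (≤-reflexive (cong (3 ^_) (sym ∣B∣≡m))) (∑-mono′ (configs m n) (λ v → ⟦⟧-mono proj₂))) (count-⊥ h ¬p B)
    pair : ∀ v → 2 * ⟦ ¬ Spanning v B ⟧ ≤ ∑ (vectors m) (λ h → ⟦ Witness v h ⟧)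
    pair v with dec (¬ Spanning v B)
    ... | no _   = z≤n
    ... | yes ¬s with dec (∃[ h ] Witness v h)
    ...   | no ¬w = contradiction (λ h k → case dec (h ≡ 𝟎) of λ { (yes p) → p ; (no ¬p) → contradiction (h , ¬p , k) ¬w }) ¬s
    ...   | yes (h , h≢𝟎 , k) = begin
      2  ≡⟨ cong₂ (λ x y → x + (y + 0)) (⟦⟧-true (h≢𝟎 , k)) (⟦⟧-true (h′≢𝟎 , k′)) ⟨
      ⟦ Witness v h ⟧ + (⟦ Witness v (𝟎 − h) ⟧ + 0)  ≤⟨ ∑-⊆ (λ h → ⟦ Witness v h ⟧) (((λ e → h≢𝟎 (𝟎−≡ h (sym e))) ∷ []) ∷ [] ∷ []) (λ {x} _ → ∈-vectors x) ⟩
      ∑ (vectors m) (λ h → ⟦ Witness v h ⟧)  ∎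
      where
      h′≢𝟎 : 𝟎 − h ≢ 𝟎
      h′≢𝟎 e = h≢𝟎 (sym (−≡𝟎 𝟎 h e))
      k′ : (𝟎 − h) ⊥[ v ] B
      k′ i i∈ = trans (dot-− 𝟎 h (V.lookup v i)) (cong₂ _⊝_ (dot-𝟎 (V.lookup v i)) (k i i∈))

  layer : ∀ n → ℕ → List (Subset n)
  layer n k = filt (λ B → ∣ B ∣ ≡ k) (subsets n)

  nC0≡1 : ∀ n → n C 0 ≡ 1
  nC0≡1 n = trans (nCk≡nC[n∸k] {0} {n} z≤n) (nCn≡1 n)

  length-layer : ∀ n k → length (layer n k) ≡ n C k
  length-layer n k = trans (length-filt (λ B → ∣ B ∣ ≡ k) (subsets n)) (go n k)
    where
    open ≡-Reasoning
    go : ∀ n k → ∑ (subsets n) (λ B → ⟦ ∣ B ∣ ≡ k ⟧) ≡ n C k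
    go zero    zero    = trans (+-identityʳ _) (trans (⟦⟧-true refl) (sym (nC0≡1 0)))
    go zero    (suc k) = trans (+-identityʳ _) (trans (⟦⟧-false λ ()) (sym (k>n⇒nCk≡0 {0} {suc k} z<s)))
    go (suc n) zero    = begin
      ∑ (subsets (suc n)) (λ B → ⟦ ∣ B ∣ ≡ 0 ⟧)  ≡⟨ ∑-vecs bools n _ ⟩
      ∑ (subsets n) (λ B → ⟦ suc ∣ B ∣ ≡ 0 ⟧) + (∑ (subsets n) (λ B → ⟦ ∣ B ∣ ≡ 0 ⟧) + 0)
        ≡⟨ cong₂ _+_ (∑-zero (subsets n) (λ B _ → ⟦⟧-false λ ())) (trans (+-identityʳ _) (go n 0)) ⟩
      n C 0  ≡⟨ trans (nC0≡1 n) (sym (nC0≡1 (suc n))) ⟩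
      suc n C 0  ∎
    go (suc n) (suc k) = begin
      ∑ (subsets (suc n)) (λ B → ⟦ ∣ B ∣ ≡ suc k ⟧)  ≡⟨ ∑-vecs bools n _ ⟩
      ∑ (subsets n) (λ B → ⟦ suc ∣ B ∣ ≡ suc k ⟧) + (∑ (subsets n) (λ B → ⟦ ∣ B ∣ ≡ suc k ⟧) + 0)
        ≡⟨ cong₂ _+_ (trans (∑-cong (subsets n) (λ B → ⟦⟧-cong ℕₚ.suc-injective (cong suc))) (go n k)) (trans (+-identityʳ _) (go n (suc k))) ⟩
      n C k + n C suc k  ≡⟨ nCk+nC[k+1]≡[n+1]C[k+1] n k ⟩
      suc n C suc k  ∎

  -- By `few-nonspanning` each m-set spans in at least half of the configurations; after exchanging
  -- the sums, one configuration serves half of the layer.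
  many-spanning : ∀ n m → ∃[ v ] n C m ≤ 2 * ∑ (layer n m) (λ B → ⟦ Spanning {m} {n} v B ⟧)
  many-spanning n m =
    let v , _ , le = ∑-average (configs m n) (λ _ → length (layer n m)) (λ v → 2 * ∑ (layer n m) (λ B → ⟦ Spanning v B ⟧)) nonempty total
    in v , ≤-trans (≤-reflexive (sym (length-layer n m))) le
    where
    open ℕₚ.≤-Reasoning
    T = (3 ^ m) ^ n
    nonempty : 0 < length (configs m n)
    nonempty = subst (0 <_) (sym (length-configs m n)) (m^n>0 (3 ^ m) {{ℕₚ.m^n≢0 3 m}} n)
    half : ∀ B → B ∈ layer n m → T ≤ 2 * ∑ (configs m n) (λ v → ⟦ Spanning v B ⟧)
    half B B∈ = +-cancelʳ-≤ T _ _ (begin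
      T + T  ≡⟨ cong (T +_) (+-identityʳ T) ⟨
      2 * T  ≡⟨ cong (2 *_) (length-configs m n) ⟨
      2 * length (configs m n)  ≡⟨ cong (2 *_) (∑-⟦⟧+⟦¬⟧ (configs m n) (λ v → Spanning v B)) ⟨
      2 * (∑ (configs m n) (λ v → ⟦ Spanning v B ⟧) + ∑ (configs m n) (λ v → ⟦ ¬ Spanning v B ⟧))
        ≡⟨ *-distribˡ-+ 2 (∑ (configs m n) (λ v → ⟦ Spanning v B ⟧)) _ ⟩
      2 * ∑ (configs m n) (λ v → ⟦ Spanning v B ⟧) + 2 * ∑ (configs m n) (λ v → ⟦ ¬ Spanning v B ⟧)
        ≤⟨ +-monoʳ-≤ (2 * ∑ (configs m n) (λ v → ⟦ Spanning v B ⟧)) (few-nonspanning B (proj₂ (∈-filt⁻ {xs = subsets n} B∈))) ⟩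
      2 * ∑ (configs m n) (λ v → ⟦ Spanning v B ⟧) + T  ∎)
    total : ∑ (configs m n) (λ _ → length (layer n m)) ≤ ∑ (configs m n) (λ v → 2 * ∑ (layer n m) (λ B → ⟦ Spanning v B ⟧))
    total = begin
      ∑ (configs m n) (λ _ → length (layer n m))  ≡⟨ trans (∑-const (configs m n) _) (cong (_* length (layer n m)) (length-configs m n)) ⟩
      T * length (layer n m)  ≡⟨ trans (*-comm T _) (sym (∑-const (layer n m) T)) ⟩
      ∑ (layer n m) (λ _ → T)  ≤⟨ ∑-mono (layer n m) half ⟩
      ∑ (layer n m) (λ B → 2 * ∑ (configs m n) (λ v → ⟦ Spanning v B ⟧))  ≡⟨ ∑-* (layer n m) 2 _ ⟩
      2 * ∑ (layer n m) (λ B → ∑ (configs m n) (λ v → ⟦ Spanning v B ⟧))  ≡⟨ cong (2 *_) (∑-swap (layer n m) (configs m n) _) ⟩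
      2 * ∑ (configs m n) (λ v → ∑ (layer n m) (λ B → ⟦ Spanning v B ⟧))  ≡⟨ ∑-* (configs m n) 2 _ ⟨
      ∑ (configs m n) (λ v → 2 * ∑ (layer n m) (λ B → ⟦ Spanning v B ⟧))  ∎

  private
    values : ∀ {m n} → Vector m → Config m n → (A : Subset n) → Vector ∣ A ∣
    values h []      []          = []
    values h (w ∷ v) (true ∷ A)  = dot h w ∷ values h v A
    values h (w ∷ v) (false ∷ A) = values h v A

    values-≡ : ∀ {m n} (h h′ : Vector m) (v : Config m n) (A : Subset n) → values h v A ≡ values h′ v A → (h − h′) ⊥[ v ] A
    values-≡ h h′ (w ∷ v) (true ∷ A)  eq zero    V.here       =
      trans (dot-− h h′ w) (trans (cong (_⊝ dot h′ w) (cong V.head eq)) (⊝-self (dot h′ w)))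
    values-≡ h h′ (w ∷ v) (true ∷ A)  eq (suc i) (V.there i∈) = values-≡ h h′ v A (cong V.tail eq) i i∈
    values-≡ h h′ (w ∷ v) (false ∷ A) eq (suc i) (V.there i∈) = values-≡ h h′ v A eq i i∈

  -- Pigeonhole: 3^(k+1) functionals have at most 3^k lists of values on `A`, and the difference of
  -- two that collide vanishes there.
  few⇒orthogonal : ∀ {k n} (v : Config (suc k) n) (A : Subset n) → ∣ A ∣ ≡ k → ∃[ h ] h ≢ 𝟎 × h ⊥[ v ] A
  few⇒orthogonal {k} v A refl with dec (∃[ h ] ∃[ h′ ] h ≢ h′ × values h v A ≡ values h′ v A)
  ... | yes (h , h′ , h≢h′ , eq) = h − h′ , (λ e → h≢h′ (−≡𝟎 h h′ e)) , values-≡ h h′ v A eq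
  ... | no ¬collision = contradiction (begin-strict
      3 ^ k  <⟨ ℕₚ.^-monoʳ-< 3 (s≤s (s≤s z≤n)) (ℕₚ.n<1+n k) ⟩
      3 ^ suc k  ≡⟨ length-vecs 𝔽₃s (suc k) ⟨
      length (vectors (suc k))  ≡⟨ Listₚ.length-map (λ h → values h v A) (vectors (suc k)) ⟨
      length (map (λ h → values h v A) (vectors (suc k)))
        ≤⟨ unique-⊆⇒length≤ (Uniqₚ.map⁺ injective (vectors-unique (suc k))) (λ {x} _ → ∈-vectors x) ⟩
      length (vectors k)  ≡⟨ length-vecs 𝔽₃s k ⟩
      3 ^ k  ∎) (<-irrefl refl)
    where
    open ℕₚ.≤-Reasoning
    injective : ∀ {h h′} → values h v A ≡ values h′ v A → h ≡ h′
    injective {h} {h′} eq with dec (h ≡ h′)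
    ... | yes p = p
    ... | no ¬p = contradiction (h , h′ , ¬p , eq) ¬collision

  -- Cut or padded to length `q`, so that the record takes at most 3^q values for any list of
  -- points.
  truncated : ∀ {m n} → Config m n → ∀ q → List (Fin n) → Vector m → Vector q
  truncated v zero    _       h = []
  truncated v (suc q) []      h = zero ∷ truncated v q [] h
  truncated v (suc q) (i ∷ ℓ) h = dot h (V.lookup v i) ∷ truncated v q ℓ h

  truncated-≡ : ∀ {m n} (v : Config m n) q ℓ {h h′} → length ℓ ≤ q → truncated v q ℓ h ≡ truncated v q ℓ h′ →
                ∀ {i} → i ∈ ℓ → dot (h − h′) (V.lookup v i) ≡ zero
  truncated-≡ v (suc q) (i ∷ ℓ) {h} {h′} _ eq (here refl) =
    trans (dot-− h h′ (V.lookup v i)) (trans (cong (_⊝ dot h′ (V.lookup v i)) (cong V.head eq)) (⊝-self (dot h′ (V.lookup v i))))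
  truncated-≡ v (suc q) (_ ∷ ℓ) (s≤s le) eq (there p) = truncated-≡ v q ℓ le (cong V.tail eq) p

  -- Differences of sets, random parity cuts, and cuts of joined graphs.

  infixl 6 _△_ _∖_
  _△_ _∖_ : ∀ {n} → Subset n → Subset n → Subset n
  _△_ = V.zipWith _xor_
  _∖_ = V.zipWith (λ a b → a ∧ not b)

  ∈∖⁺ : ∀ {n} {p r : Subset n} {i} → i ∈ₛ p → i ∉ₛ r → i ∈ₛ p ∖ r
  ∈∖⁺ {p = _ ∷ _} {true ∷ _}  V.here       i∉ = contradiction V.here i∉
  ∈∖⁺ {p = _ ∷ _} {false ∷ _} V.here       i∉ = V.here
  ∈∖⁺ {p = _ ∷ _} {_ ∷ _}     (V.there i∈) i∉ = V.there (∈∖⁺ i∈ (i∉ ∘ V.there))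

  ∈∖⁻ˡ : ∀ {n} {p r : Subset n} {i} → i ∈ₛ p ∖ r → i ∈ₛ p
  ∈∖⁻ˡ {p = true ∷ _}  {false ∷ _} V.here   = V.here
  ∈∖⁻ˡ {p = _ ∷ _}     {_ ∷ _} (V.there i∈) = V.there (∈∖⁻ˡ i∈)

  ∈∖⁻ʳ : ∀ {n} (p r : Subset n) {i} → i ∈ₛ p ∖ r → i ∉ₛ r
  ∈∖⁻ʳ (true ∷ _) (false ∷ _) V.here ()
  ∈∖⁻ʳ (_ ∷ p) (_ ∷ r) (V.there i∈) (V.there q) = ∈∖⁻ʳ p r i∈ q

  ∣∖∣≤∣△∣ : ∀ {n} (p r : Subset n) → ∣ p ∖ r ∣ ≤ ∣ p △ r ∣
  ∣∖∣≤∣△∣ []          []          = z≤n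
  ∣∖∣≤∣△∣ (true ∷ p)  (true ∷ r)  = ∣∖∣≤∣△∣ p r
  ∣∖∣≤∣△∣ (true ∷ p)  (false ∷ r) = s≤s (∣∖∣≤∣△∣ p r)
  ∣∖∣≤∣△∣ (false ∷ p) (true ∷ r)  = ℕₚ.m≤n⇒m≤1+n (∣∖∣≤∣△∣ p r)
  ∣∖∣≤∣△∣ (false ∷ p) (false ∷ r) = ∣∖∣≤∣△∣ p r

  △-comm : ∀ {n} (p r : Subset n) → p △ r ≡ r △ p
  △-comm []          []          = refl
  △-comm (true ∷ p)  (true ∷ r)  = cong (_ ∷_) (△-comm p r)
  △-comm (true ∷ p)  (false ∷ r) = cong (_ ∷_) (△-comm p r)
  △-comm (false ∷ p) (true ∷ r)  = cong (_ ∷_) (△-comm p r)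
  △-comm (false ∷ p) (false ∷ r) = cong (_ ∷_) (△-comm p r)

  ∣△∣-triangle : ∀ {n} (p r b : Subset n) → ∣ p △ r ∣ ≤ ∣ p △ b ∣ + ∣ r △ b ∣
  ∣△∣-triangle []          []          []          = z≤n
  ∣△∣-triangle (true ∷ p)  (true ∷ r)  (true ∷ b)  = ∣△∣-triangle p r b
  ∣△∣-triangle (true ∷ p)  (true ∷ r)  (false ∷ b) = ℕₚ.m≤n⇒m≤1+n (≤-trans (∣△∣-triangle p r b) (+-monoʳ-≤ _ (n≤1+n _)))
  ∣△∣-triangle (true ∷ p)  (false ∷ r) (true ∷ b)  = ≤-trans (s≤s (∣△∣-triangle p r b)) (≤-reflexive (sym (+-suc ∣ p △ b ∣ ∣ r △ b ∣)))
  ∣△∣-triangle (true ∷ p)  (false ∷ r) (false ∷ b) = s≤s (∣△∣-triangle p r b)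
  ∣△∣-triangle (false ∷ p) (true ∷ r)  (true ∷ b)  = s≤s (∣△∣-triangle p r b)
  ∣△∣-triangle (false ∷ p) (true ∷ r)  (false ∷ b) = ≤-trans (s≤s (∣△∣-triangle p r b)) (≤-reflexive (sym (+-suc ∣ p △ b ∣ ∣ r △ b ∣)))
  ∣△∣-triangle (false ∷ p) (false ∷ r) (true ∷ b)  = ℕₚ.m≤n⇒m≤1+n (≤-trans (∣△∣-triangle p r b) (+-monoʳ-≤ _ (n≤1+n _)))
  ∣△∣-triangle (false ∷ p) (false ∷ r) (false ∷ b) = ∣△∣-triangle p r b

  ∣△∣-⊆ : ∀ {n} {p b : Subset n} → p ⊆ₛ b → ∣ p △ b ∣ + ∣ p ∣ ≡ ∣ b ∣
  ∣△∣-⊆ {p = []}        {[]}        _  = refl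
  ∣△∣-⊆ {p = true ∷ p}  {true ∷ b}  p⊆ = trans (+-suc ∣ p △ b ∣ ∣ p ∣) (cong suc (∣△∣-⊆ (Subₚ.drop-∷-⊆ p⊆)))
  ∣△∣-⊆ {p = true ∷ p}  {false ∷ b} p⊆ = contradiction (p⊆ V.here) λ ()
  ∣△∣-⊆ {p = false ∷ p} {true ∷ b}  p⊆ = cong suc (∣△∣-⊆ (Subₚ.drop-∷-⊆ p⊆))
  ∣△∣-⊆ {p = false ∷ p} {false ∷ b} p⊆ = ∣△∣-⊆ (Subₚ.drop-∷-⊆ p⊆)

  extra : ∀ {n} {p b : Subset n} → p ⊆ₛ b → ∣ b ∣ ≡ suc ∣ p ∣ → ∃[ a ] a ∈ₛ b × a ∉ₛ p × (∀ {i} → i ∈ₛ b → i ≡ a ⊎ i ∈ₛ p)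
  extra {p = true ∷ p} {true ∷ b} p⊆ eq =
    let a , a∈ , a∉ , cover = extra (Subₚ.drop-∷-⊆ p⊆) (ℕₚ.suc-injective eq)
    in suc a , V.there a∈ , (λ { (V.there q) → a∉ q }) ,
       λ { V.here → inj₂ V.here ; (V.there q) → [ inj₁ ∘ cong suc , inj₂ ∘ V.there ]′ (cover q) }
  extra {p = true ∷ p} {false ∷ b} p⊆ eq = contradiction (p⊆ V.here) λ ()
  extra {p = false ∷ p} {true ∷ b} p⊆ eq = zero , V.here , (λ ()) ,
    λ { V.here → inj₁ refl ; (V.there q) → inj₂ (V.there (subst (_ ∈ₛ_) (sym p≡b) q)) }
    where
    p≡b : p ≡ b
    p≡b = ⊆∧≥⇒≡ (Subₚ.drop-∷-⊆ p⊆) (≤-reflexive (ℕₚ.suc-injective eq))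
  extra {p = false ∷ p} {false ∷ b} p⊆ eq =
    let a , a∈ , a∉ , cover = extra (Subₚ.drop-∷-⊆ p⊆) eq
    in suc a , V.there a∈ , (λ { (V.there q) → a∉ q }) ,
       λ { (V.there q) → [ inj₁ ∘ cong suc , inj₂ ∘ V.there ]′ (cover q) }

  -- The cut of the subsets of [n] by the parity of their intersection with a
  -- random set, containing each point with probability 1 / q.
  module Parity (c : ℕ) (0<c : 0 < c) where

    -- The parameter is c = q - 2 because the bias of a single point is 1 - 2/q = c/q.
    q : ℕ
    q = suc (suc c)

    chosen : Fin q → Bool
    chosen zero    = true
    chosen (suc _) = false

    side : ∀ {n} → Vec (Fin q) n → Subset n → Bool
    side []      []      = false
    side (r ∷ ρ) (b ∷ p) = (chosen r ∧ b) xor side ρ p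

    side-△ : ∀ {n} (ρ : Vec (Fin q) n) p r → side ρ (p △ r) ≡ side ρ p xor side ρ r
    side-△ []      []      []      = refl
    side-△ (x ∷ ρ) (a ∷ p) (b ∷ r) = trans (cong (chosen x ∧ (a xor b) xor_) (side-△ ρ p r)) (shuffle (chosen x) a b (side ρ p) (side ρ r))
      where
      shuffle : ∀ x a b s t → (x ∧ (a xor b)) xor (s xor t) ≡ ((x ∧ a) xor s) xor ((x ∧ b) xor t)
      shuffle false a b s t = refl
      shuffle true true  true  true  t = refl
      shuffle true true  true  false true  = refl
      shuffle true true  true  false false = refl
      shuffle true true  false true  true  = refl
      shuffle true true  false true  false = refl
      shuffle true true  false false t = refl
      shuffle true false true  true  true  = refl
      shuffle true false true  true  false = refl
      shuffle true false true  false t = refl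
      shuffle true false false s t = refl

    choices : ∀ n → List (Vec (Fin q) n)
    choices = vecs (allFin q)

    length-choices : ∀ n → length (choices n) ≡ q ^ n
    length-choices n = trans (length-vecs (allFin q) n) (cong (_^ n) (length-allFin q))

    odds evens : ∀ {n} → Subset n → ℕ
    odds  {n} p = ∑ (choices n) (λ ρ → ⟦ side ρ p ≡ true ⟧)
    evens {n} p = ∑ (choices n) (λ ρ → ⟦ side ρ p ≡ false ⟧)

    private
      ∑-choices : ∀ n (f : Vec (Fin q) (suc n) → ℕ) (h₀ h₁ : Vec (Fin q) n → ℕ) →
                  (∀ ρ → f (zero ∷ ρ) ≡ h₀ ρ) → (∀ r ρ → f (suc r ∷ ρ) ≡ h₁ ρ) →
                  ∑ (choices (suc n)) f ≡ ∑ (choices n) h₀ + suc c * ∑ (choices n) h₁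
      ∑-choices n f h₀ h₁ e₀ e₁ = begin
        ∑ (choices (suc n)) f  ≡⟨ ∑-vecs (allFin q) n f ⟩
        ∑ (allFin q) (λ r → ∑ (choices n) (λ ρ → f (r ∷ ρ)))  ≡⟨ ∑-allFin-suc (λ r → ∑ (choices n) (λ ρ → f (r ∷ ρ))) ⟩
        ∑ (choices n) (λ ρ → f (zero ∷ ρ)) + ∑ (allFin (suc c)) (λ r → ∑ (choices n) (λ ρ → f (suc r ∷ ρ)))
          ≡⟨ cong₂ _+_ (∑-cong (choices n) e₀) (∑-cong (allFin (suc c)) (λ r → ∑-cong (choices n) (e₁ r))) ⟩
        ∑ (choices n) h₀ + ∑ (allFin (suc c)) (λ r → ∑ (choices n) h₁)
          ≡⟨ cong (∑ (choices n) h₀ +_) (trans (∑-const (allFin (suc c)) (∑ (choices n) h₁)) (cong (_* ∑ (choices n) h₁) (length-allFin (suc c)))) ⟩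
        ∑ (choices n) h₀ + suc c * ∑ (choices n) h₁  ∎
        where open ≡-Reasoning

      not-≡ : ∀ {b} x → ⟦ not x ≡ b ⟧ ≡ ⟦ x ≡ not b ⟧
      not-≡ {true}  true  = ⟦⟧-cong (λ ()) (λ ())
      not-≡ {true}  false = ⟦⟧-cong (λ _ → refl) (λ _ → refl)
      not-≡ {false} true  = ⟦⟧-cong (λ _ → refl) (λ _ → refl)
      not-≡ {false} false = ⟦⟧-cong (λ ()) (λ ())

      odds-in : ∀ {n} (p : Subset n) → odds (true ∷ p) ≡ evens p + suc c * odds p
      odds-in {n} p = ∑-choices n _ _ _ (λ ρ → not-≡ (side ρ p)) (λ _ _ → refl)

      evens-in : ∀ {n} (p : Subset n) → evens (true ∷ p) ≡ odds p + suc c * evens p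
      evens-in {n} p = ∑-choices n _ _ _ (λ ρ → not-≡ (side ρ p)) (λ _ _ → refl)

      odds-out : ∀ {n} (p : Subset n) → odds (false ∷ p) ≡ odds p + suc c * odds p
      odds-out {n} p = ∑-choices n _ _ _ (λ _ → refl) (λ _ _ → refl)

      evens-out : ∀ {n} (p : Subset n) → evens (false ∷ p) ≡ evens p + suc c * evens p
      evens-out {n} p = ∑-choices n _ _ _ (λ _ → refl) (λ _ _ → refl)

    evens+odds : ∀ {n} (p : Subset n) → evens p + odds p ≡ q ^ n
    evens+odds {n} p = trans (sym (∑-+ (choices n) _ _)) (trans (∑-cong (choices n) (λ ρ → exactly (side ρ p)))
                         (trans (∑-1 (choices n)) (length-choices n)))
      where
      exactly : ∀ x → ⟦ x ≡ false ⟧ + ⟦ x ≡ true ⟧ ≡ 1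
      exactly true  = cong₂ _+_ (⟦⟧-false λ ()) (⟦⟧-true refl)
      exactly false = cong₂ _+_ (⟦⟧-true refl) (⟦⟧-false λ ())

    -- Union bound: an odd intersection is nonempty, and each point is chosen with probability 1/q.
    odds≤ : ∀ {n} (p : Subset n) → q * odds p ≤ ∣ p ∣ * q ^ n
    odds≤ [] = ≤-reflexive (trans (cong (q *_) (trans (+-identityʳ _) (⟦⟧-false λ ()))) (*-zeroʳ q))
    odds≤ {suc n} (true ∷ p) = begin
      q * odds (true ∷ p)  ≡⟨ cong (q *_) (odds-in p) ⟩
      q * (evens p + suc c * odds p)  ≡⟨ distr q (evens p) (suc c) (odds p) ⟩
      q * evens p + suc c * (q * odds p)  ≤⟨ +-mono-≤ (*-monoʳ-≤ q (≤-trans (m≤m+n _ (odds p)) (≤-reflexive (evens+odds p))))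
                                                     (*-mono-≤ (n≤1+n (suc c)) (odds≤ p)) ⟩
      q * q ^ n + q * (∣ p ∣ * q ^ n)  ≡⟨ collect q (q ^ n) ∣ p ∣ ⟩
      suc ∣ p ∣ * (q * q ^ n)  ∎
      where
      open ℕₚ.≤-Reasoning
      distr : ∀ q a b d → q * (a + b * d) ≡ q * a + b * (q * d)
      distr = solve-∀
      collect : ∀ q x y → q * x + q * (y * x) ≡ suc y * (q * x)
      collect = solve-∀
    odds≤ {suc n} (false ∷ p) = begin
      q * odds (false ∷ p)  ≡⟨ cong (q *_) (odds-out p) ⟩
      q * (q * odds p)  ≤⟨ *-monoʳ-≤ q (odds≤ p) ⟩
      q * (∣ p ∣ * q ^ n)  ≡⟨ swap q ∣ p ∣ (q ^ n) ⟩
      ∣ p ∣ * (q * q ^ n)  ∎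
      where
      open ℕₚ.≤-Reasoning
      swap : ∀ a b x → a * (b * x) ≡ b * (a * x)
      swap = solve-∀

    -- The bias (evens − odds) / q^n equals (1 − 2 / q)^∣p∣.
    bias : ∀ {n} (p : Subset n) → ∃[ δ ] evens p ≡ odds p + δ × δ * q ^ ∣ p ∣ ≡ c ^ ∣ p ∣ * q ^ n
    bias [] = 1 , trans (trans (+-identityʳ _) (⟦⟧-true refl)) (cong (_+ 1) (sym (trans (+-identityʳ _) (⟦⟧-false λ ())))) , refl
    bias {suc n} (true ∷ p) with bias p
    ... | δ , e , f = c * δ , trans (evens-in p) (trans (cong (λ z → odds p + suc c * z) e)
                         (trans (expand (odds p) c δ) (cong (_+ c * δ) (sym (trans (odds-in p) (cong (_+ suc c * odds p) e)))))) ,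
                       trans (shuffle c δ q (q ^ ∣ p ∣)) (trans (cong (c * q *_) f) (shuffle′ c q (c ^ ∣ p ∣) (q ^ n)))
      where
      expand : ∀ o c δ → o + suc c * (o + δ) ≡ o + δ + suc c * o + c * δ
      expand = solve-∀
      shuffle : ∀ c δ q x → c * δ * (q * x) ≡ c * q * (δ * x)
      shuffle = solve-∀
      shuffle′ : ∀ c q x y → c * q * (x * y) ≡ c * x * (q * y)
      shuffle′ = solve-∀
    bias {suc n} (false ∷ p) with bias p
    ... | δ , e , f = q * δ , trans (evens-out p) (trans (cong (q *_) e) (trans (*-distribˡ-+ q (odds p) δ) (cong (_+ q * δ) (sym (odds-out p))))) ,
                       trans (*-assoc q δ _) (trans (cong (q *_) f) (swap q (c ^ ∣ p ∣) (q ^ n)))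
      where
      swap : ∀ a b x → a * (b * x) ≡ b * (a * x)
      swap = solve-∀

    -- From |p| = q on, the bias is at most 1/2 by `doubling`, so the odd side has probability at
    -- least 1/4.
    odds≥ : ∀ {n} (p : Subset n) → q ≤ ∣ p ∣ → q ^ n ≤ 4 * odds p
    odds≥ {n} p q≤p with bias p
    ... | δ , e , f = +-cancelʳ-≤ (q ^ n) _ _ (begin
      q ^ n + q ^ n  ≡⟨ cong₂ _+_ total total ⟩
      (odds p + δ + odds p) + (odds p + δ + odds p) ≡⟨ collect (odds p) δ ⟩
      4 * odds p + 2 * δ  ≤⟨ +-monoʳ-≤ (4 * odds p) small ⟩
      4 * odds p + q ^ n  ∎)
      where
      open ℕₚ.≤-Reasoning
      z = ∣ p ∣
      total : q ^ n ≡ odds p + δ + odds p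
      total = trans (sym (evens+odds p)) (cong (_+ odds p) e)
      collect : ∀ o δ → (o + δ + o) + (o + δ + o) ≡ 4 * o + 2 * δ
      collect = solve-∀
      c≤z : c ≤ z
      c≤z = ≤-trans (≤-trans (n≤1+n c) (n≤1+n (suc c))) q≤p
      powers : 2 * c ^ z ≤ q ^ z
      powers = begin
        2 * c ^ z  ≡⟨ cong (λ w → 2 * c ^ w) (m+[n∸m]≡n c≤z) ⟨
        2 * c ^ (c + (z ∸ c))  ≡⟨ trans (cong (2 *_) (ℕₚ.^-distribˡ-+-* c c (z ∸ c))) (sym (*-assoc 2 (c ^ c) _)) ⟩
        2 * c ^ c * c ^ (z ∸ c)  ≤⟨ *-mono-≤ (≤-trans (doubling c 0<c) (ℕₚ.^-monoˡ-≤ c (n≤1+n (suc c))))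
                                             (ℕₚ.^-monoˡ-≤ (z ∸ c) (≤-trans (n≤1+n c) (n≤1+n (suc c)))) ⟩
        q ^ c * q ^ (z ∸ c)  ≡⟨ ℕₚ.^-distribˡ-+-* q c (z ∸ c) ⟨
        q ^ (c + (z ∸ c))  ≡⟨ cong (q ^_) (m+[n∸m]≡n c≤z) ⟩
        q ^ z  ∎
      small : 2 * δ ≤ q ^ n
      small = *-cancelʳ-≤ (2 * δ) (q ^ n) (q ^ z) {{ℕₚ.m^n≢0 q z}} (begin
        2 * δ * q ^ z  ≡⟨ trans (*-assoc 2 δ _) (cong (2 *_) f) ⟩
        2 * (c ^ z * q ^ n)  ≡⟨ *-assoc 2 (c ^ z) _ ⟨
        2 * c ^ z * q ^ n  ≤⟨ *-monoˡ-≤ (q ^ n) powers ⟩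
        q ^ z * q ^ n  ≡⟨ *-comm (q ^ z) _ ⟩
        q ^ n * q ^ z  ∎)

  module Cut {N : ℕ} (t : ℕ) (es : Edges N) (joined : Joined t es) (σ : Fin N → Bool) where

    Crossing : Fin N × Fin N → Set
    Crossing (a , b) = σ a ≢ σ b

    crossing : ℕ
    crossing = ∑ es (λ e → ⟦ Crossing e ⟧)

    separated : ℕ
    separated = ∑ (allFin N) (λ x → ∑ (allFin N) (λ y → ⟦ σ x ≢ σ y ⟧))

    private
      a b : ℕ
      a = # (λ x → σ x ≡ true)
      b = # (λ x → σ x ≡ false)

      Isolated : Fin N → Set
      Isolated x = σ x ≡ true × ¬ (∃[ e ] e ∈ es × proj₁ e ≡ x × Crossing e)

      from-edges : ∀ (fs : Edges N) → # (λ x → ∃[ e ] e ∈ fs × proj₁ e ≡ x × Crossing e) ≤ ∑ fs (λ e → ⟦ Crossing e ⟧)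
      from-edges []       = ≤-reflexive (∑-zero (allFin N) (λ x _ → ⟦⟧-false λ { (_ , () , _) }))
      from-edges (f ∷ fs) = begin
        # (λ x → ∃[ e ] e ∈ f ∷ fs × proj₁ e ≡ x × Crossing e)
          ≤⟨ ∑-mono′ (allFin N) (λ x → ≤-trans (⟦⟧-mono split) (≤-trans (⟦⟧-⊎ _ _) (+-monoˡ-≤ _ (≤-reflexive (⟦⟧-* _ _))))) ⟩
        ∑ (allFin N) (λ x → ⟦ Crossing f ⟧ * ⟦ x ≡ proj₁ f ⟧ + ⟦ (∃[ e ] e ∈ fs × proj₁ e ≡ x × Crossing e) ⟧)
          ≡⟨ trans (∑-+ (allFin N) _ _) (cong (_+ # (λ x → ∃[ e ] e ∈ fs × proj₁ e ≡ x × Crossing e)) (∑-* (allFin N) ⟦ Crossing f ⟧ (λ x → ⟦ x ≡ proj₁ f ⟧))) ⟩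
        ⟦ Crossing f ⟧ * ∑ (allFin N) (λ x → ⟦ x ≡ proj₁ f ⟧) + # (λ x → ∃[ e ] e ∈ fs × proj₁ e ≡ x × Crossing e)
          ≤⟨ +-mono-≤ (≤-trans (*-monoʳ-≤ ⟦ Crossing f ⟧ (∑-fiber (proj₁ f))) (≤-reflexive (*-identityʳ _))) (from-edges fs) ⟩
        ⟦ Crossing f ⟧ + ∑ fs (λ e → ⟦ Crossing e ⟧)  ∎
        where
        open ℕₚ.≤-Reasoning
        split : ∀ {x} → ∃[ e ] e ∈ f ∷ fs × proj₁ e ≡ x × Crossing e →
                (Crossing f × x ≡ proj₁ f) ⊎ (∃[ e ] e ∈ fs × proj₁ e ≡ x × Crossing e)
        split (e , here refl , p , cr) = inj₁ (cr , sym p)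
        split (e , there e∈ , p , cr)  = inj₂ (e , e∈ , p , cr)

      a≤ : ¬ (t ≤ # Isolated) → a ≤ t + crossing
      a≤ small = begin
        a  ≤⟨ ∑-mono′ (allFin N) (λ x → ≤-trans (⟦⟧-mono classify) (⟦⟧-⊎ _ _)) ⟩
        ∑ (allFin N) (λ x → ⟦ Isolated x ⟧ + ⟦ (∃[ e ] e ∈ es × proj₁ e ≡ x × Crossing e) ⟧) ≡⟨ ∑-+ (allFin N) _ _ ⟩
        # Isolated + # (λ x → ∃[ e ] e ∈ es × proj₁ e ≡ x × Crossing e)  ≤⟨ +-mono-≤ (<⇒≤ (≰⇒> small)) (from-edges es) ⟩
        t + crossing  ∎
        where
        open ℕₚ.≤-Reasoning
        classify : ∀ {x} → σ x ≡ true → Isolated x ⊎ (∃[ e ] e ∈ es × proj₁ e ≡ x × Crossing e)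
        classify {x} p with dec (∃[ e ] e ∈ es × proj₁ e ≡ x × Crossing e)
        ... | yes q = inj₂ q
        ... | no ¬q = inj₁ (p , ¬q)

      -- No edge leads from an isolated vertex to the false side, so the isolated vertices or the
      -- false side number less than t. Every other vertex of the true side starts a crossing edge.
      unbalanced : a ≤ t + crossing ⊎ b ≤ t + crossing
      unbalanced with t ≤? # Isolated | t ≤? b where open ℕₚ
      ... | no ¬p | _     = inj₁ (a≤ ¬p)
      ... | yes _ | no ¬q = inj₂ (≤-trans (<⇒≤ (≰⇒> ¬q)) (m≤m+n t crossing))
      ... | yes p | yes q with joined Isolated (λ x → σ x ≡ false) p q
      ...   | e , e∈ , (tr , ¬cr) , fl = contradiction (e , e∈ , refl , λ eq → true≢false (trans (sym tr) (trans eq fl))) ¬cr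
        where
        true≢false : true ≢ false
        true≢false ()

      #≤N : ∀ (P : Fin N → Set) → # P ≤ N
      #≤N P = ≤-trans (∑-mono′ (allFin N) (λ x → ⟦⟧-≤1 _)) (≤-reflexive (trans (∑-1 (allFin N)) (length-allFin N)))

      ab≤ : a * b ≤ N * (t + crossing)
      ab≤ with unbalanced
      ... | inj₁ p = ≤-trans (*-mono-≤ p (#≤N (λ x → σ x ≡ false))) (≤-reflexive (*-comm _ N))
      ... | inj₂ p = *-mono-≤ (#≤N (λ x → σ x ≡ true)) p

      separated≡ : separated ≤ a * b + b * a
      separated≡ = begin
        separated
          ≤⟨ ∑-mono′ (allFin N) (λ x → ∑-mono′ (allFin N) (λ y → ≤-trans (⟦⟧-mono (opposite (σ x) (σ y))) (≤-trans (⟦⟧-⊎ _ _) (≤-reflexive (cong₂ _+_ (⟦⟧-* _ _) (⟦⟧-* _ _)))))) ⟩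
        ∑ (allFin N) (λ x → ∑ (allFin N) (λ y → ⟦ σ x ≡ true ⟧ * ⟦ σ y ≡ false ⟧ + ⟦ σ x ≡ false ⟧ * ⟦ σ y ≡ true ⟧))
          ≡⟨ ∑-cong (allFin N) (λ x → trans (∑-+ (allFin N) _ _) (cong₂ _+_ (∑-* (allFin N) ⟦ σ x ≡ true ⟧ (λ y → ⟦ σ y ≡ false ⟧)) (∑-* (allFin N) ⟦ σ x ≡ false ⟧ (λ y → ⟦ σ y ≡ true ⟧)))) ⟩
        ∑ (allFin N) (λ x → ⟦ σ x ≡ true ⟧ * b + ⟦ σ x ≡ false ⟧ * a)
          ≡⟨ trans (∑-+ (allFin N) _ _) (cong₂ _+_ (∑-*ʳ (allFin N) b (λ x → ⟦ σ x ≡ true ⟧)) (∑-*ʳ (allFin N) a (λ x → ⟦ σ x ≡ false ⟧))) ⟩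
        a * b + b * a  ∎
        where
        open ℕₚ.≤-Reasoning
        opposite : ∀ s s′ → s ≢ s′ → (s ≡ true × s′ ≡ false) ⊎ (s ≡ false × s′ ≡ true)
        opposite true  true  ne = contradiction refl ne
        opposite true  false ne = inj₁ (refl , refl)
        opposite false true  ne = inj₂ (refl , refl)
        opposite false false ne = contradiction refl ne

    -- One side has at most t + crossing vertices, the other at most N; ordered pairs give the
    -- factor 2.
    separated≤ : separated ≤ 2 * N * (t + crossing)
    separated≤ = begin
      separated  ≤⟨ separated≡ ⟩
      a * b + b * a  ≡⟨ cong (a * b +_) (*-comm b a) ⟩
      a * b + a * b  ≤⟨ +-mono-≤ ab≤ ab≤ ⟩
      N * (t + crossing) + N * (t + crossing)  ≡⟨ two N (t + crossing) ⟩
      2 * N * (t + crossing)  ∎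
      where
      open ℕₚ.≤-Reasoning
      two : ∀ N x → N * x + N * x ≡ 2 * N * x
      two = solve-∀

  -- No copy of the incidence poset with all edges sent to spanning sets.

  colours : ℕ → ℕ
  colours q = q * (q * 3 ^ q)

  palette : ∀ q → List (ℕ × ℕ × Vector q)
  palette q = cartesianProduct (upTo q) (cartesianProduct (upTo q) (vectors q))

  length-palette : ∀ q → length (palette q) ≡ colours q
  length-palette q = trans (length-× (upTo q) _) (cong₂ _*_ (Listₚ.length-upTo q) (trans (length-× (upTo q) (vectors q))
                       (cong₂ _*_ (Listₚ.length-upTo q) (length-vecs 𝔽₃s q))))
    where
    length-× : ∀ {X Y : Set} (xs : List X) (ys : List Y) → length (cartesianProduct xs ys) ≡ length xs * length ys
    length-× []       ys = refl
    length-× (x ∷ xs) ys = trans (Listₚ.length-++ (map (x ,_) ys)) (cong₂ _+_ (Listₚ.length-map (x ,_) ys) (length-× xs ys))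

  -- The losses on the way from all vertices to an independent set: 2 for the vertices near the
  -- centre, `colours q` for a colour class, q + 1 for the greedy choice. The radius q = 3 + 64 D is
  -- explained at `centre`.
  scale : ℕ → ℕ
  scale D = let q = 3 + 64 * D in 2 * colours q * suc q

  module Rigid {g D : ℕ} (G : SparseGraph g D (scale D)) where
    open SparseGraph G

    es : Edges N
    es = es₂ ++ es₁

    c q : ℕ
    c = suc (64 * D)
    q = suc (suc c)

    open Parity c z<s hiding (q)

    module _ {n k : ℕ} (v : Config (suc k) n) (A : Fin N → Subset n) (B : Fin (length es) → Subset n)
             (A-injective : ∀ {x y} → A x ≡ A y → x ≡ y) (B-injective : ∀ {e f} → B e ≡ B f → e ≡ f)
             (A⊆B : ∀ {e x} → Endpoint (lookup es e) x → A x ⊆ₛ B e)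
             (∣A∣≡k : ∀ {e x} → Endpoint (lookup es e) x → ∣ A x ∣ ≡ k)
             (∣B∣≡1+k : ∀ (e : Fin (length es)) → ∣ B e ∣ ≡ suc k) (spanning : ∀ e → Spanning v (B e)) where

      private
        Joins⇒endpointˡ : ∀ {ab : Fin N × Fin N} {x y} → Joins ab x y → Endpoint ab x
        Joins⇒endpointˡ (inj₁ (p , _)) = inj₁ p
        Joins⇒endpointˡ (inj₂ (p , _)) = inj₂ p

        -- Both sets miss exactly one point of `B e`.
        edge-△ : ∀ e {x y} → Joins (lookup es e) x y → ∣ A x △ A y ∣ ≤ 2
        edge-△ e {x} {y} j = ≤-trans (∣△∣-triangle (A x) (A y) (B e))
                               (≤-reflexive (cong₂ _+_ (one-more (Joins⇒endpointˡ j)) (one-more (Joins⇒endpointˡ (Joins-sym j)))))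
          where
          one-more : ∀ {x} → Endpoint (lookup es e) x → ∣ A x △ B e ∣ ≡ 1
          one-more {x} p = ℕₚ.+-cancelʳ-≡ ∣ A x ∣ _ _ (trans (∣△∣-⊆ (A⊆B p)) (trans (∣B∣≡1+k e) (cong suc (sym (∣A∣≡k p)))))

        Near : Fin N → Fin N → Set
        Near x y = ∣ A x △ A y ∣ < q

        Q = q ^ n

        module C (ρ : Vec (Fin q) n) = Cut t₁ es₁ joined₁ (λ x → side ρ (A x))

        side-≢ : ∀ ρ x y → ⟦ side ρ (A x) ≢ side ρ (A y) ⟧ ≡ ⟦ side ρ (A x △ A y) ≡ true ⟧
        side-≢ ρ x y = ⟦⟧-cong (λ ne → trans (side-△ ρ (A x) (A y)) (xor-≢ _ _ ne)) (λ e → ≢-xor _ _ (trans (sym (side-△ ρ (A x) (A y))) e))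
          where
          xor-≢ : ∀ a b → a ≢ b → a xor b ≡ true
          xor-≢ true  true  ne = contradiction refl ne
          xor-≢ true  false ne = refl
          xor-≢ false true  ne = refl
          xor-≢ false false ne = contradiction refl ne
          ≢-xor : ∀ a b → a xor b ≡ true → a ≢ b
          ≢-xor true  false _ ()
          ≢-xor false true  _ ()

        open ℕₚ.≤-Reasoning

        ∑-crossing : q * ∑ (choices n) C.crossing ≤ 2 * (D * N) * Q
        ∑-crossing = begin
          q * ∑ (choices n) C.crossing  ≡⟨ cong (q *_) (∑-swap (choices n) es₁ _) ⟩
          q * ∑ es₁ (λ e → ∑ (choices n) (λ ρ → ⟦ C.Crossing ρ e ⟧))  ≡⟨ ∑-* es₁ q _ ⟨
          ∑ es₁ (λ e → q * ∑ (choices n) (λ ρ → ⟦ C.Crossing ρ e ⟧))  ≤⟨ ∑-mono es₁ each ⟩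
          ∑ es₁ (λ e → 2 * Q)  ≡⟨ ∑-const es₁ (2 * Q) ⟩
          length es₁ * (2 * Q)  ≤⟨ *-monoˡ-≤ (2 * Q) short ⟩
          D * N * (2 * Q)  ≡⟨ swap (D * N) Q ⟩
          2 * (D * N) * Q  ∎
          where
          swap : ∀ a b → a * (2 * b) ≡ 2 * a * b
          swap = solve-∀
          each : ∀ e → e ∈ es₁ → q * ∑ (choices n) (λ ρ → ⟦ C.Crossing ρ e ⟧) ≤ 2 * Q
          each (a , b) e∈ = begin
            q * ∑ (choices n) (λ ρ → ⟦ side ρ (A a) ≢ side ρ (A b) ⟧)  ≡⟨ cong (q *_) (∑-cong (choices n) (λ ρ → side-≢ ρ a b)) ⟩
            q * odds (A a △ A b)  ≤⟨ odds≤ (A a △ A b) ⟩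
            ∣ A a △ A b ∣ * Q  ≤⟨ *-monoˡ-≤ Q (edge-△ (index e∈′) (inj₁ (cong proj₁ (lookup-index e∈′) , cong proj₂ (lookup-index e∈′)))) ⟩
            2 * Q  ∎
            where
            open import Data.List.Relation.Unary.Any using (index)
            open import Data.List.Relation.Unary.Any.Properties using (lookup-index)
            e∈′ : (a , b) ∈ es
            e∈′ = Memₚ.∈-++⁺ʳ es₂ e∈

        ∑-separated : ∑ (allFin N) (λ x → # (λ y → ¬ Near x y)) * Q ≤ 4 * ∑ (choices n) C.separated
        ∑-separated = begin
          ∑ (allFin N) (λ x → # (λ y → ¬ Near x y)) * Q  ≡⟨ ∑-*ʳ (allFin N) Q _ ⟨
          ∑ (allFin N) (λ x → # (λ y → ¬ Near x y) * Q)  ≡⟨ ∑-cong (allFin N) (λ x → sym (∑-*ʳ (allFin N) Q _)) ⟩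
          ∑ (allFin N) (λ x → ∑ (allFin N) (λ y → ⟦ ¬ Near x y ⟧ * Q))  ≤⟨ ∑-mono′ (allFin N) (λ x → ∑-mono′ (allFin N) (each x)) ⟩
          ∑ (allFin N) (λ x → ∑ (allFin N) (λ y → 4 * odds (A x △ A y)))
            ≡⟨ trans (∑-cong (allFin N) (λ x → ∑-* (allFin N) 4 _)) (∑-* (allFin N) 4 _) ⟩
          4 * ∑ (allFin N) (λ x → ∑ (allFin N) (λ y → odds (A x △ A y)))
            ≡⟨ cong (4 *_) (∑-cong (allFin N) (λ x → ∑-cong (allFin N) (λ y → ∑-cong (choices n) (λ ρ → sym (side-≢ ρ x y))))) ⟩
          4 * ∑ (allFin N) (λ x → ∑ (allFin N) (λ y → ∑ (choices n) (λ ρ → ⟦ side ρ (A x) ≢ side ρ (A y) ⟧)))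
            ≡⟨ cong (4 *_) (trans (∑-cong (allFin N) (λ x → ∑-swap (allFin N) (choices n) _)) (∑-swap (allFin N) (choices n) _)) ⟩
          4 * ∑ (choices n) C.separated  ∎
          where
          each : ∀ x y → ⟦ ¬ Near x y ⟧ * Q ≤ 4 * odds (A x △ A y)
          each x y with dec (¬ Near x y)
          ... | yes ¬p = ≤-trans (≤-reflexive (*-identityˡ Q)) (odds≥ (A x △ A y) (≮⇒≥ ¬p))
          ... | no _   = z≤n

      -- Otherwise at least N²/2 ordered pairs are far, each separated with probability at least
      -- 1/4. The expected number of separated pairs is at most 2N (N/32 + 2DN/q), so q ≤ 64 D,
      -- against the choice of q.
      centre : ∃[ x ] N ≤ 2 * # (Near x)
      centre with dec (∃[ x ] N ≤ 2 * # (Near x))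
      ... | yes p = p
      ... | no ¬p = contradiction q≤64D (ℕₚ.<⇒≱ (≤-trans (n≤1+n _) (n≤1+n _)))
        where
        many-far : ∀ x → N ≤ 2 * # (λ y → ¬ Near x y)
        many-far x = +-cancelʳ-≤ N _ _ (begin
          N + N  ≡⟨ cong (N +_) (+-identityʳ N) ⟨
          2 * N  ≡⟨ cong (2 *_) (trans (∑-⟦⟧+⟦¬⟧ (allFin N) (Near x)) (length-allFin N)) ⟨
          2 * (# (Near x) + # (λ y → ¬ Near x y))  ≡⟨ trans (*-distribˡ-+ 2 (# (Near x)) _) (+-comm (2 * # (Near x)) _) ⟩
          2 * # (λ y → ¬ Near x y) + 2 * # (Near x)  ≤⟨ +-monoʳ-≤ _ (<⇒≤ (≰⇒> (λ le → ¬p (x , le)))) ⟩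
          2 * # (λ y → ¬ Near x y) + N  ∎)
        far = ∑ (allFin N) (λ x → # (λ y → ¬ Near x y))
        cr = ∑ (choices n) C.crossing
        N²≤ : N * N ≤ 2 * far
        N²≤ = begin
          N * N  ≡⟨ trans (∑-const (allFin N) N) (cong (_* N) (length-allFin N)) ⟨
          ∑ (allFin N) (λ _ → N)  ≤⟨ ∑-mono′ (allFin N) many-far ⟩
          ∑ (allFin N) (λ x → 2 * # (λ y → ¬ Near x y))  ≡⟨ ∑-* (allFin N) 2 _ ⟩
          2 * far  ∎
        N²Q≤ : N * N * Q ≤ 32 * N * cr
        N²Q≤ = +-cancelʳ-≤ (N * N * Q) _ _ (begin
          N * N * Q + N * N * Q  ≡⟨ ab (N * N * Q) ⟩
          2 * (N * N * Q)  ≤⟨ *-monoʳ-≤ 2 (*-monoˡ-≤ Q N²≤) ⟩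
          2 * (2 * far * Q)  ≡⟨ four far Q ⟩
          4 * (far * Q)  ≤⟨ *-monoʳ-≤ 4 ∑-separated ⟩
          4 * (4 * ∑ (choices n) C.separated)  ≤⟨ *-monoʳ-≤ 4 (*-monoʳ-≤ 4 (∑-mono′ (choices n) C.separated≤)) ⟩
          4 * (4 * ∑ (choices n) (λ ρ → 2 * N * (t₁ + C.crossing ρ)))
            ≡⟨ cong (λ z → 4 * (4 * z)) (trans (∑-* (choices n) (2 * N) _) (cong (2 * N *_) (trans (∑-+ (choices n) _ _) (cong (_+ cr) (trans (∑-const (choices n) t₁) (cong (_* t₁) (length-choices n))))))) ⟩
          4 * (4 * (2 * N * (Q * t₁ + cr)))  ≡⟨ expand N Q t₁ cr ⟩
          -- Since N = 32 t₁, the contribution of `t₁` is half of the left side and cancels.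
          32 * N * cr + N * (32 * t₁) * Q  ≡⟨ cong (λ z → 32 * N * cr + N * z * Q) N≡32t₁ ⟨
          32 * N * cr + N * N * Q  ∎)
          where
          ab : ∀ x → x + x ≡ 2 * x
          ab = solve-∀
          four : ∀ x y → 2 * (2 * x * y) ≡ 4 * (x * y)
          four = solve-∀
          expand : ∀ N Q t x → 4 * (4 * (2 * N * (Q * t + x))) ≡ 32 * N * x + N * (32 * t) * Q
          expand = solve-∀
        q≤64D : q ≤ 64 * D
        q≤64D = *-cancelʳ-≤ q (64 * D) (N * N * Q) {{>-nonZero (*-mono-< {0} {N * N} {0} (*-mono-< {0} {N} {0} 0<N 0<N) (m^n>0 q n))}} (begin
          q * (N * N * Q)  ≤⟨ *-monoʳ-≤ q N²Q≤ ⟩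
          q * (32 * N * cr)  ≡⟨ swap q N cr ⟩
          32 * N * (q * cr)  ≤⟨ *-monoʳ-≤ (32 * N) ∑-crossing ⟩
          32 * N * (2 * (D * N) * Q)  ≡⟨ collect N D Q ⟩
          64 * D * (N * N * Q)  ∎)
          where
          swap : ∀ q N x → q * (32 * N * x) ≡ 32 * N * (q * x)
          swap = solve-∀
          collect : ∀ N D Q → 32 * N * (2 * (D * N) * Q) ≡ 64 * D * (N * N * Q)
          collect = solve-∀

      private
        x₀ : Fin N
        x₀ = proj₁ centre

        A₀ : Subset n
        A₀ = A x₀

        -- The size of A x is known only for ends of edges; an isolated vertex may be sent to the
        -- upper layer and then receives the default 0.
        normal : ∀ x → ∃[ h ] (∣ A x ∣ ≡ k → h ≢ 𝟎 × h ⊥[ v ] A x)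
        normal x with ∣ A x ∣ ≟ k where open ℕₚ
        ... | yes p = let h , w = few⇒orthogonal v (A x) p in h , λ _ → w
        ... | no ¬p = 𝟎 , λ p → contradiction p ¬p

        h : Fin N → Vector (suc k)
        h x = proj₁ (normal x)

        -- `Y` stands for A₀ ∖ A x, so A₀ ∖ Y is the trace of A x on A₀. A functional that vanishes
        -- on this trace is determined by its values at the points of `ℓ`.
        Completes : Subset n → List (Fin n) → Set
        Completes Y ℓ = length ℓ ≤ q × (∀ f → f ⊥[ v ] (A₀ ∖ Y) → (∀ {i} → i ∈ ℓ → dot f (V.lookup v i) ≡ zero) → f ≡ 𝟎)

        -- A choice that depends on `Y` alone, so that two sets with the same trace are tested at
        -- the same points.
        completion : ∀ Y → ∃[ ℓ ] (∃ (Completes Y) → Completes Y ℓ)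
        completion Y with dec (∃ (Completes Y))
        ... | yes (ℓ , w) = ℓ , λ _ → w
        ... | no ¬p       = [] , λ p → contradiction p ¬p

        colour : Fin N → ℕ × ℕ × Vector q
        colour x = ∣ A x ∖ A₀ ∣ , ∣ A₀ ∖ A x ∣ , truncated v q (proj₁ (completion (A₀ ∖ A x))) (h x)

        near⇒∈palette : ∀ {x} → Near x₀ x → colour x ∈ palette q
        near⇒∈palette {x} near = Memₚ.∈-cartesianProduct⁺ (Memₚ.∈-upTo⁺ out) (Memₚ.∈-cartesianProduct⁺ (Memₚ.∈-upTo⁺ in′) (∈-vectors _))
          where
          in′ : ∣ A₀ ∖ A x ∣ < q
          in′ = ≤-<-trans (∣∖∣≤∣△∣ A₀ (A x)) near
          out : ∣ A x ∖ A₀ ∣ < q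
          out = ≤-<-trans (∣∖∣≤∣△∣ (A x) A₀) (subst (λ z → ∣ z ∣ < q) (△-comm A₀ (A x)) near)

        -- An edge exchanges one point for another: B e is A x with a added, and also A y with b
        -- added.
        record Exchange (x y : Fin N) (e : Fin (length es)) : Set where
          field
            a b    : Fin n
            a∉x    : a ∉ₛ A x
            a∈y    : a ∈ₛ A y
            b∈x    : b ∈ₛ A x
            b∉y    : b ∉ₛ A y
            coverˣ : ∀ {i} → i ∈ₛ B e → i ≡ a ⊎ i ∈ₛ A x
            coverʸ : ∀ {i} → i ∈ₛ B e → i ≡ b ⊎ i ∈ₛ A y

        joins⇒≢ : ∀ {e x y} → Joins (lookup es e) x y → x ≢ y
        joins⇒≢ {e} j refl = Good⇒loopless good (Memₚ.∈-lookup {xs = es} e) j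

        exchange : ∀ {x y e} → Joins (lookup es e) x y → Exchange x y e
        exchange {x} {y} {e} j
          with extra (A⊆B px) (trans (∣B∣≡1+k e) (cong suc (sym (∣A∣≡k px)))) | extra (A⊆B py) (trans (∣B∣≡1+k e) (cong suc (sym (∣A∣≡k py))))
          where
          px = Joins⇒endpointˡ j
          py = Joins⇒endpointˡ (Joins-sym j)
        ... | a , a∈ , a∉x , coverˣ | b , b∈ , b∉y , coverʸ = record
          { a = a ; b = b ; a∉x = a∉x ; b∉y = b∉y ; coverˣ = coverˣ ; coverʸ = coverʸ
          ; a∈y = [ (λ a≡b → ⊥-elim (distinct a≡b)) , id ]′ (coverʸ a∈)
          ; b∈x = [ (λ b≡a → ⊥-elim (distinct (sym b≡a))) , id ]′ (coverˣ b∈) }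
          where
          distinct : a ≢ b
          distinct a≡b = joins⇒≢ j (A-injective (⊆∧≥⇒≡ sub (≤-reflexive (trans (∣A∣≡k (Joins⇒endpointˡ (Joins-sym j))) (sym (∣A∣≡k (Joins⇒endpointˡ j)))))))
            where
            sub : A x ⊆ₛ A y
            sub i∈ = [ (λ i≡b → contradiction (subst (_∈ₛ A x) (trans i≡b (sym a≡b)) i∈) a∉x) , id ]′ (coverʸ (A⊆B (Joins⇒endpointˡ j) i∈))

        -- The edges that a colour class can still contain: both exchanged points lie in A₀.
        SameOutside : Fin N → Fin N → Set
        SameOutside x y = (∃[ e ] Joins (lookup es e) x y) × A x ∖ A₀ ≡ A y ∖ A₀

        fewer-outside : ∀ {x y e} (X : Exchange x y e) → Exchange.a X ∈ₛ A₀ → Exchange.b X ∉ₛ A₀ → A y ⊆ₛ B e → ∣ A y ∖ A₀ ∣ < ∣ A x ∖ A₀ ∣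
        fewer-outside {x} {y} X a∈ b∉ y⊆ = Subₚ.p⊂q⇒∣p∣<∣q∣ (sub , b , ∈∖⁺ b∈x b∉ , λ b∈ → b∉y (∈∖⁻ˡ b∈))
          where
          open Exchange X
          sub : A y ∖ A₀ ⊆ₛ A x ∖ A₀
          sub i∈ = [ (λ { refl → contradiction a∈ (∈∖⁻ʳ (A y) A₀ i∈) }) , (λ i∈x → ∈∖⁺ i∈x (∈∖⁻ʳ (A y) A₀ i∈)) ]′ (coverˣ (y⊆ (∈∖⁻ˡ i∈)))

        flip : ∀ {x y e} → Exchange x y e → Exchange y x e
        flip X = record { a = b ; b = a ; a∉x = b∉y ; a∈y = b∈x ; b∈x = a∈y ; b∉y = a∉x ; coverˣ = coverʸ ; coverʸ = coverˣ }
          where open Exchange X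

        -- Adjacent sets with the same trace on A₀ have different colours, because
        -- otherwise their normals would agree on a spanning family.
        same-trace : ∀ {x y e} → Joins (lookup es e) x y → Exchange x y e → colour x ≡ colour y → ∣ A x ∖ A₀ ∣ < q → A₀ ∖ A x ≢ A₀ ∖ A y
        same-trace {x} {y} {e} j X col out Y≡ = proj₁ hx≢𝟎 (spanning e (h x) ⊥B)
          where
          open Exchange X
          px = Joins⇒endpointˡ j
          py = Joins⇒endpointˡ (Joins-sym j)
          hx≢𝟎 = proj₂ (normal x) (∣A∣≡k px)
          hy≢𝟎 = proj₂ (normal y) (∣A∣≡k py)
          Y = A₀ ∖ A x
          trace : ∀ {z i} → i ∈ₛ A₀ ∖ (A₀ ∖ A z) → i ∈ₛ A z
          trace {z} {i} i∈ with i Subₚ.∈? A z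
          ... | yes p = p
          ... | no ¬p = contradiction (∈∖⁺ (∈∖⁻ˡ i∈) ¬p) (∈∖⁻ʳ A₀ (A₀ ∖ A z) i∈)
          -- At most `q` points that together with the trace make up `B e`, which spans; so a
          -- completion exists.
          ℓ₀ = a ∷ elements (A x ∖ A₀)
          completes₀ : Completes Y ℓ₀
          completes₀ = ≤-trans (s≤s (≤-reflexive (length-elements (A x ∖ A₀)))) out , λ f f⊥ f⊥ℓ → spanning e f λ i i∈ →
            [ (λ { refl → f⊥ℓ (here refl) })
            , (λ i∈x → case i Subₚ.∈? A₀ of λ
                { (yes i∈₀) → f⊥ i (∈∖⁺ i∈₀ (λ i∈Y → ∈∖⁻ʳ A₀ (A x) i∈Y i∈x))
                ; (no i∉₀)  → f⊥ℓ (there (∈-elements (∈∖⁺ i∈x i∉₀))) }) ]′ (coverˣ i∈)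
          ℓ = proj₁ (completion Y)
          completes : Completes Y ℓ
          completes = proj₂ (completion Y) (ℓ₀ , completes₀)
          truncated≡ : truncated v q ℓ (h x) ≡ truncated v q ℓ (h y)
          truncated≡ = trans (cong (proj₂ ∘ proj₂) col) (cong (λ Z → truncated v q (proj₁ (completion Z)) (h y)) (sym Y≡))
          hx≡hy : h x ≡ h y
          hx≡hy = −≡𝟎 (h x) (h y) (proj₂ completes (h x − h y)
            (λ i i∈ → trans (dot-− (h x) (h y) (V.lookup v i)) (cong₂ _⊝_ (proj₂ hx≢𝟎 i (trace i∈)) (proj₂ hy≢𝟎 i (trace (subst (λ Z → i ∈ₛ A₀ ∖ Z) Y≡ i∈)))))
            (truncated-≡ v q ℓ (proj₁ completes) truncated≡))
          ⊥B : h x ⊥[ v ] B e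
          ⊥B i i∈ = [ (λ { refl → subst (λ f → dot f (V.lookup v a) ≡ zero) (sym hx≡hy) (proj₂ hy≢𝟎 a a∈y) }) , proj₂ hx≢𝟎 i ]′ (coverˣ i∈)

        -- If one of the exchanged points is in A₀ and the other is not, the size of the part
        -- outside A₀ changes. If both are outside, the traces agree, which `same-trace` excludes.
        -- If both are in A₀, the parts outside agree.
        same-colour : ∀ {x y e} → Joins (lookup es e) x y → colour x ≡ colour y → ∣ A x ∖ A₀ ∣ < q → SameOutside x y
        same-colour {x} {y} {e} j col out = (e , j) , outside≡
          where
          X = exchange j
          open Exchange X
          x⊆ : A x ⊆ₛ B e
          x⊆ = A⊆B (Joins⇒endpointˡ j)
          y⊆ : A y ⊆ₛ B e
          y⊆ = A⊆B (Joins⇒endpointˡ (Joins-sym j))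
          outside≡ : A x ∖ A₀ ≡ A y ∖ A₀
          outside≡ with a Subₚ.∈? A₀ | b Subₚ.∈? A₀
          ... | yes a∈ | no b∉  = contradiction (fewer-outside X a∈ b∉ y⊆) (<-irrefl (sym (cong proj₁ col)))
          ... | no a∉  | yes b∈ = contradiction (fewer-outside (flip X) b∈ a∉ x⊆) (<-irrefl (cong proj₁ col))
          ... | yes a∈ | yes b∈ = Subₚ.⊆-antisym
            (λ i∈ → [ (λ { refl → contradiction b∈ (∈∖⁻ʳ (A x) A₀ i∈) }) , (λ i∈y → ∈∖⁺ i∈y (∈∖⁻ʳ (A x) A₀ i∈)) ]′ (coverʸ (x⊆ (∈∖⁻ˡ i∈))))
            (λ i∈ → [ (λ { refl → contradiction a∈ (∈∖⁻ʳ (A y) A₀ i∈) }) , (λ i∈x → ∈∖⁺ i∈x (∈∖⁻ʳ (A y) A₀ i∈)) ]′ (coverˣ (y⊆ (∈∖⁻ˡ i∈))))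
          ... | no a∉  | no b∉  = contradiction (Subₚ.⊆-antisym
            (λ {i} i∈ → ∈∖⁺ (∈∖⁻ˡ i∈) (λ i∈y → [ (λ { refl → a∉ (∈∖⁻ˡ i∈) }) , ∈∖⁻ʳ A₀ (A x) i∈ ]′ (coverˣ (y⊆ i∈y))))
            (λ {i} i∈ → ∈∖⁺ (∈∖⁻ˡ i∈) (λ i∈x → [ (λ { refl → b∉ (∈∖⁻ˡ i∈) }) , ∈∖⁻ʳ A₀ (A y) i∈ ]′ (coverʸ (x⊆ i∈x)))))
            (same-trace j X col out)

        -- The point gained by A x lies in A₀ ∖ A x. It determines B e, hence the edge, as `B` is
        -- injective, hence its other end.
        few-neighbours : ∀ {x ys} → ∣ A₀ ∖ A x ∣ < q → Unique ys → (∀ {y} → y ∈ ys → SameOutside x y) → length ys ≤ q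
        few-neighbours {x} {ys} in′ u rel = ≤-trans
          (unique-relation {Φ = Φ} u (elements (A₀ ∖ A x)) total functional)
          (≤-trans (≤-reflexive (length-elements (A₀ ∖ A x))) (<⇒≤ in′))
          where
          Φ : Fin N → Fin n → Set
          Φ y a = ∃[ e ] Joins (lookup es e) x y × a ∈ₛ B e × (∀ {i} → i ∈ₛ B e → i ≡ a ⊎ i ∈ₛ A x)
          total : ∀ {y} → y ∈ ys → ∃[ a ] a ∈ elements (A₀ ∖ A x) × Φ y a
          total {y} y∈ with rel y∈
          ... | (e , j) , out≡ = a , ∈-elements (∈∖⁺ a∈₀ a∉x) , e , j , A⊆B (Joins⇒endpointˡ (Joins-sym j)) a∈y , coverˣ
            where
            open Exchange (exchange j)
            a∈₀ : a ∈ₛ A₀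
            a∈₀ with a Subₚ.∈? A₀
            ... | yes p = p
            ... | no ¬p = contradiction (∈∖⁻ˡ (subst (a ∈ₛ_) (sym out≡) (∈∖⁺ a∈y ¬p))) a∉x
          other : ∀ {ab : Fin N × Fin N} {y y′} → x ≢ y → Joins ab x y → Joins ab x y′ → y ≡ y′
          other ne (inj₁ (refl , refl)) (inj₁ (refl , refl)) = refl
          other ne (inj₁ (refl , refl)) (inj₂ (refl , refl)) = contradiction refl ne
          other ne (inj₂ (refl , refl)) (inj₁ (refl , refl)) = contradiction refl ne
          other ne (inj₂ (refl , refl)) (inj₂ (refl , refl)) = refl
          functional : ∀ {a y y′} → Φ y a → Φ y′ a → y ≡ y′
          functional {a} (e , j , a∈ , cov) (f , j′ , a∈′ , cov′) with B-injective {e} {f} (Subₚ.⊆-antisym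
            (λ i∈ → [ (λ { refl → a∈′ }) , A⊆B (Joins⇒endpointˡ j′) ]′ (cov i∈))
            (λ i∈ → [ (λ { refl → a∈ }) , A⊆B (Joins⇒endpointˡ j) ]′ (cov′ i∈)))
          ... | refl = other (joins⇒≢ j) j j′

      -- A popular colour class contains `t₂` vertices that are independent for `SameOutside`, yet
      -- `es₂` joins two of them, and such an edge is of the kind `SameOutside` by `same-colour`.
      contradictory : ⊥
      contradictory = ind (proj₁ (proj₂ (proj₂ inner))) (proj₂ (proj₂ (proj₂ inner))) (same-outside inner)
        where
        near = filt (Near x₀) (allFin N)
        popular = popular-colour near (palette q) colour (λ x x∈ → near⇒∈palette (proj₂ (∈-filt⁻ {xs = allFin N} x∈)))
                    (subst (0 <_) (sym (length-palette q)) (*-mono-< {0} {q} {0} z<s (*-mono-< {0} {q} {0} z<s (m^n>0 3 q))))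
        class = filt (λ x → colour x ≡ proj₁ popular) near
        class⁻ : ∀ {x} → x ∈ class → Near x₀ x × colour x ≡ proj₁ popular
        class⁻ x∈ = let x∈near , col = ∈-filt⁻ {xs = near} x∈ in proj₂ (∈-filt⁻ {xs = allFin N} x∈near) , col
        SameOutside-sym : ∀ {x y} → SameOutside x y → SameOutside y x
        SameOutside-sym ((e , j) , p) = (e , Joins-sym j) , sym p
        indep = independent SameOutside q SameOutside-sym (λ { ((e , j) , _) → joins⇒≢ j refl }) (length class) class ≤-refl
                  (filt-unique (filt-unique (Uniqₚ.allFin⁺ N)))
                  (λ {x} x∈ → few-neighbours (≤-<-trans (∣∖∣≤∣△∣ A₀ (A x)) (proj₁ (class⁻ x∈))))
        I = proj₁ indep
        I⊆ = proj₁ (proj₂ (proj₂ indep))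
        ind = proj₁ (proj₂ (proj₂ (proj₂ indep)))
        t₂≤I : t₂ ≤ length I
        t₂≤I = *-cancelˡ-≤ (scale D) {{>-nonZero scale>0}} (begin
          scale D * t₂  ≡⟨ N≡st₂ ⟨
          N  ≤⟨ proj₂ centre ⟩
          2 * # (Near x₀)  ≡⟨ cong (2 *_) (length-filt (Near x₀) (allFin N)) ⟨
          2 * length near  ≤⟨ *-monoʳ-≤ 2 (proj₂ popular) ⟩
          2 * (length (palette q) * length class)  ≡⟨ cong (λ z → 2 * (z * length class)) (length-palette q) ⟩
          2 * (colours q * length class)  ≤⟨ *-monoʳ-≤ 2 (*-monoʳ-≤ (colours q) (proj₂ (proj₂ (proj₂ (proj₂ indep))))) ⟩
          2 * (colours q * (suc q * length I))  ≡⟨ assoc (colours q) (suc q) (length I) ⟩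
          scale D * length I  ∎)
          where
          open ℕₚ.≤-Reasoning
          assoc : ∀ a b x → 2 * (a * (b * x)) ≡ 2 * a * b * x
          assoc = solve-∀
          scale>0 : 0 < scale D
          scale>0 = *-mono-< {0} {2 * colours q} {0} (*-mono-< {0} {2} {0} z<s (*-mono-< {0} {q} {0} z<s (*-mono-< {0} {q} {0} z<s (m^n>0 3 q)))) z<s
        inner : ∃[ e ] e ∈ es₂ × proj₁ e ∈ I × proj₂ e ∈ I
        inner = joined₂ (_∈ I) (_∈ I) (≤-trans t₂≤I (length≤# (proj₁ (proj₂ indep)))) (≤-trans t₂≤I (length≤# (proj₁ (proj₂ indep))))
        same-outside : (ε : ∃[ e ] e ∈ es₂ × proj₁ e ∈ I × proj₂ e ∈ I) → SameOutside (proj₁ (proj₁ ε)) (proj₂ (proj₁ ε))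
        same-outside ((a , b) , e∈ , a∈ , b∈) = same-colour {e = index e∈′} (inj₁ (cong proj₁ (lookup-index e∈′) , cong proj₂ (lookup-index e∈′)))
          (trans (proj₂ (class⁻ (I⊆ a∈))) (sym (proj₂ (class⁻ (I⊆ b∈)))))
          (≤-<-trans (∣∖∣≤∣△∣ (A a) A₀) (subst (λ z → ∣ z ∣ < q) (△-comm A₀ (A a)) (proj₁ (class⁻ (I⊆ a∈)))))
          where
          open import Data.List.Relation.Unary.Any using (index)
          open import Data.List.Relation.Unary.Any.Properties using (lookup-index)
          e∈′ : (a , b) ∈ es
          e∈′ = Memₚ.∈-++⁺ˡ e∈

  -- Binomial coefficients, fractions and maxima.

  binomial-! : ∀ a b → ((a + b) C a) * (a ! * b !) ≡ (a + b) !
  binomial-! a b = begin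
    ((a + b) C a) * (a ! * b !)  ≡⟨ cong (λ z → ((a + b) C a) * (a ! * z !)) (ℕₚ.m+n∸m≡n a b) ⟨
    ((a + b) C a) * (a ! * (a + b ∸ a) !)  ≡⟨ cong (_* (a ! * (a + b ∸ a) !)) (nCk≡n!/k![n-k]! a≤) ⟩
    _  ≡⟨ m/n*n≡m {{ℕₚ._!*_!≢0 a (a + b ∸ a)}} (k![n∸k]!∣n! a≤) ⟩
    (a + b) !  ∎
    where
    open ≡-Reasoning
    a≤ : a ≤ a + b
    a≤ = m≤m+n a b

  binomial-step : ∀ a b → ((a + suc b) C suc a) * suc a ≡ ((a + suc b) C a) * suc b
  binomial-step a b = ℕₚ.*-cancelʳ-≡ _ _ (a ! * b !) {{ℕₚ._!*_!≢0 a b}} (begin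
    ((a + suc b) C suc a) * suc a * (a ! * b !)  ≡⟨ shuffle ((a + suc b) C suc a) (suc a) (a !) (b !) ⟩
    ((a + suc b) C suc a) * (suc a * a ! * b !)  ≡⟨ cong (λ n → (n C suc a) * (suc a ! * b !)) (+-suc a b) ⟩
    (suc (a + b) C suc a) * (suc a ! * b !)  ≡⟨ binomial-! (suc a) b ⟩
    suc (a + b) !  ≡⟨ cong _! (+-suc a b) ⟨
    (a + suc b) !  ≡⟨ binomial-! a (suc b) ⟨
    ((a + suc b) C a) * (a ! * (suc b * b !))  ≡⟨ shuffle′ ((a + suc b) C a) (suc b) (a !) (b !) ⟩
    ((a + suc b) C a) * suc b * (a ! * b !)  ∎)
    where
    open ≡-Reasoning
    shuffle : ∀ x y a b → x * y * (a * b) ≡ x * (y * a * b)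
    shuffle = solve-∀
    shuffle′ : ∀ x y a b → x * (a * (y * b)) ≡ x * y * (a * b)
    shuffle′ = solve-∀

  /-mono-≤ : ∀ p q m d .{{_ : NonZero q}} .{{_ : NonZero d}} → p * d ≤ m * q → (ℤ.+ p) ℚ./ q ℚ.≤ (ℤ.+ m) ℚ./ d
  /-mono-≤ p (suc q) m (suc d) le = ℚₚ.toℚᵘ-cancel-≤ (ℚᵘₚ.≤-respˡ-≃ (ℚᵘₚ.≃-sym (ℚₚ.toℚᵘ-fromℚᵘ (ℚᵘ.mkℚᵘ (ℤ.+ p) q)))
    (ℚᵘₚ.≤-respʳ-≃ (ℚᵘₚ.≃-sym (ℚₚ.toℚᵘ-fromℚᵘ (ℚᵘ.mkℚᵘ (ℤ.+ m) d))) (ℚᵘ.*≤* (subst₂ ℤ._≤_ (ℤₚ.pos-* p (suc d)) (ℤₚ.pos-* m (suc q)) (ℤ.+≤+ le)))))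

  -- With b the denominator of c, the numerator is at least b + 1, so c ≥ 1 + 1/b.
  above-1 : ∀ {c} → ℚ.1ℚ ℚ.< c → ∃[ b ] 0 < b × (∀ m d .{{_ : NonZero d}} → c ℚ.≤ (ℤ.+ m) ℚ./ d → suc b * d ≤ b * m)
  above-1 {c@(ℚ.mkℚ (ℤ.+ p) q _)} 1<c = suc q , z<s , λ { m (suc d) le → ≤-trans (*-monoˡ-≤ (suc d) q<p)
    (≤-trans (ℤₚ.drop‿+≤+ (subst₂ ℤ._≤_ (sym (ℤₚ.pos-* p (suc d))) (sym (ℤₚ.pos-* m (suc q)))
      (ℚᵘₚ.drop-*≤* (ℚᵘₚ.≤-respʳ-≃ (ℚₚ.toℚᵘ-fromℚᵘ (ℚᵘ.mkℚᵘ (ℤ.+ m) d)) (ℚₚ.toℚᵘ-mono-≤ le))))) (≤-reflexive (*-comm m (suc q)))) }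
    where
    q<p : suc q < p
    q<p = subst₂ _<_ (*-identityˡ (suc q)) (*-identityʳ p) (ℤₚ.drop‿+<+ (subst₂ ℤ._<_ (sym (ℤₚ.pos-* 1 (suc q))) (sym (ℤₚ.pos-* p 1)) (ℚᵘₚ.drop-*<* (ℚₚ.toℚᵘ-mono-< 1<c))))
  above-1 {ℚ.mkℚ ℤ.-[1+ p ] q _} (ℚ.*<* ())

  hasSize : ∀ {n} (𝓕 : Family n) → HasSize 𝓕 (∑ (subsets n) (λ Y → ⟦ 𝓕 Y ⟧))
  hasSize {n} 𝓕 = filt 𝓕 (subsets n) , filt-unique (subsets-unique n) , length-filt 𝓕 (subsets n) ,
    λ Y → mk⇔ (∈-filt⁺ (∈-subsets Y)) (λ Y∈ → proj₂ (∈-filt⁻ {xs = subsets n} Y∈))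

  hasSize≤ : ∀ {n} {𝓕 : Family n} {k} → HasSize 𝓕 k → k ≤ 2 ^ n
  hasSize≤ {n} (xs , u , refl , _) = ≤-trans (unique-⊆⇒length≤ u (λ {Y} _ → ∈-subsets Y)) (≤-reflexive (length-vecs bools n))

  -- Descent from the bound. Membership is decided classically in `Set₁`, where freeness lives.
  maximum : ((A : Set₁) → Dec A) → (S : ℕ → Set₁) → ∀ b → (∀ k → S k → k ≤ b) → ∀ k → S k → ∃[ m ] IsMaximum S m
  maximum em S zero    bound k Sk = zero , subst S (ℕₚ.n≤0⇒n≡0 (bound k Sk)) Sk , bound
  maximum em S (suc b) bound k Sk with em (S (suc b))
  ... | yes p = suc b , p , bound
  ... | no ¬p = maximum em S b (λ j Sj → ≤-pred (ℕₚ.≤∧≢⇒< (bound j Sj) λ { refl → ¬p Sj })) k Sk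

  -- The two-layer family and its density.

  module TwoLayerFamily {g D : ℕ} (G : SparseGraph g D (scale D)) where
    open SparseGraph G
    open Rigid G using (es; contradictory)

    family : ∀ {n k} → Config (suc k) n → Family n
    family {k = k} v Y = (∣ Y ∣ ≡ k) ⊎ (∣ Y ∣ ≡ suc k × Spanning v Y)

    family-free : ∀ {n k} (v : Config (suc k) n) → incidencePoset es IsFree family v
    family-free {n} {k} v 𝓖 𝓖⊆ copy = contradictory v A B
      (λ eq → vertex-injective es (W.injective eq)) (λ eq → edge-injective es (W.injective eq))
      A⊆B (λ p → proj₁ (sizes p)) (λ e → proj₁ (proj₂ (sizes {e} (inj₁ refl)))) (λ e → proj₂ (proj₂ (sizes {e} (inj₁ refl))))
      where
      module W = _IsWeakCopyOf_ copy
      A : Fin N → Subset n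
      A x = W.ψ (vertex es x)
      B : Fin (length es) → Subset n
      B e = W.ψ (edge es e)
      A⊆B : ∀ {e x} → Endpoint (lookup es e) x → A x ⊆ₛ B e
      A⊆B p = W.monotone (vertex≼edge es p)
      -- Distinct nested members of the family lie in different layers, so ends of edges go to the
      -- lower layer and edges to spanning sets of the upper one.
      sizes : ∀ {e x} → Endpoint (lookup es e) x → ∣ A x ∣ ≡ k × ∣ B e ∣ ≡ suc k × Spanning v (B e)
      sizes {e} {x} p with 𝓖⊆ (W.ψ∈𝓖 (vertex es x)) | 𝓖⊆ (W.ψ∈𝓖 (edge es e))
      ... | inj₁ a       | inj₂ b       = a , b
      ... | inj₁ a       | inj₁ b       = contradiction (⊆∧≥⇒≡ (A⊆B p) (≤-reflexive (trans b (sym a)))) (λ eq → vertex≢edge es (W.injective eq))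
      ... | inj₂ (a , _) | inj₁ b       = contradiction (Subₚ.p⊆q⇒∣p∣≤∣q∣ (A⊆B p)) (subst₂ (λ s t → ¬ (s ≤ t)) (sym a) (sym b) (ℕₚ.<⇒≱ (ℕₚ.n<1+n k)))
      ... | inj₂ (a , _) | inj₂ (b , _) = contradiction (⊆∧≥⇒≡ (A⊆B p) (≤-reflexive (trans b (sym a)))) (λ eq → vertex≢edge es (W.injective eq))

    family-size : ∀ {n k} (v : Config (suc k) n) → n C suc k ≤ 2 * ∑ (layer n (suc k)) (λ Y → ⟦ Spanning v Y ⟧) →
                  2 * (n C k) + n C suc k ≤ 2 * ∑ (subsets n) (λ Y → ⟦ family v Y ⟧)
    family-size {n} {k} v half = begin
      2 * (n C k) + n C suc k
        ≤⟨ +-monoʳ-≤ (2 * (n C k)) half ⟩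
      2 * (n C k) + 2 * ∑ (layer n (suc k)) (λ Y → ⟦ Spanning v Y ⟧)
        ≡⟨ *-distribˡ-+ 2 (n C k) _ ⟨
      2 * (n C k + ∑ (layer n (suc k)) (λ Y → ⟦ Spanning v Y ⟧))
        ≡⟨ cong (2 *_) (cong₂ _+_ (trans (sym (length-layer n k)) (length-filt (λ Y → ∣ Y ∣ ≡ k) (subsets n))) (∑-filt (λ Y → ∣ Y ∣ ≡ suc k) (subsets n) _)) ⟩
      2 * (∑ (subsets n) (λ Y → ⟦ ∣ Y ∣ ≡ k ⟧) + ∑ (subsets n) (λ Y → ⟦ ∣ Y ∣ ≡ suc k ⟧ * ⟦ Spanning v Y ⟧))
        ≡⟨ cong (2 *_) (∑-+ (subsets n) _ _) ⟨
      2 * ∑ (subsets n) (λ Y → ⟦ ∣ Y ∣ ≡ k ⟧ + ⟦ ∣ Y ∣ ≡ suc k ⟧ * ⟦ Spanning v Y ⟧)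
        ≤⟨ *-monoʳ-≤ 2 (∑-mono′ (subsets n) disjoint) ⟩
      2 * ∑ (subsets n) (λ Y → ⟦ family v Y ⟧) ∎
      where
      open ℕₚ.≤-Reasoning
      disjoint : ∀ Y → ⟦ ∣ Y ∣ ≡ k ⟧ + ⟦ ∣ Y ∣ ≡ suc k ⟧ * ⟦ Spanning v Y ⟧ ≤ ⟦ family v Y ⟧
      disjoint Y with dec (∣ Y ∣ ≡ k)
      ... | yes p = ≤-trans (≤-reflexive (cong (λ z → suc (z * ⟦ Spanning v Y ⟧)) (⟦⟧-false (λ q → ℕₚ.m≢1+m+n k (trans (sym p) (trans q (cong suc (sym (+-identityʳ k)))))))))
                       (≤-reflexive (sym (⟦⟧-true (inj₁ p))))
      ... | no ¬p = ≤-trans (≤-reflexive (sym (⟦⟧-* (∣ Y ∣ ≡ suc k) (Spanning v Y)))) (⟦⟧-mono inj₂)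

    -- The ratio of the upper to the lower binomial coefficient is b / (k + 1), at least 1/2 here.
    upper-layer : ∀ k b → k ≤ b → 0 < k → (k + b) C k ≤ 2 * ((k + b) C suc k)
    upper-layer k (suc b) k≤ 0<k = *-cancelʳ-≤ _ _ (suc k) (begin
      ((k + suc b) C k) * suc k  ≤⟨ *-monoʳ-≤ ((k + suc b) C k) bound ⟩
      ((k + suc b) C k) * (2 * suc b)  ≡⟨ swap ((k + suc b) C k) (suc b) ⟩
      2 * (((k + suc b) C k) * suc b)  ≡⟨ cong (2 *_) (binomial-step k b) ⟨
      2 * (((k + suc b) C suc k) * suc k)  ≡⟨ *-assoc 2 ((k + suc b) C suc k) (suc k) ⟨
      2 * ((k + suc b) C suc k) * suc k  ∎)
      where
      open ℕₚ.≤-Reasoning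
      swap : ∀ x y → x * (2 * y) ≡ 2 * (x * y)
      swap = solve-∀
      bound : suc k ≤ 2 * suc b
      bound = begin
        suc k  ≤⟨ +-mono-≤ 0<k k≤ ⟩
        k + suc b  ≤⟨ +-mono-≤ k≤ ≤-refl ⟩
        suc b + suc b  ≡⟨ cong (suc b +_) (+-identityʳ (suc b)) ⟨
        2 * suc b  ∎
    upper-layer zero zero k≤ ()

    -- The middle layer and half of the next one, which is itself at least half as large, give 5/4
    -- of the middle binomial coefficient; the constant 9/8 lies strictly between this and 1.
    large : ∀ n k → k ≡ ⌊ n /2⌋ → 2 ≤ n → ∀ s → 2 * (n C k) + n C suc k ≤ 2 * s → 9 * (n C k) ≤ 8 * s
    large n k k≡ 2≤n s le = begin
      9 * (n C k)  ≤⟨ *-monoˡ-≤ (n C k) (n≤1+n 9) ⟩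
      10 * (n C k)  ≡⟨ ten (n C k) ⟩
      8 * (n C k) + 2 * (n C k)  ≤⟨ +-monoʳ-≤ (8 * (n C k)) (*-monoʳ-≤ 2 upper) ⟩
      8 * (n C k) + 2 * (2 * (n C suc k))  ≡⟨ collect (n C k) (n C suc k) ⟩
      4 * (2 * (n C k) + n C suc k)  ≤⟨ *-monoʳ-≤ 4 le ⟩
      4 * (2 * s)  ≡⟨ *-assoc 4 2 s ⟨
      8 * s  ∎
      where
      open ℕₚ.≤-Reasoning
      ten : ∀ x → 10 * x ≡ 8 * x + 2 * x
      ten = solve-∀
      collect : ∀ x y → 8 * x + 2 * (2 * y) ≡ 4 * (2 * x + y)
      collect = solve-∀
      n≡ : k + ⌈ n /2⌉ ≡ n
      n≡ = trans (cong (_+ ⌈ n /2⌉) k≡) (ℕₚ.⌊n/2⌋+⌈n/2⌉≡n n)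
      upper : n C k ≤ 2 * (n C suc k)
      upper = subst (λ m → m C k ≤ 2 * (m C suc k)) n≡ (upper-layer k ⌈ n /2⌉
             (subst (_≤ ⌈ n /2⌉) (sym k≡) (ℕₚ.⌊n/2⌋≤⌈n/2⌉ n))
             (subst (0 <_) (sym k≡) (ℕₚ.⌊n/2⌋-mono 2≤n)))

    π⁻>1 : ((A : Set₁) → Dec A) → ℚ.1ℚ <π⁻[ incidencePoset es ]
    π⁻>1 em = (λ n → proj₁ (La n)) , (λ n → proj₂ (La n)) , (ℤ.+ 9) ℚ./ 8 , 1<9/8 , 2 , λ n 2≤n →
      /-mono-≤ 9 8 (proj₁ (La n)) (n C ⌊ n /2⌋) {{_}} {{nCk-nonZero (ℕₚ.⌊n/2⌋≤n n)}}
        (≤-trans (large n ⌊ n /2⌋ refl 2≤n (proj₁ (La n)) (≤-trans (family-size (v n) (proj₂ (many-spanning n (suc ⌊ n /2⌋))))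
          (*-monoʳ-≤ 2 (proj₂ (proj₂ (La n)) _ (family (v n) , hasSize (family (v n)) , family-free (v n)))))) (≤-reflexive (*-comm 8 (proj₁ (La n)))))
      where
      open import Relation.Nullary.Decidable using (from-yes)
      v : ∀ n → Config (suc ⌊ n /2⌋) n
      v n = proj₁ (many-spanning n (suc ⌊ n /2⌋))
      La : ∀ n → ∃[ m ] La[ n , incidencePoset es ]≡ m
      La n = maximum em _ (2 ^ n) (λ k → λ { (𝓕 , size , _) → hasSize≤ {𝓕 = 𝓕} size }) _ (family (v n) , hasSize (family (v n)) , family-free (v n))
      1<9/8 : ℚ.1ℚ ℚ.< (ℤ.+ 9) ℚ./ 8
      1<9/8 = from-yes (ℚ.1ℚ ℚₚ.<? (ℤ.+ 9) ℚ./ 8)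

  -- Counting members and comparable pairs along maximal chains.

  _⊊_ : ∀ {n} → Subset n → Subset n → Set
  A ⊊ B = A ⊆ₛ B × A ≢ B

  ⊊⇒< : ∀ {n} {A B : Subset n} → A ⊊ B → ∣ A ∣ < ∣ B ∣
  ⊊⇒< (A⊆B , A≢B) = ≰⇒> (λ le → A≢B (⊆∧≥⇒≡ A⊆B le))

  ∣∖∣-⊆ : ∀ {n} {p b : Subset n} → p ⊆ₛ b → ∣ b ∖ p ∣ + ∣ p ∣ ≡ ∣ b ∣
  ∣∖∣-⊆ {p = []}        {[]}        _  = refl
  ∣∖∣-⊆ {p = true ∷ p}  {true ∷ b}  p⊆ = trans (+-suc ∣ b ∖ p ∣ ∣ p ∣) (cong suc (∣∖∣-⊆ (Subₚ.drop-∷-⊆ p⊆)))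
  ∣∖∣-⊆ {p = true ∷ p}  {false ∷ b} p⊆ = contradiction (p⊆ V.here) λ ()
  ∣∖∣-⊆ {p = false ∷ p} {true ∷ b}  p⊆ = cong suc (∣∖∣-⊆ (Subₚ.drop-∷-⊆ p⊆))
  ∣∖∣-⊆ {p = false ∷ p} {false ∷ b} p⊆ = ∣∖∣-⊆ (Subₚ.drop-∷-⊆ p⊆)

  -- The number of maximal chains between A and T.
  chains : ∀ {n} → Subset n → Subset n → ℕ
  chains A T = ⟦ A ⊆ₛ T ⟧ * (∣ T ∣ ∸ ∣ A ∣) !

  module Chains {n : ℕ} where

    private
      delete : Subset n → Fin n → Subset n
      delete T i = T ∖ ⁅ i ⁆

      ∣delete∣ : ∀ {T i} → i ∈ₛ T → suc ∣ delete T i ∣ ≡ ∣ T ∣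
      ∣delete∣ {T} {i} i∈ = trans (+-comm 1 _) (trans (cong (∣ delete T i ∣ +_) (sym (Subₚ.∣⁅x⁆∣≡1 i)))
        (∣∖∣-⊆ {p = ⁅ i ⁆} (λ j∈ → subst (_∈ₛ T) (sym (Subₚ.x∈⁅y⁆⇒x≡y i j∈)) i∈)))

      ⊆delete : ∀ {A T i} → A ⊆ₛ T → i ∉ₛ A → A ⊆ₛ delete T i
      ⊆delete {A} {i = i} A⊆ i∉ {j} j∈ = ∈∖⁺ (A⊆ j∈) (λ j∈i → i∉ (subst (_∈ₛ A) (Subₚ.x∈⁅y⁆⇒x≡y i j∈i) j∈))

      ⊆delete⁻ : ∀ {A T i} → A ⊆ₛ delete T i → A ⊆ₛ T × i ∉ₛ A
      ⊆delete⁻ {A} {T} {i} A⊆ = (λ j∈ → ∈∖⁻ˡ (A⊆ j∈)) , λ i∈ → ∈∖⁻ʳ T ⁅ i ⁆ (A⊆ i∈) (Subₚ.x∈⁅x⁆ i)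

      below : Subset n → (Subset n → ℕ) → ℕ
      below T f = ∑ (elements T) (λ i → f (delete T i))

    -- A maximal chain that ends in T passes, just before, through exactly one set T minus a point.
    chains-step : ∀ {A T} → A ≢ T → chains A T ≡ below T (chains A)
    chains-step {A} {T} A≢T with dec (A ⊆ₛ T)
    ... | no ¬p = sym (∑-zero (elements T) (λ i _ → cong (_* (∣ delete T i ∣ ∸ ∣ A ∣) !) (⟦⟧-false {A ⊆ₛ delete T i} (λ q → ¬p (λ j∈ → ∈∖⁻ˡ (q j∈))))))
    ... | yes A⊆T = begin
      (∣ T ∣ ∸ ∣ A ∣) ! + 0  ≡⟨ trans (+-identityʳ _) (cong _! (sym size)) ⟩
      ∣ T ∖ A ∣ !  ≡⟨ factor (∣ T ∖ A ∣) positive ⟩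
      ∣ T ∖ A ∣ * (∣ T ∖ A ∣ ∸ 1) !  ≡⟨ cong (_* (∣ T ∖ A ∣ ∸ 1) !) (sym count) ⟩
      ∑ (elements T) (λ i → ⟦ i ∉ₛ A ⟧) * (∣ T ∖ A ∣ ∸ 1) !  ≡⟨ ∑-*ʳ (elements T) ((∣ T ∖ A ∣ ∸ 1) !) _ ⟨
      ∑ (elements T) (λ i → ⟦ i ∉ₛ A ⟧ * (∣ T ∖ A ∣ ∸ 1) !)  ≡⟨ ∑-cong∈ (elements T) each ⟩
      below T (chains A)  ∎
      where
      open ≡-Reasoning
      ∑-cong∈ : ∀ {X : Set} (xs : List X) {f h : X → ℕ} → (∀ x → x ∈ xs → f x ≡ h x) → ∑ xs f ≡ ∑ xs h
      ∑-cong∈ []       e = refl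
      ∑-cong∈ (x ∷ xs) e = cong₂ _+_ (e x (here refl)) (∑-cong∈ xs (λ y → e y ∘ there))
      size : ∣ T ∖ A ∣ ≡ ∣ T ∣ ∸ ∣ A ∣
      size = trans (sym (ℕₚ.m+n∸n≡m ∣ T ∖ A ∣ ∣ A ∣)) (cong (_∸ ∣ A ∣) (∣∖∣-⊆ A⊆T))
      positive : 0 < ∣ T ∖ A ∣
      positive = subst (0 <_) (sym size) (ℕₚ.m<n⇒0<n∸m (⊊⇒< (A⊆T , A≢T)))
      factor : ∀ x → 0 < x → x ! ≡ x * (x ∸ 1) !
      factor (suc x) _ = refl
      count : ∑ (elements T) (λ i → ⟦ i ∉ₛ A ⟧) ≡ ∣ T ∖ A ∣
      count = trans (∑-filt (_∈ₛ T) (allFin n) _) (trans (∑-cong (allFin n) (λ i → trans (sym (⟦⟧-* (i ∈ₛ T) (i ∉ₛ A)))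
                (⟦⟧-cong (λ { (p , q) → ∈∖⁺ p q }) (λ p → ∈∖⁻ˡ p , ∈∖⁻ʳ T A p)))) (#-∈ₛ (T ∖ A)))
      each : ∀ i → i ∈ elements T → ⟦ i ∉ₛ A ⟧ * (∣ T ∖ A ∣ ∸ 1) ! ≡ chains A (delete T i)
      each i i∈ = cong₂ (λ x y → x * y !) (⟦⟧-cong (λ i∉ {j} → ⊆delete A⊆T i∉ {j}) (λ q → proj₂ (⊆delete⁻ {A} {T} {i} (λ {j} → q {j}))))
                    (trans (cong (_∸ 1) size) (trans (ℕₚ.∸-+-assoc ∣ T ∣ ∣ A ∣ 1) (trans (cong (∣ T ∣ ∸_) (+-comm ∣ A ∣ 1))
                      (cong (_∸ suc ∣ A ∣) (sym (∣delete∣ (proj₂ (∈-filt⁻ {xs = allFin n} i∈))))))))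

    module _ (F : List (Subset n)) where

      -- The sums, over all maximal chains between ∅ and T, of the number of
      -- members of F and of the number of pairs of members of F.
      members pairs : Subset n → ℕ
      members T = ∑ F (λ A → ∣ A ∣ ! * chains A T)
      pairs   T = ∑ F (λ A → ∑ F (λ B → ⟦ A ⊊ B ⟧ * (∣ A ∣ ! * ((∣ B ∣ ∸ ∣ A ∣) ! * chains B T))))

      private
        ∑-below : ∀ T (w : Subset n → ℕ) → T ∉ F → ∑ F (λ A → w A * chains A T) ≡ below T (λ T′ → ∑ F (λ A → w A * chains A T′))
        ∑-below T w T∉ = trans (go F T∉) (∑-swap F (elements T) (λ A i → w A * chains A (delete T i)))
          where
          go : ∀ xs → T ∉ xs → ∑ xs (λ A → w A * chains A T) ≡ ∑ xs (λ A → ∑ (elements T) (λ i → w A * chains A (delete T i)))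
          go []       _  = refl
          go (A ∷ xs) T∉ = cong₂ _+_ (trans (cong (w A *_) (chains-step (λ { refl → T∉ (here refl) }))) (sym (∑-* (elements T) (w A) _))) (go xs (T∉ ∘ there))

      -- No pair has T as its upper member, so each is counted on the chains up to the last set
      -- before T.
      pairs-step : ∀ T → T ∉ F → pairs T ≡ below T pairs
      pairs-step T T∉ = begin
        pairs T  ≡⟨ reorder T ⟩
        ∑ F (λ B → weight B * chains B T)  ≡⟨ ∑-below T weight T∉ ⟩
        below T (λ T′ → ∑ F (λ B → weight B * chains B T′))  ≡⟨ ∑-cong (elements T) (λ i → sym (reorder (delete T i))) ⟩
        below T pairs  ∎
        where
        open ≡-Reasoning
        weight : Subset n → ℕ
        weight B = ∑ F (λ A → ⟦ A ⊊ B ⟧ * (∣ A ∣ ! * (∣ B ∣ ∸ ∣ A ∣) !))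
        assoc : ∀ a b c d → a * (b * (c * d)) ≡ a * (b * c) * d
        assoc = solve-∀
        reorder : ∀ T → pairs T ≡ ∑ F (λ B → weight B * chains B T)
        reorder T = trans (∑-swap F F _) (∑-cong F (λ B → trans (∑-cong F (λ A → assoc ⟦ A ⊊ B ⟧ (∣ A ∣ !) ((∣ B ∣ ∸ ∣ A ∣) !) (chains B T))) (∑-*ʳ F (chains B T) _)))

      module _ (uF : Unique F) where

        private
          chains-self : ∀ (T : Subset n) → chains T T ≡ 1
          chains-self T = cong₂ (λ x y → x * y !) (⟦⟧-true {T ⊆ₛ T} (λ p → p)) (ℕₚ.n∸n≡0 ∣ T ∣)

          member-case : ∀ T → T ∈ F → members T ≤ ∣ T ∣ ! + pairs T
          member-case T T∈ = begin
            ∑ F (λ A → ∣ A ∣ ! * chains A T)  ≤⟨ ∑-mono′ F split ⟩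
            ∑ F (λ A → ⟦ A ≡ T ⟧ * ∣ T ∣ ! + top A)  ≡⟨ ∑-+ F _ _ ⟩
            ∑ F (λ A → ⟦ A ≡ T ⟧ * ∣ T ∣ !) + ∑ F top  ≡⟨ cong (_+ ∑ F top) (∑-*ʳ F (∣ T ∣ !) _) ⟩
            ∑ F (λ A → ⟦ A ≡ T ⟧) * ∣ T ∣ ! + ∑ F top  ≤⟨ +-mono-≤ (≤-trans (*-monoˡ-≤ (∣ T ∣ !) (unique∈ uF)) (≤-reflexive (*-identityˡ _)))
                                                                                         (∑-mono′ F (λ A → ∈⇒≤∑ (λ B → ⟦ A ⊊ B ⟧ * (∣ A ∣ ! * ((∣ B ∣ ∸ ∣ A ∣) ! * chains B T))) T∈)) ⟩
            ∣ T ∣ ! + pairs T  ∎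
            where
            open ℕₚ.≤-Reasoning
            top : Subset n → ℕ
            top A = ⟦ A ⊊ T ⟧ * (∣ A ∣ ! * ((∣ T ∣ ∸ ∣ A ∣) ! * chains T T))
            split : ∀ A → ∣ A ∣ ! * chains A T ≤ ⟦ A ≡ T ⟧ * ∣ T ∣ ! + top A
            split A with dec (A ≡ T)
            ... | yes refl = ≤-trans (≤-reflexive (trans (cong (∣ A ∣ ! *_) (chains-self A)) (trans (*-identityʳ (∣ A ∣ !)) (sym (+-identityʳ (∣ A ∣ !)))))) (m≤m+n (1 * ∣ A ∣ !) (top A))
            ... | no A≢T   = ≤-reflexive (trans (swap (∣ A ∣ !) ⟦ A ⊆ₛ T ⟧ ((∣ T ∣ ∸ ∣ A ∣) !))
                (cong₂ (λ x y → x * (∣ A ∣ ! * y)) (⟦⟧-cong (λ p → (λ {i} → p {i}) , A≢T) proj₁) (trans (sym (*-identityʳ ((∣ T ∣ ∸ ∣ A ∣) !))) (cong ((∣ T ∣ ∸ ∣ A ∣) ! *_) (sym (chains-self T))))))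
              where
              swap : ∀ a b c → a * (b * c) ≡ b * (a * c)
              swap = solve-∀

        -- A chain with x members has at least x - 1 pairs. In the induction on the top T: if T is a
        -- member, every other member of the chain forms a pair with it; if not, the chains are
        -- sorted by their last step.
        members≤ : ∀ m T → ∣ T ∣ ≡ m → members T ≤ m ! + pairs T
        members≤ m T eq with dec (T ∈ F)
        members≤ m       T refl | yes T∈ = member-case T T∈
        members≤ zero    T eq | no T∉ = ≤-trans (≤-reflexive (trans (∑-below T (λ A → ∣ A ∣ !) T∉) (empty (elements T) (trans (length-elements T) eq)))) z≤n
          where
          empty : ∀ {f : Fin n → ℕ} xs → length xs ≡ 0 → ∑ xs f ≡ 0
          empty [] _ = refl
        members≤ (suc m) T eq | no T∉ = begin
          members T  ≡⟨ ∑-below T (λ A → ∣ A ∣ !) T∉ ⟩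
          below T members  ≤⟨ ∑-mono (elements T) (λ i i∈ → members≤ m (delete T i) (ℕₚ.suc-injective (trans (∣delete∣ (proj₂ (∈-filt⁻ {xs = allFin n} i∈))) eq))) ⟩
          ∑ (elements T) (λ i → m ! + pairs (delete T i))  ≡⟨ ∑-+ (elements T) _ _ ⟩
          ∑ (elements T) (λ _ → m !) + below T pairs  ≡⟨ cong₂ _+_ (trans (∑-const (elements T) (m !)) (cong (_* m !) (trans (length-elements T) eq))) (sym (pairs-step T T∉)) ⟩
          suc m ! + pairs T  ∎
          where open ℕₚ.≤-Reasoning

  -- Large minimum degree by peeling, and embedding forests.

  ∑-remove : ∀ {X : Set} {xs : List X} {x} (f : X → ℕ) → Unique xs → x ∈ xs → ∑ xs f ≡ f x + ∑ (filt (_≢ x) xs) f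
  ∑-remove {xs = xs} {x} f u x∈ = ℕₚ.≤-antisym (∑-⊆ f u into) (∑-⊆ f (fresh ∷ filt-unique u) from)
    where
    import Data.List.Relation.Unary.All as All
    fresh : All (x ≢_) (filt (_≢ x) xs)
    fresh = All.tabulate (λ y∈ e → proj₂ (∈-filt⁻ {xs = xs} y∈) (sym e))
    into : ∀ {y} → y ∈ xs → y ∈ x ∷ filt (_≢ x) xs
    into {y} y∈ with dec (y ≡ x)
    ... | yes e = here e
    ... | no ne = there (∈-filt⁺ y∈ ne)
    from : ∀ {y} → y ∈ x ∷ filt (_≢ x) xs → y ∈ xs
    from (here refl) = x∈
    from (there p)   = proj₁ (∈-filt⁻ {xs = xs} p)

  length-remove : ∀ {X : Set} {xs : List X} {x} → Unique xs → x ∈ xs → length xs ≡ suc (length (filt (_≢ x) xs))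
  length-remove {xs = xs} {x} u x∈ = trans (sym (∑-1 xs)) (trans (∑-remove (λ _ → 1) u x∈) (cong suc (∑-1 (filt (_≢ x) xs))))

  -- Deleting a vertex of degree < d loses weight at most d/m times its cost.
  module Peel {X : Set} (R : X → X → Set) (wt : X → X → ℕ) (cost : X → ℕ) (d m : ℕ)
              (wtˡ : ∀ x y → m * wt x y ≤ ⟦ R x y ⟧ * cost x) (wtʳ : ∀ x y → m * wt x y ≤ ⟦ R x y ⟧ * cost y) where

    record Dense (As Bs : List X) : Set where
      field
        as bs    : List X
        as⊆      : ∀ {x} → x ∈ as → x ∈ As
        bs⊆      : ∀ {x} → x ∈ bs → x ∈ Bs
        uas      : Unique as
        ubs      : Unique bs
        nonempty : 0 < length as
        degˡ     : ∀ {x} → x ∈ as → d ≤ length (filt (R x) bs)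
        degʳ     : ∀ {y} → y ∈ bs → d ≤ length (filt (λ x → R x y) as)

    -- The weight bound that results when the deletions exhaust the left side.
    Light : List X → List X → Set
    Light As Bs = m * ∑ As (λ x → ∑ Bs (wt x)) ≤ d * (∑ As cost + ∑ Bs cost)

    private
      open ℕₚ.≤-Reasoning
      distr : ∀ m a b → m * (a + b) ≡ m * a + m * b
      distr = *-distribˡ-+
      low-degree : ∀ (P : X → Set) (w : X → ℕ) K → (∀ y → m * w y ≤ ⟦ P y ⟧ * K) → ∀ Ys → length (filt P Ys) ≤ d → m * ∑ Ys w ≤ d * K
      low-degree P w K h Ys le = begin
        m * ∑ Ys w  ≡⟨ ∑-* Ys m w ⟨
        ∑ Ys (λ y → m * w y)  ≤⟨ ∑-mono′ Ys h ⟩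
        ∑ Ys (λ y → ⟦ P y ⟧ * K)  ≡⟨ ∑-*ʳ Ys K _ ⟩
        ∑ Ys (λ y → ⟦ P y ⟧) * K  ≡⟨ cong (_* K) (length-filt P Ys) ⟨
        length (filt P Ys) * K  ≤⟨ *-monoˡ-≤ K le ⟩
        d * K  ∎

    peel : ∀ s As Bs → length As + length Bs ≤ s → Unique As → Unique Bs → Dense As Bs ⊎ Light As Bs
    peel s [] Bs le uA uB = inj₂ (≤-trans (≤-reflexive (*-zeroʳ m)) z≤n)
    peel zero (_ ∷ _) Bs () uA uB
    peel (suc s) As@(_ ∷ _) Bs le uA uB with dec (∃[ x ] x ∈ As × length (filt (R x) Bs) < d) | dec (∃[ y ] y ∈ Bs × length (filt (λ x → R x y) As) < d)
    ... | no ¬x | no ¬y = inj₁ record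
      { as = As ; bs = Bs ; as⊆ = id ; bs⊆ = id ; uas = uA ; ubs = uB ; nonempty = z<s
      ; degˡ = λ x∈ → ≮⇒≥ (λ lt → ¬x (_ , x∈ , lt)) ; degʳ = λ y∈ → ≮⇒≥ (λ lt → ¬y (_ , y∈ , lt)) }
    ... | yes (x , x∈ , lt) | _ with peel s (filt (_≢ x) As) Bs (≤-pred (subst (λ z → z + length Bs ≤ suc s) (length-remove uA x∈) le)) (filt-unique uA) uB
    ...   | inj₁ D = inj₁ record
      { as = D.as ; bs = D.bs ; as⊆ = λ p → proj₁ (∈-filt⁻ {xs = As} (D.as⊆ p)) ; bs⊆ = D.bs⊆ ; uas = D.uas ; ubs = D.ubs
      ; nonempty = D.nonempty ; degˡ = D.degˡ ; degʳ = D.degʳ }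
      where module D = Dense D
    ...   | inj₂ L = inj₂ (begin
      m * ∑ As (λ x → ∑ Bs (wt x))  ≡⟨ trans (cong (m *_) (∑-remove _ uA x∈)) (distr m _ (∑ As′ (λ x → ∑ Bs (wt x)))) ⟩
      m * ∑ Bs (wt x) + m * ∑ As′ (λ x → ∑ Bs (wt x))  ≤⟨ +-mono-≤ (low-degree (R x) (wt x) (cost x) (wtˡ x) Bs (<⇒≤ lt)) L ⟩
      d * cost x + d * (∑ As′ cost + ∑ Bs cost)  ≡⟨ trans (sym (distr d _ _)) (cong (d *_) (sym (ℕₚ.+-assoc (cost x) _ _))) ⟩
      d * (cost x + ∑ As′ cost + ∑ Bs cost)  ≡⟨ cong (λ z → d * (z + ∑ Bs cost)) (sym (∑-remove cost uA x∈)) ⟩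
      d * (∑ As cost + ∑ Bs cost)  ∎)
      where As′ = filt (_≢ x) As
    peel (suc s) As@(_ ∷ _) Bs le uA uB | no ¬x | yes (y , y∈ , lt)
      with peel s As (filt (_≢ y) Bs) (≤-pred (≤-trans (≤-reflexive (trans (sym (+-suc (length As) _)) (cong (length As +_) (sym (length-remove uB y∈))))) le)) uA (filt-unique uB)
    ...   | inj₁ D = inj₁ record
      { as = D.as ; bs = D.bs ; as⊆ = D.as⊆ ; bs⊆ = λ p → proj₁ (∈-filt⁻ {xs = Bs} (D.bs⊆ p)) ; uas = D.uas ; ubs = D.ubs
      ; nonempty = D.nonempty ; degˡ = D.degˡ ; degʳ = D.degʳ }
      where module D = Dense D
    ...   | inj₂ L = inj₂ (begin
      m * ∑ As (λ x → ∑ Bs (wt x))  ≡⟨ cong (m *_) (trans (∑-cong As (λ x → ∑-remove (wt x) uB y∈)) (∑-+ As (λ x → wt x y) (λ x → ∑ Bs′ (wt x)))) ⟩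
      m * (∑ As (λ x → wt x y) + ∑ As (λ x → ∑ Bs′ (wt x)))  ≡⟨ distr m _ _ ⟩
      m * ∑ As (λ x → wt x y) + m * ∑ As (λ x → ∑ Bs′ (wt x))  ≤⟨ +-mono-≤ (low-degree (λ x → R x y) (λ x → wt x y) (cost y) (λ x → wtʳ x y) As (<⇒≤ lt)) L ⟩
      d * cost y + d * (∑ As cost + ∑ Bs′ cost)  ≡⟨ collect d (cost y) (∑ As cost) (∑ Bs′ cost) ⟩
      d * (∑ As cost + (cost y + ∑ Bs′ cost))  ≡⟨ cong (λ z → d * (∑ As cost + z)) (sym (∑-remove cost uB y∈)) ⟩
      d * (∑ As cost + ∑ Bs cost)  ∎)
      where
      Bs′ = filt (_≢ y) Bs
      collect : ∀ d c a b → d * c + d * (a + b) ≡ d * (a + (c + b))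
      collect = solve-∀

  module Embed {N g : ℕ} (es : Edges N) (gd : Good g es) {X : Set} (R : X → X → Set) (as bs : List X)
               (uas : Unique as) (ubs : Unique bs) (a₀∈ : 0 < length as)
               (degˡ : ∀ {x} → x ∈ as → g ≤ length (filt (R x) bs)) (degʳ : ∀ {y} → y ∈ bs → g ≤ length (filt (λ x → R x y) as)) where

    -- The sides `as` and `bs` may overlap, being cut from the same family; so injectivity is
    -- demanded across vertices and edges.
    record Embedding (W : List (Node es)) : Set where
      field
        ψ         : Node es → X
        vertices  : ∀ {v} → inj₁ v ∈ W → ψ (inj₁ v) ∈ as
        edges     : ∀ {e} → inj₂ e ∈ W → ψ (inj₂ e) ∈ bs
        injective : ∀ {x y} → x ∈ W → y ∈ W → ψ x ≡ ψ y → x ≡ y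
        related   : ∀ {v e} → inj₁ v ∈ W → inj₂ e ∈ W → Endpoint (lookup es e) v → R (ψ (inj₁ v)) (ψ (inj₂ e))

    private
      first : ∀ {A : Set} (xs : List A) → 0 < length xs → ∃[ x ] x ∈ xs
      first (x ∷ _) _ = x , here refl

      fresh : ∀ {cs used : List X} → Unique cs → length used < length cs → ∃[ c ] c ∈ cs × c ∉ used
      fresh {cs} {used} u lt with dec (∃[ c ] c ∈ cs × c ∉ used)
      ... | yes p = p
      ... | no ¬p = contradiction (unique-⊆⇒length≤ u sub) (ℕₚ.<⇒≱ lt)
        where
        sub : ∀ {c} → c ∈ cs → c ∈ used
        sub {c} c∈ with dec (c ∈ used)
        ... | yes q = q
        ... | no ¬q = contradiction (c , c∈ , ¬q) ¬p

      a₀ = proj₁ (first as a₀∈)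

      as-large : g ≤ length as
      as-large with g ≟ 0 where open ℕₚ
      ... | yes refl = z≤n
      ... | no g≢0 = ≤-trans (degʳ (proj₁ (∈-filt⁻ {xs = bs} (proj₂ b)))) (Listₚ.length-filter (λ x → dec (R x (proj₁ b))) as)
        where
        b : ∃[ b ] b ∈ filt (R a₀) bs
        b = first _ (<-≤-trans (ℕₚ.n≢0⇒n>0 g≢0) (degˡ (proj₂ (first as a₀∈))))

      bs-large : g ≤ length bs
      bs-large = ≤-trans (degˡ (proj₂ (first as a₀∈))) (Listₚ.length-filter (λ y → dec (R a₀ y)) bs)

      Fits : Node es → X → Set
      Fits (inj₁ v) c = c ∈ as
      Fits (inj₂ e) c = c ∈ bs

      Suits : ∀ {w y} → Inc es w y → X → X → Set
      Suits (up _)   c z = R c z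
      Suits (down _) c z = R z c

    extend-leaf : ∀ {W w} (E : Embedding (filt (_≢ w) W)) → (c : X) → Fits w c → c ∉ map (Embedding.ψ E) (filt (_≢ w) W) →
                  (∀ {y} → y ∈ filt (_≢ w) W → (i : Inc es w y) → Suits i c (Embedding.ψ E y)) → Embedding W
    extend-leaf {W} {w} E c fits c∉ suits = record
      { ψ = ψ′ ; vertices = λ {v} → vertices′ {v} ; edges = λ {e} → edges′ {e} ; injective = injective′ ; related = λ {v} {e} → related′ {v} {e} }
      where
      module E = Embedding E
      ψ′ : Node es → X
      ψ′ x with dec (x ≡ w)
      ... | yes _ = c
      ... | no  _ = E.ψ x
      vertices′ : ∀ {v} → inj₁ v ∈ W → ψ′ (inj₁ v) ∈ as
      vertices′ {v} v∈ with dec (inj₁ v ≡ w)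
      ... | yes refl = fits
      ... | no ne    = E.vertices (∈-filt⁺ v∈ ne)
      edges′ : ∀ {e} → inj₂ e ∈ W → ψ′ (inj₂ e) ∈ bs
      edges′ {e} e∈ with dec (inj₂ e ≡ w)
      ... | yes refl = fits
      ... | no ne    = E.edges (∈-filt⁺ e∈ ne)
      injective′ : ∀ {x y} → x ∈ W → y ∈ W → ψ′ x ≡ ψ′ y → x ≡ y
      injective′ {x} {y} x∈ y∈ eq with dec (x ≡ w) | dec (y ≡ w)
      ... | yes p | yes q = trans p (sym q)
      ... | no ¬p | no ¬q = E.injective (∈-filt⁺ x∈ ¬p) (∈-filt⁺ y∈ ¬q) eq
      ... | yes _ | no ¬q = contradiction (subst (_∈ map E.ψ (filt (_≢ w) W)) (sym eq) (Memₚ.∈-map⁺ E.ψ (∈-filt⁺ y∈ ¬q))) c∉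
      ... | no ¬p | yes _ = contradiction (subst (_∈ map E.ψ (filt (_≢ w) W)) eq (Memₚ.∈-map⁺ E.ψ (∈-filt⁺ x∈ ¬p))) c∉
      related′ : ∀ {v e} → inj₁ v ∈ W → inj₂ e ∈ W → Endpoint (lookup es e) v → R (ψ′ (inj₁ v)) (ψ′ (inj₂ e))
      related′ {v} {e} v∈ e∈ p with dec (inj₁ v ≡ w) | dec (inj₂ e ≡ w)
      ... | no ne    | no ne′   = E.related (∈-filt⁺ v∈ ne) (∈-filt⁺ e∈ ne′) p
      ... | yes refl | no ne    = suits (∈-filt⁺ e∈ ne) (up p)
      ... | no ne    | yes refl = suits (∈-filt⁺ v∈ ne) (down p)

    -- A leaf is removed, the rest embedded, and the leaf put back: it must be related to the image
    -- of at most one node, which has at least g candidates, while only |W| - 1 < g sets are in use.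
    embed : ∀ k W → length W ≤ k → Unique W → length W ≤ g → Embedding W
    embed k [] _ _ _ = record { ψ = λ _ → a₀ ; vertices = λ () ; edges = λ () ; injective = λ () ; related = λ () }
    embed (suc k) W@(_ ∷ _) le u W≤g with Leaf.leaf g es gd W z<s W≤g
    ... | w , w∈ , isLeaf = place (dec (∃[ y ] y ∈ W′ × Inc es w y))
      where
      W′ = filt (_≢ w) W
      shorter : length W ≡ suc (length W′)
      shorter = length-remove u w∈
      E : Embedding W′
      E = embed k W′ (≤-pred (subst (_≤ suc k) shorter le)) (filt-unique u) (≤-trans (n≤1+n _) (subst (_≤ g) shorter W≤g))
      module E = Embedding E
      used = map E.ψ W′
      room : ∀ (cs : List X) → g ≤ length cs → length used < length cs
      room cs g≤ = <-≤-trans (≤-reflexive (trans (cong suc (Listₚ.length-map E.ψ W′)) (sym shorter))) (≤-trans W≤g g≤)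
      ∈W : ∀ {y} → y ∈ W′ → y ∈ W
      ∈W y∈ = proj₁ (∈-filt⁻ {xs = W} y∈)
      place : Dec (∃[ y ] y ∈ W′ × Inc es w y) → Embedding W
      place (no none) with side w
        where
        side : ∀ w → ∃[ cs ] Unique cs × g ≤ length cs × (∀ {c} → c ∈ cs → Fits w c)
        side (inj₁ _) = as , uas , as-large , id
        side (inj₂ _) = bs , ubs , bs-large , id
      ... | cs , ucs , g≤ , fit with fresh {cs} {used} ucs (room cs g≤)
      ...   | c , c∈ , c∉ = extend-leaf E c (fit c∈) c∉ (λ y∈ i → contradiction (_ , y∈ , i) none)
      place (yes (y , y∈ , up {v} {e} p)) with fresh {filt (λ x → R x (E.ψ y)) as} {used} (filt-unique uas) (room (filt (λ x → R x (E.ψ y)) as) (degʳ (E.edges y∈)))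
      ... | c , c∈ , c∉ = extend-leaf E c (proj₁ (∈-filt⁻ {xs = as} c∈)) c∉ suits
        where
        suits : ∀ {z} → z ∈ W′ → (i : Inc es w z) → Suits i c (E.ψ z)
        suits z∈ i@(up _) = subst (λ z → R c (E.ψ z)) (isLeaf (∈W y∈) (∈W z∈) (up p) i) (proj₂ (∈-filt⁻ {xs = as} c∈))
      place (yes (y , y∈ , down {v} {e} p)) with fresh {filt (R (E.ψ y)) bs} {used} (filt-unique ubs) (room (filt (R (E.ψ y)) bs) (degˡ (E.vertices y∈)))
      ... | c , c∈ , c∉ = extend-leaf E c (proj₁ (∈-filt⁻ {xs = bs} c∈)) c∉ suits
        where
        suits : ∀ {z} → z ∈ W′ → (i : Inc es w z) → Suits i c (E.ψ z)
        suits z∈ i@(down _) = subst (λ z → R (E.ψ z) c) (isLeaf (∈W y∈) (∈W z∈) (down p) i) (proj₂ (∈-filt⁻ {xs = bs} c∈))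

  -- Supersaturation above the middle binomial coefficient.

  binomial-increasing : ∀ n j i → 2 * (j + i) ≤ n → n C j ≤ n C (j + i)
  binomial-increasing n j zero    le = ≤-reflexive (cong (n C_) (sym (+-identityʳ j)))
  binomial-increasing n j (suc i) le = ≤-trans (binomial-increasing n j i (≤-trans (*-monoʳ-≤ 2 (+-monoʳ-≤ j (n≤1+n i))) le))
    (subst (n C k ≤_) (cong (n C_) (sym (+-suc j i))) step′)
    where
    k = j + i
    2k+2≤n : 2 * suc k ≤ n
    2k+2≤n = subst (λ z → 2 * z ≤ n) (+-suc j i) le
    b = n ∸ suc k
    n≡ : k + suc b ≡ n
    n≡ = trans (+-suc k b) (m+[n∸m]≡n (≤-trans (m≤n*m (suc k) 2) 2k+2≤n))
    k≤b : suc k ≤ suc b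
    k≤b = +-cancelˡ-≤ k _ _ (≤-trans (+-monoˡ-≤ (suc k) (n≤1+n k))
            (≤-trans (≤-reflexive (cong (suc k +_) (sym (+-identityʳ (suc k))))) (≤-trans 2k+2≤n (≤-reflexive (sym n≡)))))
    step′ : n C k ≤ n C suc k
    step′ = subst (λ z → z C k ≤ z C suc k) n≡ (*-cancelʳ-≤ _ _ (suc k)
      (≤-trans (*-monoʳ-≤ ((k + suc b) C k) k≤b) (≤-reflexive (sym (binomial-step k b)))))

  binomial≤middle-lower : ∀ n j → j ≤ ⌊ n /2⌋ → n C j ≤ n C ⌊ n /2⌋
  binomial≤middle-lower n j j≤h = subst (λ z → n C j ≤ n C z) h≡ (binomial-increasing n j (⌊ n /2⌋ ∸ j)
    (subst (λ z → 2 * z ≤ n) (sym h≡) (≤-trans (≤-reflexive (cong (⌊ n /2⌋ +_) (+-identityʳ _)))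
      (≤-trans (+-monoʳ-≤ ⌊ n /2⌋ (ℕₚ.⌊n/2⌋≤⌈n/2⌉ n)) (≤-reflexive (ℕₚ.⌊n/2⌋+⌈n/2⌉≡n n))))))
    where
    h≡ : j + (⌊ n /2⌋ ∸ j) ≡ ⌊ n /2⌋
    h≡ = m+[n∸m]≡n j≤h

  binomial≤middle : ∀ n j → n C j ≤ n C ⌊ n /2⌋
  binomial≤middle n j with ℕₚ.≤-total j ⌊ n /2⌋
  ... | inj₁ j≤h = binomial≤middle-lower n j j≤h
  ... | inj₂ h≤j with j ≤? n | j ≟ ⌊ n /2⌋ where open ℕₚ
  ...   | no j≰n  | _        = ≤-trans (≤-reflexive (k>n⇒nCk≡0 (≰⇒> j≰n))) z≤n
  ...   | yes _   | yes refl = ≤-refl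
  ...   | yes j≤n | no j≢    = subst (_≤ n C ⌊ n /2⌋) (sym (nCk≡nC[n∸k] j≤n)) (binomial≤middle-lower n (n ∸ j)
    (ℕₚ.m≤n+o⇒m∸n≤o n j (≤-trans (≤-reflexive (trans (sym (ℕₚ.⌊n/2⌋+⌈n/2⌉≡n n)) (+-comm ⌊ n /2⌋ _)))
      (+-monoˡ-≤ ⌊ n /2⌋ (≤-trans (⌈/2⌉≤ n) (ℕₚ.≤∧≢⇒< h≤j (j≢ ∘ sym)))))))
    where
    ⌈/2⌉≤ : ∀ n → ⌈ n /2⌉ ≤ suc ⌊ n /2⌋
    ⌈/2⌉≤ zero          = z≤n
    ⌈/2⌉≤ (suc zero)    = s≤s z≤n
    ⌈/2⌉≤ (suc (suc n)) = s≤s (⌈/2⌉≤ n)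

  -- In terms of binomial coefficients: x + y over x is at least m.
  !-bound : ∀ x y m → 0 < x → m ≤ y → m * (x ! * y !) ≤ (x + y) !
  !-bound (suc zero) y m _ m≤y = ≤-trans (≤-reflexive (cong (m *_) (+-identityʳ (y !)))) (*-monoˡ-≤ (y !) (ℕₚ.m≤n⇒m≤1+n m≤y))
  !-bound (suc (suc x)) y m _ m≤y = begin
    m * (suc (suc x) * suc x ! * y !)  ≡⟨ swap m (suc (suc x)) (suc x !) (y !) ⟩
    suc (suc x) * (m * (suc x ! * y !))  ≤⟨ *-mono-≤ (s≤s (s≤s (m≤m+n x y))) (!-bound (suc x) y m z<s m≤y) ⟩
    suc (suc x + y) * (suc x + y) !  ∎
    where
    open ℕₚ.≤-Reasoning
    swap : ∀ m s a b → m * (s * a * b) ≡ s * (m * (a * b))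
    swap = solve-∀

  Realisation : ∀ {N n} (es : Edges N) → List (Node es) → List (Subset n) → Set
  Realisation {n = n} es W xs = Σ[ ψ ∈ (Node es → Subset n) ]
      (∀ {x} → x ∈ W → ψ x ∈ xs)
    × (∀ {x y} → x ∈ W → y ∈ W → ψ x ≡ ψ y → x ≡ y)
    × (∀ {x y} → x ∈ W → y ∈ W → Up es x y → ψ x ⊆ₛ ψ y)

  -- The family will have at least (1 + 1/b) X sets. Half of the excess pays for discarding the sets
  -- of extreme size, which `n-large` makes few; the other half yields comparable pairs, which
  -- `m-large` makes too heavy to be peeled away.
  module Supersaturated (g b : ℕ) (0<b : 0 < b) (m : ℕ) (m-large : 2 * g * (2 * b + 1) < m) (n : ℕ) (n-large : (4 * b * m + 2) * m ≤ n) where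

    X : ℕ
    X = n C ⌊ n /2⌋

    private
      R : ℕ
      R = 4 * b * m

    -- Distance m from both ends of the cube ensures, by `!-bound`, that at most 1/m of the chains
    -- through one set pass through another given one.
    Mid : Subset n → Set
    Mid Y = m ≤ ∣ Y ∣ × ∣ Y ∣ + m ≤ n

    _⋖_ : Subset n → Subset n → Set
    A ⋖ B = A ⊊ B × Mid A × Mid B

    private
      open ℕₚ.≤-Reasoning

      Rm≤ : ∀ j → j < m → R * suc j + j ≤ n
      Rm≤ j j<m = begin
        R * suc j + j  ≤⟨ +-mono-≤ (*-monoʳ-≤ R j<m) (<⇒≤ j<m) ⟩
        R * m + m  ≤⟨ m≤m+n _ m ⟩
        R * m + m + m  ≡⟨ collect R m ⟩
        (R + 2) * m  ≤⟨ n-large ⟩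
        n  ∎
        where
        collect : ∀ R m → R * m + m + m ≡ (R + 2) * m
        collect = solve-∀

      0<R : 0 < R
      0<R = *-mono-< {0} {4 * b} {0} (*-mono-< {0} {4} {0} z<s 0<b) (≤-<-trans z≤n m-large)

      j<n : ∀ j → j < m → suc j ≤ n
      j<n j j<m = ≤-trans (m≤n*m (suc j) R {{>-nonZero 0<R}}) (≤-trans (m≤m+n _ j) (Rm≤ j j<m))

      -- Near the bottom, consecutive binomial coefficients grow by the factor (n - j) / (j + 1) ≥ 4
      -- b m; summed over m layers this leaves X / (4b).
      small-layer : ∀ j → j < m → R * (n C j) ≤ X
      small-layer j j<m = ≤-trans (*-cancelʳ-≤ _ _ (suc j) (begin
        R * (n C j) * suc j  ≡⟨ swap R (n C j) (suc j) ⟩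
        (n C j) * (R * suc j)  ≤⟨ *-monoʳ-≤ (n C j) R≤ ⟩
        (n C j) * suc c  ≡⟨ cong (λ z → (z C j) * suc c) n≡ ⟨
        ((j + suc c) C j) * suc c  ≡⟨ binomial-step j c ⟨
        ((j + suc c) C suc j) * suc j  ≡⟨ cong (λ z → (z C suc j) * suc j) n≡ ⟩
        (n C suc j) * suc j  ∎)) (binomial≤middle n (suc j))
        where
        swap : ∀ a b c → a * b * c ≡ b * (a * c)
        swap = solve-∀
        c = n ∸ suc j
        n≡ : j + suc c ≡ n
        n≡ = trans (+-suc j c) (m+[n∸m]≡n (j<n j j<m))
        R≤ : R * suc j ≤ suc c
        R≤ = +-cancelʳ-≤ j _ _ (≤-trans (Rm≤ j j<m) (≤-reflexive (trans (sym n≡) (+-comm j _))))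

      E : ℕ
      E = ∑ (upTo m) (λ j → n C j)

      E≤ : 4 * b * E ≤ X
      E≤ = *-cancelʳ-≤ _ _ m {{>-nonZero (≤-<-trans z≤n m-large)}} (begin
        4 * b * E * m  ≡⟨ swap (4 * b) E m ⟩
        R * E  ≡⟨ ∑-* (upTo m) R _ ⟨
        ∑ (upTo m) (λ j → R * (n C j))  ≤⟨ ∑-mono (upTo m) (λ j j∈ → small-layer j (Memₚ.∈-upTo⁻ j∈)) ⟩
        ∑ (upTo m) (λ _ → X)  ≡⟨ trans (∑-const (upTo m) X) (trans (cong (_* X) (Listₚ.length-upTo m)) (*-comm m X)) ⟩
        X * m  ∎)
        where
        swap : ∀ a e m → a * e * m ≡ a * m * e
        swap = solve-∀

      ∑-layers : ∀ (h : ℕ → ℕ) → ∑ (subsets n) (λ Y → ∑ (upTo m) (λ j → ⟦ ∣ Y ∣ ≡ h j ⟧)) ≡ ∑ (upTo m) (λ j → n C h j)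
      ∑-layers h = trans (∑-swap (subsets n) (upTo m) _) (∑-cong (upTo m) (λ j → trans (sym (length-filt (λ Y → ∣ Y ∣ ≡ h j) (subsets n))) (length-layer n (h j))))

      few-extreme : ∑ (subsets n) (λ Y → ⟦ ¬ Mid Y ⟧) ≤ 2 * E
      few-extreme = begin
        ∑ (subsets n) (λ Y → ⟦ ¬ Mid Y ⟧)  ≤⟨ ∑-mono′ (subsets n) extreme ⟩
        ∑ (subsets n) (λ Y → ∑ (upTo m) (λ j → ⟦ ∣ Y ∣ ≡ j ⟧) + ∑ (upTo m) (λ j → ⟦ ∣ Y ∣ ≡ n ∸ j ⟧))
          ≡⟨ trans (∑-+ (subsets n) _ _) (cong₂ _+_ (∑-layers id) (∑-layers (n ∸_))) ⟩
        E + ∑ (upTo m) (λ j → n C (n ∸ j))  ≤⟨ +-monoʳ-≤ E (∑-mono (upTo m) (λ j j∈ → ≤-reflexive (sym (nCk≡nC[n∸k] (<⇒≤ (j<n j (Memₚ.∈-upTo⁻ j∈))))))) ⟩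
        E + E  ≡⟨ cong (E +_) (+-identityʳ E) ⟨
        2 * E  ∎
        where
        extreme : ∀ Y → ⟦ ¬ Mid Y ⟧ ≤ ∑ (upTo m) (λ j → ⟦ ∣ Y ∣ ≡ j ⟧) + ∑ (upTo m) (λ j → ⟦ ∣ Y ∣ ≡ n ∸ j ⟧)
        extreme Y = ⟦⟧-≤ λ ¬mid → case m ≤? ∣ Y ∣ of λ
          { (no m≰) → ≤-trans (≤-trans (≤-reflexive (sym (⟦⟧-true refl))) (∈⇒≤∑ (λ j → ⟦ ∣ Y ∣ ≡ j ⟧) (Memₚ.∈-upTo⁺ (≰⇒> m≰)))) (m≤m+n _ _)
          ; (yes m≤) → case ∣ Y ∣ + m ≤? n of λ
              { (yes ≤n) → contradiction (m≤ , ≤n) ¬mid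
              ; (no ≰n)  → ≤-trans (≤-trans (≤-reflexive (sym (⟦⟧-true (sym (ℕₚ.m∸[m∸n]≡n (Subₚ.∣p∣≤n Y))))))
                  (∈⇒≤∑ (λ j → ⟦ ∣ Y ∣ ≡ n ∸ j ⟧) (Memₚ.∈-upTo⁺ (ℕₚ.+-cancelˡ-< ∣ Y ∣ _ _ (subst (_< ∣ Y ∣ + m) (sym (m+[n∸m]≡n (Subₚ.∣p∣≤n Y))) (≰⇒> ≰n)))))) (m≤n+m _ _) } }
          where open ℕₚ

      top : Subset n
      top = Data.Fin.Subset.⊤
        where import Data.Fin.Subset

      -- The number of maximal chains of the cube through A; `wt` counts those through both sets of
      -- a comparable pair.
      cost : Subset n → ℕ
      cost A = ∣ A ∣ ! * chains A top

      wt : Subset n → Subset n → ℕ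
      wt A B = ⟦ A ⋖ B ⟧ * (∣ A ∣ ! * ((∣ B ∣ ∸ ∣ A ∣) ! * chains B top))

      chains-top : ∀ A → chains A top ≡ (n ∸ ∣ A ∣) !
      chains-top A = trans (cong₂ (λ x y → x * (y ∸ ∣ A ∣) !) (⟦⟧-true (λ p → Subₚ.⊆⊤ {p = A} p)) (Subₚ.∣⊤∣≡n n)) (*-identityˡ _)

      bracket : ∀ (P : Set) x y → (P → m * x ≤ y) → m * (⟦ P ⟧ * x) ≤ ⟦ P ⟧ * y
      bracket P x y h with dec P
      ... | yes p = ≤-trans (≤-reflexive (cong (m *_) (*-identityˡ x))) (≤-trans (h p) (≤-reflexive (sym (*-identityˡ y))))
      ... | no _  = ≤-reflexive (*-zeroʳ m)

      wtˡ : ∀ A B → m * wt A B ≤ ⟦ A ⋖ B ⟧ * cost A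
      wtˡ A B = bracket (A ⋖ B) _ _ λ { (A⊊B , _ , _ , B≤) →
        let a≤b = <⇒≤ (⊊⇒< A⊊B) ; b≤n = Subₚ.∣p∣≤n B in begin
        m * (∣ A ∣ ! * ((∣ B ∣ ∸ ∣ A ∣) ! * chains B top))  ≡⟨ cong (λ z → m * (∣ A ∣ ! * ((∣ B ∣ ∸ ∣ A ∣) ! * z))) (chains-top B) ⟩
        m * (∣ A ∣ ! * ((∣ B ∣ ∸ ∣ A ∣) ! * (n ∸ ∣ B ∣) !))  ≡⟨ swap m (∣ A ∣ !) _ ⟩
        ∣ A ∣ ! * (m * ((∣ B ∣ ∸ ∣ A ∣) ! * (n ∸ ∣ B ∣) !))  ≤⟨ *-monoʳ-≤ (∣ A ∣ !) (!-bound (∣ B ∣ ∸ ∣ A ∣) (n ∸ ∣ B ∣) m (ℕₚ.m<n⇒0<n∸m (⊊⇒< A⊊B))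
                                                                  (+-cancelˡ-≤ ∣ B ∣ _ _ (≤-trans B≤ (≤-reflexive (sym (m+[n∸m]≡n b≤n)))))) ⟩
        ∣ A ∣ ! * (∣ B ∣ ∸ ∣ A ∣ + (n ∸ ∣ B ∣)) !  ≡⟨ cong (λ z → ∣ A ∣ ! * z !) (trans (+-comm (∣ B ∣ ∸ ∣ A ∣) _) (trans (sym (ℕₚ.+-∸-assoc (n ∸ ∣ B ∣) a≤b)) (cong (_∸ ∣ A ∣) (ℕₚ.m∸n+n≡m b≤n)))) ⟩
        ∣ A ∣ ! * (n ∸ ∣ A ∣) !  ≡⟨ cong (∣ A ∣ ! *_) (chains-top A) ⟨
        cost A  ∎ }
        where
        swap : ∀ a b c → a * (b * c) ≡ b * (a * c)
        swap = solve-∀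

      wtʳ : ∀ A B → m * wt A B ≤ ⟦ A ⋖ B ⟧ * cost B
      wtʳ A B = bracket (A ⋖ B) _ _ λ { (A⊊B , (m≤ , _) , _) → begin
        m * (∣ A ∣ ! * ((∣ B ∣ ∸ ∣ A ∣) ! * chains B top))  ≡⟨ shuffle m (∣ A ∣ !) ((∣ B ∣ ∸ ∣ A ∣) !) (chains B top) ⟩
        m * ((∣ B ∣ ∸ ∣ A ∣) ! * ∣ A ∣ !) * chains B top  ≤⟨ *-monoˡ-≤ (chains B top) (!-bound (∣ B ∣ ∸ ∣ A ∣) ∣ A ∣ m (ℕₚ.m<n⇒0<n∸m (⊊⇒< A⊊B)) m≤) ⟩
        (∣ B ∣ ∸ ∣ A ∣ + ∣ A ∣) ! * chains B top  ≡⟨ cong (λ z → z ! * chains B top) (ℕₚ.m∸n+n≡m (<⇒≤ (⊊⇒< A⊊B))) ⟩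
        cost B  ∎ }
        where
        shuffle : ∀ m a x c → m * (a * (x * c)) ≡ m * (x * a) * c
        shuffle = solve-∀

      module Pl = Peel _⋖_ wt cost g m wtˡ wtʳ

    module _ (xs : List (Subset n)) (uxs : Unique xs) (large : suc b * X ≤ b * length xs) where

      private
        F : List (Subset n)
        F = filt Mid xs

        ∈F⇒Mid : ∀ {A} → A ∈ F → Mid A
        ∈F⇒Mid p = proj₂ (∈-filt⁻ {xs = xs} p)

        Λ = ∑ F cost

        xs≤ : length xs ≤ length F + 2 * E
        xs≤ = begin
          length xs  ≡⟨ ∑-⟦⟧+⟦¬⟧ xs Mid ⟨
          ∑ xs (λ Y → ⟦ Mid Y ⟧) + ∑ xs (λ Y → ⟦ ¬ Mid Y ⟧)  ≤⟨ +-mono-≤ (≤-reflexive (sym (length-filt Mid xs))) (≤-trans (∑-⊆ _ uxs (λ {Y} _ → ∈-subsets Y)) few-extreme) ⟩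
          length F + 2 * E  ∎

        F-large : (2 * b + 1) * X ≤ 2 * b * length F
        F-large = +-cancelʳ-≤ X _ _ (begin
          (2 * b + 1) * X + X  ≡⟨ expand b X ⟩
          2 * (suc b * X)  ≤⟨ *-monoʳ-≤ 2 large ⟩
          2 * (b * length xs)  ≤⟨ *-monoʳ-≤ 2 (*-monoʳ-≤ b xs≤) ⟩
          2 * (b * (length F + 2 * E))  ≡⟨ expand′ b (length F) E ⟩
          2 * b * length F + 4 * b * E  ≤⟨ +-monoʳ-≤ _ E≤ ⟩
          2 * b * length F + X  ∎)
          where
          expand : ∀ b X → (2 * b + 1) * X + X ≡ 2 * (suc b * X)
          expand = solve-∀
          expand′ : ∀ b f e → 2 * (b * (f + 2 * e)) ≡ 2 * b * f + 4 * b * e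
          expand′ = solve-∀

        -- `cost A` is n! divided by the binomial coefficient of the level of A, which is at most X.
        lubell : length F * n ! ≤ X * Λ
        lubell = begin
          length F * n !  ≡⟨ ∑-const F (n !) ⟨
          ∑ F (λ _ → n !)  ≤⟨ ∑-mono′ F each ⟩
          ∑ F (λ A → X * cost A)  ≡⟨ ∑-* F X _ ⟩
          X * Λ  ∎
          where
          each : ∀ A → n ! ≤ X * cost A
          each A = begin
            n !  ≡⟨ cong _! n≡ ⟨
            (∣ A ∣ + (n ∸ ∣ A ∣)) !  ≡⟨ binomial-! ∣ A ∣ (n ∸ ∣ A ∣) ⟨
            ((∣ A ∣ + (n ∸ ∣ A ∣)) C ∣ A ∣) * (∣ A ∣ ! * (n ∸ ∣ A ∣) !)  ≡⟨ cong₂ (λ z y → (z C ∣ A ∣) * (∣ A ∣ ! * y)) n≡ (sym (chains-top A)) ⟩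
            (n C ∣ A ∣) * cost A  ≤⟨ *-monoˡ-≤ (cost A) (binomial≤middle n ∣ A ∣) ⟩
            X * cost A  ∎
            where
            n≡ : ∣ A ∣ + (n ∸ ∣ A ∣) ≡ n
            n≡ = m+[n∸m]≡n (Subₚ.∣p∣≤n A)

        0<X : 0 < X
        0<X = >-nonZero⁻¹ X {{nCk-nonZero (ℕₚ.⌊n/2⌋≤n n)}}

        Λ-large : (2 * b + 1) * n ! ≤ 2 * b * Λ
        Λ-large = *-cancelˡ-≤ X {{>-nonZero 0<X}} (begin
          X * ((2 * b + 1) * n !)  ≡⟨ swap X (2 * b + 1) (n !) ⟩
          (2 * b + 1) * X * n !  ≤⟨ *-monoˡ-≤ (n !) F-large ⟩
          2 * b * length F * n !  ≡⟨ *-assoc (2 * b) (length F) (n !) ⟩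
          2 * b * (length F * n !)  ≤⟨ *-monoʳ-≤ (2 * b) lubell ⟩
          2 * b * (X * Λ)  ≡⟨ swap′ (2 * b) X Λ ⟩
          X * (2 * b * Λ)  ∎)
          where
          swap : ∀ x c f → x * (c * f) ≡ c * x * f
          swap = solve-∀
          swap′ : ∀ c x l → c * (x * l) ≡ x * (c * l)
          swap′ = solve-∀

        Λ≤ : Λ ≤ n ! + ∑ F (λ A → ∑ F (wt A))
        Λ≤ = ≤-trans (Chains.members≤ F (filt-unique uxs) n top (Subₚ.∣⊤∣≡n n))
          (+-monoʳ-≤ (n !) (∑-mono F (λ A A∈ → ∑-mono F (λ B B∈ →
            *-monoˡ-≤ (∣ A ∣ ! * ((∣ B ∣ ∸ ∣ A ∣) ! * chains B top)) (⟦⟧-mono (λ (p : A ⊊ B) → p , ∈F⇒Mid A∈ , ∈F⇒Mid B∈))))))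

        -- With S the total weight of the pairs, Λ ≤ n! + S and n! ≤ 2b / (2b + 1) Λ give S ≥ Λ /
        -- (2b + 1). Lightness would give S ≤ 2 g Λ / m, which is smaller by the choice of m.
        not-light : ¬ Pl.Light F F
        not-light light = <-irrefl refl (begin-strict
          2 * g * (2 * b + 1) * Λ  <⟨ ℕₚ.*-monoˡ-< Λ {{>-nonZero 0<Λ}} m-large ⟩
          m * Λ  ≤⟨ +-cancelʳ-≤ (m * (2 * b * Λ)) _ _ (begin
            m * Λ + m * (2 * b * Λ)  ≡⟨ e₁ m Λ b ⟩
            (2 * b + 1) * (m * Λ)  ≤⟨ *-monoʳ-≤ (2 * b + 1) (*-monoʳ-≤ m Λ≤) ⟩
            (2 * b + 1) * (m * (n ! + S))  ≡⟨ e₂ b m (n !) S ⟩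
            m * ((2 * b + 1) * n !) + (2 * b + 1) * (m * S) ≤⟨ +-mono-≤ (*-monoʳ-≤ m Λ-large) (*-monoʳ-≤ (2 * b + 1) light) ⟩
            m * (2 * b * Λ) + (2 * b + 1) * (g * (Λ + Λ)) ≡⟨ e₃ (m * (2 * b * Λ)) b g Λ ⟩
            2 * g * (2 * b + 1) * Λ + m * (2 * b * Λ)  ∎) ⟩
          2 * g * (2 * b + 1) * Λ  ∎)
          where
          S = ∑ F (λ A → ∑ F (wt A))
          e₁ : ∀ m l b → m * l + m * (2 * b * l) ≡ (2 * b + 1) * (m * l)
          e₁ = solve-∀
          e₂ : ∀ b m f s → (2 * b + 1) * (m * (f + s)) ≡ m * ((2 * b + 1) * f) + (2 * b + 1) * (m * s)
          e₂ = solve-∀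
          e₃ : ∀ z b g l → z + (2 * b + 1) * (g * (l + l)) ≡ 2 * g * (2 * b + 1) * l + z
          e₃ = solve-∀
          0<Λ : 0 < Λ
          0<Λ = ℕₚ.n≢0⇒n>0 λ Λ≡0 → contradiction (≤-trans (*-mono-≤ (m≤n+m 1 (2 * b)) (ℕₚ.1≤n! n))
            (≤-trans Λ-large (≤-reflexive (trans (cong (2 * b *_) Λ≡0) (*-zeroʳ (2 * b)))))) λ ()

      dense : Peel.Dense _⋖_ wt cost g m wtˡ wtʳ F F
      dense = [ id , (λ L → contradiction L not-light) ]′ (Pl.peel (length F + length F) F F ≤-refl (filt-unique uxs) (filt-unique uxs))

      abstract
        dense-embedding : ∀ {N} {es : Edges N} → Good g es → (W : List (Node es)) → Unique W → length W ≤ g →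
                          Realisation es W xs
        dense-embedding {es = es} gd W uW W≤g = M.ψ , (λ {x} → member {x}) , M.injective , λ { p q (up e) → proj₁ (proj₁ (M.related p q e)) }
          where
          module D = Peel.Dense dense
          module M = Embed.Embedding (Embed.embed es gd _⋖_ D.as D.bs D.uas D.ubs D.nonempty D.degˡ D.degʳ (length W) W ≤-refl uW W≤g)
          member : ∀ {x} → x ∈ W → M.ψ x ∈ xs
          member {inj₁ v} p = proj₁ (∈-filt⁻ {xs = xs} (D.as⊆ (M.vertices p)))
          member {inj₂ e} p = proj₁ (∈-filt⁻ {xs = xs} (D.bs⊆ (M.edges p)))

  -- Small subposets of incidence posets have π⁻ at most 1.

  module _ {N g : ℕ} (es : Edges N) (gd : Good g es) (Q : FinPoset) (Q⊆ : Q WeaklyContainedIn incidencePoset es)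
           (small : FinPoset.size Q ≤ g) where

    forest-not-free : ∀ {b} → 0 < b → ∀ {m} → 2 * g * (2 * b + 1) < m → ∀ {n} → (4 * b * m + 2) * m ≤ n →
                      ∀ (𝓕 : Family n) {s} → HasSize 𝓕 s → suc b * (n C ⌊ n /2⌋) ≤ b * s → ¬ (Q IsFree 𝓕)
    forest-not-free {b} 0<b {m} m-large {n} n-large 𝓕 (xs , uxs , refl , 𝓕⇔) large free =
      free⇒no-embedding {P = Q} {𝓕 = 𝓕} free χ χ∈ χ-injective χ-mono
      where
      φ : Fin (FinPoset.size Q) → Fin (N + length es)
      φ = proj₁ Q⊆
      module S = Supersaturated g b 0<b m m-large n n-large
      nodeQ : Fin (FinPoset.size Q) → Node es
      nodeQ p = node es (φ p)
      nodeQ-injective : ∀ {p p′} → nodeQ p ≡ nodeQ p′ → p ≡ p′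
      nodeQ-injective eq = proj₁ (proj₂ Q⊆) (node-injective es eq)
      W : List (Node es)
      W = map nodeQ (allFin (FinPoset.size Q))
      emb : Realisation es W xs
      emb = S.dense-embedding xs uxs large gd W (Uniqₚ.map⁺ nodeQ-injective (Uniqₚ.allFin⁺ _))
              (≤-trans (≤-reflexive (trans (Listₚ.length-map nodeQ (allFin (FinPoset.size Q))) (length-allFin _))) small)
      ∈W : ∀ p → nodeQ p ∈ W
      ∈W p = Memₚ.∈-map⁺ nodeQ (Memₚ.∈-allFin p)
      ψ = proj₁ emb
      χ : Fin (FinPoset.size Q) → Subset n
      χ p = ψ (nodeQ p)
      χ∈ : ∀ p → 𝓕 (χ p)
      χ∈ p = Equivalence.from (𝓕⇔ (χ p)) (proj₁ (proj₂ emb) (∈W p))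
      χ-injective : Injective _≡_ _≡_ χ
      χ-injective {p} {p′} eq = nodeQ-injective (proj₁ (proj₂ (proj₂ emb)) (∈W p) (∈W p′) eq)
      χ-mono : ∀ {p p′} → FinPoset._≼_ Q p p′ → χ p ⊆ₛ χ p′
      χ-mono {p} {p′} p≼ = from-≼ (IsOrderHomomorphism.mono (proj₂ (proj₂ Q⊆)) p≼)
        where
        from-≼ : _≼ᵢ_ es (φ p) (φ p′) → χ p ⊆ₛ χ p′
        from-≼ (inj₁ eq) = Subₚ.⊆-reflexive (cong (λ z → ψ (node es z)) eq)
        from-≼ (inj₂ u)  = proj₂ (proj₂ (proj₂ emb)) (∈W p) (∈W p′) u

    -- A rational c > 1 below a tail makes the extremal families exceed (1 + 1/b) times the middle
    -- binomial coefficient for all large n, where they cannot be free.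
    forest-π⁻≤1 : ¬ (ℚ.1ℚ <π⁻[ Q ])
    forest-π⁻≤1 (a , La , c , 1<c , N₀ , tail) = contra (above-1 1<c)
      where
      at : ∀ b → 0 < b → (∀ m d .{{_ : NonZero d}} → c ℚ.≤ (ℤ.+ m) ℚ./ d → suc b * d ≤ b * m) →
           ∀ m → 2 * g * (2 * b + 1) < m → ∀ n → (4 * b * m + 2) * m ≤ n → N₀ ≤ n → ⊥
      at b 0<b above m m-large n n-large N₀≤n = let ((𝓕 , size , free) , _) = La n in
        forest-not-free 0<b m-large n-large 𝓕 size (above (a n) (n C ⌊ n /2⌋) {{nCk-nonZero (ℕₚ.⌊n/2⌋≤n n)}} (tail n N₀≤n)) free
      contra : (∃[ b ] 0 < b × (∀ m d .{{_ : NonZero d}} → c ℚ.≤ (ℤ.+ m) ℚ./ d → suc b * d ≤ b * m)) → ⊥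
      contra (b , 0<b , above) = at b 0<b above m ≤-refl (N₀ + (4 * b * m + 2) * m) (m≤n+m _ N₀) (m≤m+n N₀ _)
        where m = suc (2 * g * (2 * b + 1))

  -- Minimal posets below a given one, and infinitely many of them.

  open FinPoset using (size)

  WeaklyContainedIn-trans : ∀ {P Q R} → P WeaklyContainedIn Q → Q WeaklyContainedIn R → P WeaklyContainedIn R
  WeaklyContainedIn-trans (φ , φ-inj , φ-hom) (χ , χ-inj , χ-hom) =
    (χ ∘ φ) , (λ eq → φ-inj (χ-inj eq)) ,
    record { cong = λ { refl → refl } ; mono = λ p → IsOrderHomomorphism.mono χ-hom (IsOrderHomomorphism.mono φ-hom p) }

  WeaklyContainedIn-refl : ∀ {P} → P WeaklyContainedIn P
  WeaklyContainedIn-refl = id , id , record { cong = id ; mono = id }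

  -- A weak subposet may keep all points and lose only relations, so descent needs this count
  -- besides the size.
  relations : FinPoset → ℕ
  relations P = ∑ (allFin (size P)) (λ x → ∑ (allFin (size P)) (λ y → ⟦ FinPoset._≼_ P x y ⟧))

  module _ {Q P : FinPoset} (Q⊆P : Q WeaklyContainedIn P) where

    private
      φ = proj₁ Q⊆P
      φ-injective = proj₁ (proj₂ Q⊆P)
      mono = IsOrderHomomorphism.mono (proj₂ (proj₂ Q⊆P))
      qs = allFin (size Q)
      ps = allFin (size P)
      _≼Q_ = FinPoset._≼_ Q
      _≼P_ = FinPoset._≼_ P

      reindex : ∀ (f : Fin (size P) → ℕ) → ∑ qs (f ∘ φ) ≤ ∑ ps f
      reindex f = ≤-trans (≤-reflexive (sym (∑-map φ qs f)))
        (∑-⊆ f (Uniqₚ.map⁺ φ-injective (Uniqₚ.allFin⁺ (size Q))) (λ {x} _ → Memₚ.∈-allFin x))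

      images≤ : ∑ qs (λ x → ∑ qs (λ y → ⟦ φ x ≼P φ y ⟧)) ≤ relations P
      images≤ = ≤-trans (∑-mono′ qs (λ x → reindex (λ y → ⟦ φ x ≼P y ⟧))) (reindex (λ x → ∑ ps (λ y → ⟦ x ≼P y ⟧)))

    size≤ : size Q ≤ size P
    size≤ = Finₚ.injective⇒≤ φ-injective

    relations≤ : relations Q ≤ relations P
    relations≤ = ≤-trans (∑-mono′ qs (λ x → ∑-mono′ qs (λ y → ⟦⟧-mono mono))) images≤

    -- Equal counts leave no relation of `P` between images beyond those of `Q`, and no point
    -- outside the image.
    tight⇒≅ : size P ≤ size Q → relations P ≤ relations Q → Q ≅ P
    tight⇒≅ s≤ r≤ = φ , record
      { isOrderMonomorphism = record { isOrderHomomorphism = proj₂ (proj₂ Q⊆P) ; injective = φ-injective ; cancel = cancel }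
      ; surjective = surjective }
      where
      open ℕₚ.≤-Reasoning
      extra-relations : ℕ
      extra-relations = ∑ qs (λ x → ∑ qs (λ y → ⟦ φ x ≼P φ y × ¬ (x ≼Q y) ⟧))
      none : extra-relations ≤ 0
      none = +-cancelˡ-≤ (relations Q) _ _ (begin
        relations Q + extra-relations  ≡⟨ trans (sym (∑-+ qs _ _)) (∑-cong qs (λ x → sym (∑-+ qs _ _))) ⟩
        ∑ qs (λ x → ∑ qs (λ y → ⟦ x ≼Q y ⟧ + ⟦ φ x ≼P φ y × ¬ (x ≼Q y) ⟧))  ≤⟨ ∑-mono′ qs (λ x → ∑-mono′ qs (λ y → disjoint x y)) ⟩
        ∑ qs (λ x → ∑ qs (λ y → ⟦ φ x ≼P φ y ⟧))  ≤⟨ images≤ ⟩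
        relations P  ≤⟨ r≤ ⟩
        relations Q  ≡⟨ +-identityʳ _ ⟨
        relations Q + 0  ∎)
        where
        disjoint : ∀ x y → ⟦ x ≼Q y ⟧ + ⟦ φ x ≼P φ y × ¬ (x ≼Q y) ⟧ ≤ ⟦ φ x ≼P φ y ⟧
        disjoint x y with dec (x ≼Q y)
        ... | yes p = ≤-reflexive (trans (cong suc (⟦⟧-false λ q → proj₂ q p)) (sym (⟦⟧-true (mono p))))
        ... | no _  = ⟦⟧-mono proj₁
      cancel : ∀ {x y} → φ x ≼P φ y → x ≼Q y
      cancel {x} {y} p with dec (x ≼Q y)
      ... | yes q = q
      ... | no ¬q = contradiction (begin
        1  ≡⟨ ⟦⟧-true (p , ¬q) ⟨
        ⟦ φ x ≼P φ y × ¬ (x ≼Q y) ⟧  ≤⟨ ∈⇒≤∑ (λ y → ⟦ φ x ≼P φ y × ¬ (x ≼Q y) ⟧) (Memₚ.∈-allFin y) ⟩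
        ∑ qs (λ y → ⟦ φ x ≼P φ y × ¬ (x ≼Q y) ⟧)  ≤⟨ ∈⇒≤∑ (λ x → ∑ qs (λ y → ⟦ φ x ≼P φ y × ¬ (x ≼Q y) ⟧)) (Memₚ.∈-allFin x) ⟩
        extra-relations  ≤⟨ none ⟩
        0  ∎) λ ()
      surjective : ∀ y → ∃[ x ] (∀ {z} → z ≡ x → φ z ≡ y)
      surjective y with dec (∃[ x ] φ x ≡ y)
      ... | yes (x , eq) = x , λ { refl → eq }
      ... | no ¬x = contradiction (begin-strict
        size Q  ≡⟨ length-allFin (size Q) ⟨
        length qs  ≡⟨ Listₚ.length-map φ qs ⟨
        length (map φ qs)  <⟨ unique-⊆⇒length≤ (missed ∷ Uniqₚ.map⁺ φ-injective (Uniqₚ.allFin⁺ (size Q))) (λ {z} _ → Memₚ.∈-allFin z) ⟩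
        length ps  ≡⟨ length-allFin (size P) ⟩
        size P  ≤⟨ s≤ ⟩
        size Q  ∎) (<-irrefl refl)
        where
        import Data.List.Relation.Unary.All as All
        missed : All (y ≢_) (map φ qs)
        missed = All.tabulate λ z∈ e → let x , _ , eq = Memₚ.∈-map⁻ φ z∈ in ¬x (x , trans (sym eq) (sym e))

  ≅⇒size≤ : ∀ {P Q} → P ≅ Q → size Q ≤ size P
  ≅⇒size≤ {P} {Q} (φ , iso) = Finₚ.injective⇒≤ {f = λ y → proj₁ (surjective y)} λ {x} {y} eq →
    trans (sym (proj₂ (surjective x) refl)) (proj₂ (surjective y) (sym (sym eq)))
    where
    surjective : ∀ y → ∃[ x ] (∀ {z} → z ≡ x → φ z ≡ y)
    surjective = IsOrderIsomorphism.surjective iso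

  module _ (em : (A : Set₁) → Dec A) where

    -- By `tight⇒≅`, passing to a nonisomorphic weak subposet lowers size + relations, so the
    -- descent ends at a minimal member.
    minimal-below : ∀ (𝒞 : Pred FinPoset (lsuc 0ℓ)) m P → size P + relations P ≤ m → P ∈ᵖ 𝒞 →
                    Σ[ Q ∈ FinPoset ] Q WeaklyContainedIn P × IsMinimal 𝒞 Q
    minimal-below 𝒞 m P μ≤m P∈ with em (Σ[ Q ∈ FinPoset ] Q ∈ᵖ 𝒞 × Q WeaklyContainedIn P × ¬ (Q ≅ P))
    ... | no ¬smaller = P , WeaklyContainedIn-refl {P} , P∈ , λ Q Q∈ Q⊆P → case dec (Q ≅ P) of λ
      { (yes iso) → iso ; (no ¬iso) → contradiction (Q , Q∈ , Q⊆P , ¬iso) ¬smaller }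
    ... | yes (Q , Q∈ , Q⊆P , ¬iso) = descend m μ≤m
      where
      μ< : size Q + relations Q < size P + relations P
      μ< = ≰⇒> λ le → ¬iso (tight⇒≅ {Q} {P} Q⊆P
        (+-cancelʳ-≤ (relations P) _ _ (≤-trans le (+-monoʳ-≤ (size Q) (relations≤ {Q} {P} Q⊆P))))
        (+-cancelˡ-≤ (size P) _ _ (≤-trans le (+-monoˡ-≤ (relations Q) (size≤ {Q} {P} Q⊆P)))))
      descend : ∀ m → size P + relations P ≤ m → Σ[ Q ∈ FinPoset ] Q WeaklyContainedIn P × IsMinimal 𝒞 Q
      descend zero    le = contradiction (<-≤-trans μ< le) λ ()
      descend (suc m) le = let Q′ , Q′⊆Q , min = minimal-below 𝒞 m Q (≤-pred (<-≤-trans μ< le)) Q∈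
                           in Q′ , WeaklyContainedIn-trans {Q′} {Q} {P} Q′⊆Q Q⊆P , min

    large-minimal : ∀ s → Σ[ Q ∈ FinPoset ] IsMinimal e≡1∧π⁻>1 Q × s < size Q
    large-minimal s = Q , min , ≰⇒> λ small →
      forest-π⁻≤1 es good Q Q⊆P (ℕₚ.m≤n⇒m≤1+n small) (proj₂ (proj₁ min))
      where
      -- The girth bound is s + 1: it covers all subposets of size at most s, and it is positive, as
      -- excluding parallel edges requires.
      G = sparse (suc s) (scale D₁) (scale-positive D₁)
        where
        scale-positive : ∀ D → 0 < scale D
        scale-positive D = *-mono-< {0} {2 * colours q} {0} (*-mono-< {0} {2} {0} z<s (*-mono-< {0} {q} {0} z<s (*-mono-< {0} {q} {0} z<s (m^n>0 3 q)))) z<s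
          where q = 3 + 64 * D
      open SparseGraph G
      es = es₂ ++ es₁
      e₀ : Fin (length es)
      -- The whole vertex set is large, so it is joined to itself and an edge exists.
      e₀ = index (Memₚ.∈-++⁺ʳ es₂ (proj₁ (proj₂ (joined₁ (λ _ → ⊤) (λ _ → ⊤) all all))))
        where
        open import Data.List.Relation.Unary.Any using (index)
        all : t₁ ≤ # {N} (λ _ → ⊤)
        all = begin
          t₁  ≤⟨ m≤n*m t₁ 32 ⟩
          32 * t₁  ≡⟨ N≡32t₁ ⟨
          N  ≡⟨ trans (∑-1 (allFin N)) (length-allFin N) ⟨
          ∑ (allFin N) (λ _ → 1)  ≡⟨ ∑-cong (allFin N) (λ _ → sym (⟦⟧-true tt)) ⟩
          # {N} (λ _ → ⊤)  ∎
          where open ℕₚ.≤-Reasoning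
      P = incidencePoset es
      P∈ : P ∈ᵖ e≡1∧π⁻>1
      P∈ = incidence-e≡1 es good (s≤s z≤n) e₀ , TwoLayerFamily.π⁻>1 G em
      below = minimal-below e≡1∧π⁻>1 (size P + relations P) P ≤-refl P∈
      Q = proj₁ below
      Q⊆P = proj₁ (proj₂ below)
      min = proj₂ (proj₂ below)

    minimals : ℕ → Σ[ Q ∈ FinPoset ] IsMinimal e≡1∧π⁻>1 Q
    minimals zero    = let Q , min , _ = large-minimal 0 in Q , min
    minimals (suc i) = let Q , min , _ = large-minimal (size (proj₁ (minimals i))) in Q , min

    minimals-increasing : ∀ {i j} → i < j → size (proj₁ (minimals i)) < size (proj₁ (minimals j))
    minimals-increasing {i} {suc j} (s≤s i≤j) = ≤-<-trans (weakly (ℕₚ.m≤n⇒m<n∨m≡n i≤j)) (proj₂ (proj₂ (large-minimal (size (proj₁ (minimals j))))))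
      where
      weakly : i < j ⊎ i ≡ j → size (proj₁ (minimals i)) ≤ size (proj₁ (minimals j))
      weakly (inj₁ i<j)  = <⇒≤ (minimals-increasing i<j)
      weakly (inj₂ refl) = ≤-refl

    ≅-sym-size : ∀ {P Q} → P ≅ Q → size P ≤ size Q
    ≅-sym-size {P} {Q} (φ , iso) = Finₚ.injective⇒≤ (IsOrderIsomorphism.injective iso)

    infinitely-many : Σ[ P ∈ (ℕ → FinPoset) ] (∀ i → IsMinimal e≡1∧π⁻>1 (P i)) × (∀ i j → i ≢ j → ¬ (P i ≅ P j))
    infinitely-many = (λ i → proj₁ (minimals i)) , (λ i → proj₂ (minimals i)) , λ i j i≢j iso →
      case ℕₚ.<-cmp i j of λ
        { (tri< i<j _ _) → ℕₚ.<⇒≱ (minimals-increasing i<j) (≅⇒size≤ {proj₁ (minimals i)} {proj₁ (minimals j)} iso)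
        ; (tri≈ _ i≡j _) → i≢j i≡j
        ; (tri> _ _ j<i) → ℕₚ.<⇒≱ (minimals-increasing j<i) (≅-sym-size {proj₁ (minimals i)} {proj₁ (minimals j)} iso) }
      where open import Relation.Binary.Definitions using (tri<; tri≈; tri>)

theorem2 : ExcludedMiddle (lsuc 0ℓ) →
    Σ[ P ∈ (ℕ → FinPoset) ] (∀ i → IsMinimal e≡1∧π⁻>1 (P i)) × (∀ i j → i ≢ j → ¬ (P i ≅ P j))
theorem2 em = Classical.infinitely-many decide (λ A → em {A})
  where
  decide : (A : Set) → Dec A
  decide A = map′ lower lift (em {Lift (lsuc 0ℓ) A})
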